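{- Let $\mathcal I_\nu\subseteq\mathcal I_{int}$ be finite. Every non adjacent 1-$\mathsf{TPTL}$ formula $\psi$ whose clock constraints use intervals from $\mathcal I_\nu$ can be effectively reduced to a non adjacent $\mathsf{PnEMTL}$ formula $\phi$ with $|\phi|=2^{\mathrm{poly}(|\psi|)}$ and arity $O(|\mathcal I_\nu|^2)$ such that $\psi$ is satisfiable if and only if $\phi$ is satisfiable.
   Context: Fix a finite set $\Sigma$ of propositions. A timed word over $\Sigma$ is a finite sequence $\rho=(\sigma_1,\tau_1)\cdots(\sigma_n,\tau_n)$ with $\emptyset\neq\sigma_i\subseteq\Sigma$, $\tau_i\in\mathbb R_{\ge0}$, $\tau_1=0$, $\tau_i\le\tau_j$ for $i\le j$; $dom(\rho)=\{1,\dots,n\}$. A formula is satisfiable iff there is a timed word $\rho$ (over the alphabet of the formula's propositions) with $\rho,1\models$ the formula. $\mathcal I_{int}$ is the set of open, half-open or closed real intervals with endpoints in $\mathbb Z\cup\{ -\infty,\infty\}$. 1-$\mathsf{TPTL}$ (one clock $x$, negation normal form): $\varphi::=a\mid\neg a\mid\top\mid\bot\mid x.\varphi\mid T-x\in I\mid x-T\in I\mid\varphi\wedge\varphi\mid\varphi\vee\varphi\mid\varphi\mathsf{U}\varphi\mid\varphi\mathsf{S}\varphi\mid\mathcal G\varphi\mid\mathcal H\varphi$, $a\in\Sigma$, $I\in\mathcal I_{int}$. Semantics with value $\nu$ of $x$: $\rho,i,\nu\models x.\varphi$ iff $\rho,i,\tau_i\models\varphi$; $T-x\in I$ holds iff $\tau_i-\nu\in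 I$; $x-T\in I$ iff $\nu-\tau_i\in I$; $\varphi_1\mathsf U\varphi_2$ at $i$ iff $\exists j>i$ with $\varphi_2$ at $j$ and $\varphi_1$ at all $i<k<j$; $\mathsf S$ symmetric in the past; $\mathcal G\varphi$ ($\mathcal H\varphi$) iff $\varphi$ at all $j>i$ ($j<i$). $\rho,i\models\varphi$ iff $\rho,i,0\models\varphi$. Size $|\psi|$ = number of $\mathsf U,\mathsf S$, Boolean operators and freeze quantifiers. Non adjacency: intervals $I_1,I_2$ are non adjacent iff $\sup(I_1)=\inf(I_2)$ implies $\sup(I_1)=0$. A set of intervals is non adjacent iff every ordered pair of (not necessarily distinct) members is non adjacent. A 1-$\mathsf{TPTL}$ formula is non adjacent iff for each subformula $x.\varphi$, the set of intervals occurring in clock constraints of $\varphi$ not in the scope of a freeze quantifier inside $\varphi$ is non adjacent (and likewise for constraints not in the scope of any freeze quantifier). $\mathsf{PnEMTL}$: formulae $\varphi::=a\mid\varphi\wedge\varphi\mid\neg\varphi\mid\mathcal F^k_{I_1,\dots,I_k}(\mathsf A_1,\dots,\mathsf A_{k+1})(S)\mid\mathcal P^k_{I_1,\dots,I_k}(\mathsf A_1,\dots,\mathsf A_{k+1})(S)$, where $a$ is a proposition, $k\ge1$, $I_w\in\mathcal I_{int}$, $S$ is a finite set of $\mathsf{PnEMTL}$ formulae and $\mathsf A_w$ are finite automata over $2^S$. With $S_j=\{\theta\in S:\rho,j\models\theta\}$, $\mathsf{Seg}^+(\rho,x,y,S)=S_x\cdots S_y$ and $\mathsf{Seg}^-(\rho,y,x,S)=S_yS_{y-1}\cdots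 S_x$ ($x\le y$): $\rho,i_0\models\mathcal F^k_{I_1..I_k}(\mathsf A_1..\mathsf A_{k+1})(S)$ iff $\exists i_0\le i_1\le\dots\le i_k\le n$ with $\tau_{i_w}-\tau_{i_0}\in I_w$, $\mathsf{Seg}^+(\rho,i_{w-1},i_w,S)\in L(\mathsf A_w)$ ($1\le w\le k$) and $\mathsf{Seg}^+(\rho,i_k,n,S)\in L(\mathsf A_{k+1})$; $\rho,i_0\models\mathcal P^k_{I_1..I_k}(\mathsf A_1..\mathsf A_{k+1})(S)$ iff $\exists i_0\ge i_1\ge\dots\ge i_k\ge1$ with $\tau_{i_0}-\tau_{i_w}\in I_w$, $\mathsf{Seg}^-(\rho,i_{w-1},i_w,S)\in L(\mathsf A_w)$ and $\mathsf{Seg}^-(\rho,i_k,1,S)\in L(\mathsf A_{k+1})$. The arity is the maximal $k$ of its modalities; it is non adjacent iff in every modality $\{I_1,\dots,I_k\}$ is non adjacent. Size: Boolean operators and propositions count 1; $|\mathcal F^k_{\dots}(\mathsf A_1,\dots,\mathsf A_{k+1})(S)|=\sum_{\theta\in S}|\theta|+\sum_w|\mathsf A_w|$ (same for $\mathcal P$).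
   Formalization: In the non adjacency of 1-TPTL formulas a constraint x−T∈I contributes the interval −I rather than I (otherwise punctuality T−x=1 is expressible and the claim fails), and the size |ψ| also counts each G and H, as the U or S it abbreviates. -}

module Defs where

open import Algebra.Bundles using (CommutativeRing)
import Algebra.Definitions.RawMonoid as RawMonoidDefs
open import Data.Fin as Fin using (Fin; inject₁; fromℕ)
import Data.Fin.Properties as Fin
open import Data.Fin.Subset using (Subset; Nonempty; _∈_)
open import Data.Integer as ℤ using (ℤ; +_; -[1+_]; 0ℤ)
import Data.Integer.Properties as ℤ
open import Data.List using (List; []; _∷_; _++_; length; filter; allFin; reverse; foldr; sum; tabulate; map)
open import Data.List.Membership.Propositional using () renaming (_∈_ to _∈ₗ_)
open import Data.List.Relation.Unary.All using (All)
open import Data.Nat as ℕ using (ℕ; zero; suc; _⊔_; NonZero)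
open import Data.Product using (_×_; _,_; ∃; ∃₂)
open import Data.Sum using (_⊎_)
open import Data.Unit using (⊤; tt)
open import Data.Empty using (⊥)
open import Function using (_⇔_)
open import Level using (0ℓ) renaming (suc to lsuc)
open import Relation.Binary using (Rel; IsDecTotalOrder)
open import Relation.Binary.PropositionalEquality using (_≡_)
open import Relation.Nullary using (¬_)
open import Relation.Nullary.Construct.Add.Extrema using (_±; ⊥±; ⊤±; [_])
open import Relation.Nullary.Decidable using (_×-dec_)
open import Relation.Unary using (Pred; Satisfiable)

-- The standard library has no real numbers.  Classically the structures below
-- are exactly ℝ, up to unique isomorphism.  Timed words range over an arbitrary
-- such structure; its decidable order is the only classical principle assumed
-- besides the existence of suprema.

record CompleteOrderedField : Set₁ where
  field
    commutativeRing : CommutativeRing 0ℓ 0ℓ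

  open CommutativeRing commutativeRing public

  infix 4 _≤_ _<_
  field
    _≤_             : Rel Carrier 0ℓ
    isDecTotalOrder : IsDecTotalOrder _≈_ _≤_
    +-monoˡ-≤       : ∀ {x y} z → x ≤ y → x + z ≤ y + z
    *-nonNeg        : ∀ {x y} → 0# ≤ x → 0# ≤ y → 0# ≤ x * y
    0≉1             : ¬ (0# ≈ 1#)
    inverse         : ∀ x → ¬ (x ≈ 0#) → ∃ λ y → x * y ≈ 1#

  _IsUpperBoundOf_ : Carrier → Pred Carrier 0ℓ → Set
  b IsUpperBoundOf P = ∀ x → P x → x ≤ b

  field
    supremum : (P : Pred Carrier 0ℓ) → Satisfiable P → (∃ λ b → b IsUpperBoundOf P) →
               ∃ λ s → s IsUpperBoundOf P × (∀ b → b IsUpperBoundOf P → s ≤ b)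

  _<_ : Rel Carrier 0ℓ
  x < y = x ≤ y × ¬ (x ≈ y)

  fromℤ : ℤ → Carrier
  fromℤ (+ n)    = n ×ᴿ 1#
    where open RawMonoidDefs +-rawMonoid renaming (_×_ to _×ᴿ_)
  fromℤ -[1+ n ] = - fromℤ (+ suc n)

-- Endpoints of intervals; an infinite endpoint is never attained, so that
-- distinct nonempty intervals have distinct representations.

data Lower : Set where
  -∞        : Lower
  closed open′ : ℤ → Lower

data Upper : Set where
  +∞        : Upper
  closed open′ : ℤ → Upper

Consistent : Lower → Upper → Set
Consistent -∞         _          = ⊤
Consistent (closed _) +∞         = ⊤
Consistent (open′ _)  +∞         = ⊤
Consistent (closed a) (closed b) = a ℤ.≤ b
Consistent (closed a) (open′ b)  = a ℤ.< b
Consistent (open′ a)  (closed b) = a ℤ.< b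
Consistent (open′ a)  (open′ b)  = a ℤ.< b

record Interval : Set where
  constructor interval
  field
    lower     : Lower
    upper     : Upper
    .nonempty : Consistent lower upper

open Interval public

inf : Interval → ℤ ±
inf I with lower I
... | -∞       = ⊥±
... | closed a = [ a ]
... | open′ a  = [ a ]

sup : Interval → ℤ ±
sup I with upper I
... | +∞       = ⊤±
... | closed b = [ b ]
... | open′ b  = [ b ]

negLower : Lower → Upper
negLower -∞         = +∞
negLower (closed a) = closed (ℤ.- a)
negLower (open′ a)  = open′ (ℤ.- a)

negUpper : Upper → Lower
negUpper +∞         = -∞
negUpper (closed b) = closed (ℤ.- b)
negUpper (open′ b)  = open′ (ℤ.- b)

neg-consistent : ∀ l u → Consistent l u → Consistent (negUpper u) (negLower l)
neg-consistent -∞         +∞         _ = tt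
neg-consistent -∞         (closed _) _ = tt
neg-consistent -∞         (open′ _)  _ = tt
neg-consistent (closed _) +∞         _ = tt
neg-consistent (open′ _)  +∞         _ = tt
neg-consistent (closed _) (closed _) p = ℤ.neg-mono-≤ p
neg-consistent (closed _) (open′ _)  p = ℤ.neg-mono-< p
neg-consistent (open′ _)  (closed _) p = ℤ.neg-mono-< p
neg-consistent (open′ _)  (open′ _)  p = ℤ.neg-mono-< p

-- { - r ∣ r ∈ I }
negInterval : Interval → Interval
negInterval (interval l u p) = interval (negUpper u) (negLower l) (neg-consistent l u p)

NonAdjacent : Interval → Interval → Set
NonAdjacent I J = sup I ≡ inf J → sup I ≡ [ 0ℤ ]

NonAdjacentSet : List Interval → Set
NonAdjacentSet Is = ∀ {I J} → I ∈ₗ Is → J ∈ₗ Is → NonAdjacent I J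

-- The index m carries the alphabet: a formula in TPTL m or PnEMTL m is over the
-- propositions Fin m and is interpreted over timed words on that alphabet.

data TPTL (m : ℕ) : Set where
  prop ¬prop : Fin m → TPTL m
  true false : TPTL m
  x∙_        : TPTL m → TPTL m
  T-x∈_ x-T∈_ : Interval → TPTL m
  _∧_ _∨_    : TPTL m → TPTL m → TPTL m
  _U_ _S_    : TPTL m → TPTL m → TPTL m
  G_ H_      : TPTL m → TPTL m

-- G and H, the negation normal forms of ¬ (⊤ U ¬ _) and ¬ (⊤ S ¬ _), are counted
-- like the U or S they stand for.  Otherwise all of a, G a, G G a, … would
-- have size 0.
sizeᵀ : ∀ {m} → TPTL m → ℕ
sizeᵀ (prop a)  = 0
sizeᵀ (¬prop a) = 1
sizeᵀ true      = 0
sizeᵀ false     = 0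
sizeᵀ (x∙ φ)    = suc (sizeᵀ φ)
sizeᵀ (T-x∈ I)  = 0
sizeᵀ (x-T∈ I)  = 0
sizeᵀ (φ ∧ χ)   = suc (sizeᵀ φ ℕ.+ sizeᵀ χ)
sizeᵀ (φ ∨ χ)   = suc (sizeᵀ φ ℕ.+ sizeᵀ χ)
sizeᵀ (φ U χ)   = suc (sizeᵀ φ ℕ.+ sizeᵀ χ)
sizeᵀ (φ S χ)   = suc (sizeᵀ φ ℕ.+ sizeᵀ χ)
sizeᵀ (G φ)     = suc (sizeᵀ φ)
sizeᵀ (H φ)     = suc (sizeᵀ φ)

intervals : ∀ {m} → TPTL m → List Interval
intervals (prop a)  = []
intervals (¬prop a) = []
intervals true      = []
intervals false     = []
intervals (x∙ φ)    = intervals φ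
intervals (T-x∈ I)  = I ∷ []
intervals (x-T∈ I)  = I ∷ []
intervals (φ ∧ χ)   = intervals φ ++ intervals χ
intervals (φ ∨ χ)   = intervals φ ++ intervals χ
intervals (φ U χ)   = intervals φ ++ intervals χ
intervals (φ S χ)   = intervals φ ++ intervals χ
intervals (G φ)     = intervals φ
intervals (H φ)     = intervals φ

-- The intervals to which T - x is constrained outside the scope of any freeze
-- quantifier.  The constraint x - T ∈ I is T - x ∈ - I and contributes - I.
-- With I itself in its place non adjacency would not exclude punctuality:
-- (0,1] and (-2,-1] are non adjacent, but T - x ∈ (0,1] ∧ x - T ∈ (-2,-1]
-- says T - x = 1.
freeIntervals : ∀ {m} → TPTL m → List Interval
freeIntervals (prop a)  = []
freeIntervals (¬prop a) = []
freeIntervals true      = []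
freeIntervals false     = []
freeIntervals (x∙ φ)    = []
freeIntervals (T-x∈ I)  = I ∷ []
freeIntervals (x-T∈ I)  = negInterval I ∷ []
freeIntervals (φ ∧ χ)   = freeIntervals φ ++ freeIntervals χ
freeIntervals (φ ∨ χ)   = freeIntervals φ ++ freeIntervals χ
freeIntervals (φ U χ)   = freeIntervals φ ++ freeIntervals χ
freeIntervals (φ S χ)   = freeIntervals φ ++ freeIntervals χ
freeIntervals (G φ)     = freeIntervals φ
freeIntervals (H φ)     = freeIntervals φ

NonAdjacentFreezes : ∀ {m} → TPTL m → Set
NonAdjacentFreezes (prop a)  = ⊤
NonAdjacentFreezes (¬prop a) = ⊤
NonAdjacentFreezes true      = ⊤
NonAdjacentFreezes false     = ⊤
NonAdjacentFreezes (x∙ φ)    = NonAdjacentSet (freeIntervals φ) × NonAdjacentFreezes φ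
NonAdjacentFreezes (T-x∈ I)  = ⊤
NonAdjacentFreezes (x-T∈ I)  = ⊤
NonAdjacentFreezes (φ ∧ χ)   = NonAdjacentFreezes φ × NonAdjacentFreezes χ
NonAdjacentFreezes (φ ∨ χ)   = NonAdjacentFreezes φ × NonAdjacentFreezes χ
NonAdjacentFreezes (φ U χ)   = NonAdjacentFreezes φ × NonAdjacentFreezes χ
NonAdjacentFreezes (φ S χ)   = NonAdjacentFreezes φ × NonAdjacentFreezes χ
NonAdjacentFreezes (G φ)     = NonAdjacentFreezes φ
NonAdjacentFreezes (H φ)     = NonAdjacentFreezes φ

NonAdjacentᵀ : ∀ {m} → TPTL m → Set
NonAdjacentᵀ φ = NonAdjacentSet (freeIntervals φ) × NonAdjacentFreezes φ

-- A letter is a subset of an s-element set; transitions are counted in the size.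

record NFA (s : ℕ) : Set where
  field
    states        : ℕ
    initial final : Subset states
    transitions   : List (Fin states × Subset s × Fin states)

open NFA public

sizeᴬ : ∀ {s} → NFA s → ℕ
sizeᴬ A = states A ℕ.+ length (transitions A)

AcceptsFrom : ∀ {s} (A : NFA s) → Fin (states A) → List (Subset s) → Set
AcceptsFrom A q []      = q ∈ final A
AcceptsFrom A q (a ∷ w) = ∃ λ q′ → (q , a , q′) ∈ₗ transitions A × AcceptsFrom A q′ w

_∈L_ : ∀ {s} → List (Subset s) → NFA s → Set
w ∈L A = ∃ λ q → q ∈ initial A × AcceptsFrom A q w

-- In 𝓕 k I A Θ the set Θ is an indexed family
-- of s formulae, and A zero, …, A k are the automata A₁, …, A_{k+1}.

data PnEMTL (m : ℕ) : Set where
  prop : Fin m → PnEMTL m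
  _∧_  : PnEMTL m → PnEMTL m → PnEMTL m
  ¬′_  : PnEMTL m → PnEMTL m
  𝓕 𝓟  : (k : ℕ) .{{_ : NonZero k}} (I : Fin k → Interval)
         {s : ℕ} (A : Fin (suc k) → NFA s) (Θ : Fin s → PnEMTL m) → PnEMTL m

sizeᴾ : ∀ {m} → PnEMTL m → ℕ
sizeᴾ (prop a)    = 1
sizeᴾ (φ ∧ χ)     = suc (sizeᴾ φ ℕ.+ sizeᴾ χ)
sizeᴾ (¬′ φ)      = suc (sizeᴾ φ)
sizeᴾ (𝓕 k I A Θ) = sum (tabulate λ t → sizeᴾ (Θ t)) ℕ.+ sum (tabulate λ w → sizeᴬ (A w))
sizeᴾ (𝓟 k I A Θ) = sum (tabulate λ t → sizeᴾ (Θ t)) ℕ.+ sum (tabulate λ w → sizeᴬ (A w))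

arity : ∀ {m} → PnEMTL m → ℕ
arity (prop a)    = 0
arity (φ ∧ χ)     = arity φ ⊔ arity χ
arity (¬′ φ)      = arity φ
arity (𝓕 k I A Θ) = k ⊔ foldr _⊔_ 0 (tabulate λ t → arity (Θ t))
arity (𝓟 k I A Θ) = k ⊔ foldr _⊔_ 0 (tabulate λ t → arity (Θ t))

NonAdjacentᴾ : ∀ {m} → PnEMTL m → Set
NonAdjacentᴾ (prop a)    = ⊤
NonAdjacentᴾ (φ ∧ χ)     = NonAdjacentᴾ φ × NonAdjacentᴾ χ
NonAdjacentᴾ (¬′ φ)      = NonAdjacentᴾ φ
NonAdjacentᴾ (𝓕 k I A Θ) = NonAdjacentSet (tabulate I) × (∀ t → NonAdjacentᴾ (Θ t))
NonAdjacentᴾ (𝓟 k I A Θ) = NonAdjacentSet (tabulate I) × (∀ t → NonAdjacentᴾ (Θ t))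

module Semantics (ℝ : CompleteOrderedField) where

  open CompleteOrderedField ℝ

  AboveLower : Carrier → Lower → Set
  AboveLower r -∞         = ⊤
  AboveLower r (closed a) = fromℤ a ≤ r
  AboveLower r (open′ a)  = fromℤ a < r

  BelowUpper : Carrier → Upper → Set
  BelowUpper r +∞         = ⊤
  BelowUpper r (closed b) = r ≤ fromℤ b
  BelowUpper r (open′ b)  = r < fromℤ b

  infix 4 _∈ᴵ_
  _∈ᴵ_ : Carrier → Interval → Set
  r ∈ᴵ I = AboveLower r (lower I) × BelowUpper r (upper I)

  -- Nonempty timed words, since satisfaction is only evaluated at a position;
  -- the positions 1, …, n are the elements of Fin (suc end).
  record TimedWord (m : ℕ) : Set where
    field
      end        : ℕ
      σ          : Fin (suc end) → Subset m
      τ          : Fin (suc end) → Carrier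
      σ-nonempty : ∀ i → Nonempty (σ i)
      τ-nonneg   : ∀ i → 0# ≤ τ i
      τ-start    : τ Fin.zero ≈ 0#
      τ-mono     : ∀ {i j} → i Fin.≤ j → τ i ≤ τ j

    Pos : Set
    Pos = Fin (suc end)

    first last : Pos
    first = Fin.zero
    last  = fromℕ end

  open TimedWord public

  _,_,_⊨ᵀ_ : ∀ {m} (ρ : TimedWord m) → Pos ρ → Carrier → TPTL m → Set
  ρ , i , ν ⊨ᵀ prop a   = a ∈ σ ρ i
  ρ , i , ν ⊨ᵀ ¬prop a  = ¬ (a ∈ σ ρ i)
  ρ , i , ν ⊨ᵀ true     = ⊤
  ρ , i , ν ⊨ᵀ false    = ⊥
  ρ , i , ν ⊨ᵀ (x∙ φ)   = ρ , i , τ ρ i ⊨ᵀ φ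
  ρ , i , ν ⊨ᵀ (T-x∈ I) = τ ρ i - ν ∈ᴵ I
  ρ , i , ν ⊨ᵀ (x-T∈ I) = ν - τ ρ i ∈ᴵ I
  ρ , i , ν ⊨ᵀ (φ ∧ χ)  = (ρ , i , ν ⊨ᵀ φ) × (ρ , i , ν ⊨ᵀ χ)
  ρ , i , ν ⊨ᵀ (φ ∨ χ)  = (ρ , i , ν ⊨ᵀ φ) ⊎ (ρ , i , ν ⊨ᵀ χ)
  ρ , i , ν ⊨ᵀ (φ U χ)  = ∃ λ j → i Fin.< j × (ρ , j , ν ⊨ᵀ χ) ×
                            (∀ k → i Fin.< k → k Fin.< j → ρ , k , ν ⊨ᵀ φ)
  ρ , i , ν ⊨ᵀ (φ S χ)  = ∃ λ j → j Fin.< i × (ρ , j , ν ⊨ᵀ χ) ×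
                            (∀ k → j Fin.< k → k Fin.< i → ρ , k , ν ⊨ᵀ φ)
  ρ , i , ν ⊨ᵀ (G φ)    = ∀ j → i Fin.< j → ρ , j , ν ⊨ᵀ φ
  ρ , i , ν ⊨ᵀ (H φ)    = ∀ j → j Fin.< i → ρ , j , ν ⊨ᵀ φ

  Satisfiableᵀ : ∀ {m} → TPTL m → Set
  Satisfiableᵀ {m} φ = ∃ λ (ρ : TimedWord m) → ρ , first ρ , 0# ⊨ᵀ φ

  -- Seg⁺ f x y = f x, …, f y  and  Seg⁻ f y x = f y, …, f x  for x ≤ y
  Seg⁺ Seg⁻ : ∀ {n s} → (Fin n → Subset s) → Fin n → Fin n → List (Subset s)
  Seg⁺ {n} f x y = map f (filter (λ j → (x Fin.≤? j) ×-dec (j Fin.≤? y)) (allFin n))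
  Seg⁻ f y x     = reverse (Seg⁺ f x y)

  -- Here f j is the set of members of Θ true at j.
  module _ {m s : ℕ} (ρ : TimedWord m) (f : Pos ρ → Subset s) (i₀ : Pos ρ) where

    FutureWitness : ∀ k → (Fin k → Interval) → (Fin (suc k) → NFA s) → Set
    FutureWitness k I A = ∃ λ (i : Fin (suc k) → Pos ρ) →
      i Fin.zero ≡ i₀ ×
      (∀ w → i (inject₁ w) Fin.≤ i (Fin.suc w)) ×
      (∀ w → τ ρ (i (Fin.suc w)) - τ ρ i₀ ∈ᴵ I w) ×
      (∀ w → Seg⁺ f (i (inject₁ w)) (i (Fin.suc w)) ∈L A (inject₁ w)) ×
      Seg⁺ f (i (fromℕ k)) (last ρ) ∈L A (fromℕ k)

    PastWitness : ∀ k → (Fin k → Interval) → (Fin (suc k) → NFA s) → Set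
    PastWitness k I A = ∃ λ (i : Fin (suc k) → Pos ρ) →
      i Fin.zero ≡ i₀ ×
      (∀ w → i (Fin.suc w) Fin.≤ i (inject₁ w)) ×
      (∀ w → τ ρ i₀ - τ ρ (i (Fin.suc w)) ∈ᴵ I w) ×
      (∀ w → Seg⁻ f (i (inject₁ w)) (i (Fin.suc w)) ∈L A (inject₁ w)) ×
      Seg⁻ f (i (fromℕ k)) (first ρ) ∈L A (fromℕ k)

  -- The first component determines f uniquely: f j = { θ ∈ Θ ∣ ρ , j ⊨ θ }.
  _,_⊨ᴾ_ : ∀ {m} (ρ : TimedWord m) → Pos ρ → PnEMTL m → Set
  ρ , i ⊨ᴾ prop a          = a ∈ σ ρ i
  ρ , i ⊨ᴾ (φ ∧ χ)         = (ρ , i ⊨ᴾ φ) × (ρ , i ⊨ᴾ χ)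
  ρ , i ⊨ᴾ (¬′ φ)          = ¬ (ρ , i ⊨ᴾ φ)
  ρ , i ⊨ᴾ 𝓕 k I {s} A Θ   = ∃ λ (f : Pos ρ → Subset s) →
    (∀ j t → t ∈ f j ⇔ (ρ , j ⊨ᴾ Θ t)) × FutureWitness ρ f i k I A
  ρ , i ⊨ᴾ 𝓟 k I {s} A Θ   = ∃ λ (f : Pos ρ → Subset s) →
    (∀ j t → t ∈ f j ⇔ (ρ , j ⊨ᴾ Θ t)) × PastWitness ρ f i k I A

  Satisfiableᴾ : ∀ {m} → PnEMTL m → Set
  Satisfiableᴾ {m} φ = ∃ λ (ρ : TimedWord m) → ρ , first ρ ⊨ᴾ φ

-- The polynomial with the given coefficients, constant term first
evalPoly : List ℕ → ℕ → ℕ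
evalPoly p n = foldr (λ c r → c ℕ.+ n ℕ.* r) 0 p

module Submission where

-- At a freeze point i, x∙ φ is an LTL formula over letters and interval constraints on
-- the time elapsed since i.  It holds iff some Hintikka labelling of all positions by
-- sets of claimed subformulas claims φ at i.  As φ is in negation normal form, claiming
-- a constraint only requires it to hold, never to fail, and by convexity a claim at j is
-- certified by one point at or before j and one at or after j in the interval.  So on
-- either side of i the first and last position in each of the n intervals suffice; they
-- become the points of a modality with k = 2n + 1, one of them trivial.  Its automata
-- check the labelling between consecutive points.  The disjunction ranges over the
-- labels and intervals of the points and over the label at i, which joins the past to
-- the future.  Only intervals of φ, their negatives and (-∞,∞) occur, so non adjacency
-- is inherited.

open import Defs
open import Data.Nat using (ℕ; _≤_; _*_; _^_; _⊔_)
open import Data.List using (List; length)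
open import Data.List.Membership.Propositional using (_∈_)
open import Data.List.Relation.Unary.All using (All)
open import Data.List.Relation.Unary.Unique.Propositional using (Unique)
open import Data.Product using (_×_; ∃; ∃₂)
open import Function using (_⇔_)

import Algebra.Properties.Ring as RingProperties
open import Data.Bool as Bool using (Bool; true; false; T)
import Data.Bool.Properties as Bool
open import Data.Empty using (⊥; ⊥-elim)
open import Data.Fin as Fin using (Fin; toℕ; fromℕ; inject₁; _↑ˡ_; _↑ʳ_; splitAt)
open import Data.Fin.Induction using (<-weakInduction; >-weakInduction)
import Data.Fin.Properties as Fin
open import Data.Fin.Subset using (Subset; ⁅_⁆) renaming (_∈_ to _∈ˢ_)
open import Data.Fin.Subset.Properties using (x∈⁅x⁆; x∈⁅y⁆⇒x≡y; ⊆-antisym; _∈?_)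
open import Data.Integer as ℤ using (ℤ; +_; -[1+_])
import Data.Integer.Properties as ℤ
open import Data.List
  using ([]; _∷_; _++_; map; filter; foldr; reverse; lookup; tabulate; deduplicate; allFin; cartesianProduct; cartesianProductWith)
import Data.List.Membership.DecPropositional as DecMembership
open import Data.List.Membership.Propositional.Properties
  using (∈-allFin; ∈-map⁺; ∈-map⁻; ∈-++⁺ˡ; ∈-++⁺ʳ; ∈-++⁻; ∈-∃++; ∈-filter⁺; ∈-filter⁻; ∈-tabulate⁻;
         ∈-cartesianProduct⁺; ∈-cartesianProduct⁻; ∈-cartesianProductWith⁺; ∈-cartesianProductWith⁻;
         ∈-deduplicate⁺; ∈-deduplicate⁻)
open import Data.List.Properties
  using (filter-accept; filter-reject; filter-none; map-++; map-cong; reverse-++;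
         length-map; length-++; length-++-sucʳ; length-filter; length-tabulate; length-deduplicate)
open import Data.List.Relation.Unary.All as All using ([]; _∷_)
import Data.List.Relation.Unary.All.Properties as All
open import Data.List.Relation.Unary.AllPairs using (AllPairs; []; _∷_)
import Data.List.Relation.Unary.AllPairs.Properties as AllPairs
open import Data.List.Relation.Unary.Any as Any using (here; there)
open import Data.List.Relation.Unary.Any.Properties using (lookup-index)
import Data.List.Relation.Unary.Unique.DecPropositional.Properties as Unique
open import Data.Nat as ℕ using (zero; suc; _+_; z≤n; s≤s; NonZero)
open import Data.Nat.ListAction using (sum)
import Data.Nat.Properties as ℕ
open import Data.Nat.Tactic.RingSolver using (solve-∀)
open import Data.Product as Product using (_,_; proj₁; proj₂)
open import Data.Product.Properties using (≡-dec)
open import Data.Sum as Sum using (_⊎_; inj₁; inj₂)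
open import Data.Unit using (⊤; tt)
open import Data.Vec as Vec using (Vec; []; _∷_)
import Data.Vec.Functional as Vector
import Data.Vec.Functional.Properties as Vector
open import Data.Vec.Membership.Propositional using () renaming (_∈_ to _∈ᵥ_)
import Data.Vec.Properties as Vec
open import Data.Vec.Relation.Unary.All as VecAll using ([]; _∷_)
import Data.Vec.Relation.Unary.All.Properties as VecAll
open import Data.Vec.Relation.Unary.Any using (here; there)
open import Function using (id; _∘_; flip; mk⇔; Equivalence)
open import Relation.Binary using (DecidableEquality; IsDecTotalOrder)
open import Relation.Binary.PropositionalEquality
  using (_≡_; _≢_; refl; sym; trans; cong; cong₂; subst; subst₂; module ≡-Reasoning)
import Relation.Binary.Reasoning.Setoid as SetoidReasoning
open import Relation.Nullary using (¬_; Dec; yes; no; does)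
open import Relation.Nullary.Construct.Add.Extrema using (_±; ⊥±; ⊤±; [_])
open import Relation.Nullary.Decidable
  using (_×-dec_; _⊎-dec_; _→-dec_; ¬?; map′; isYes; isNo; toWitness; fromWitness; toWitnessFalse; fromWitnessFalse;
         dec-true; decidable-stable)

-- Directions and segments

-- A modality holds only together with a labelling of all positions by the true members of its set,
-- and that labelling has to be produced. Here the members are nested translations, so their truth
-- must be decidable at every position. Decidability of a translation is obtained from its
-- correctness, and its correctness from the labelling; hence both are proved in one recursion over
-- the formula. The same decidability removes the double negations that come from writing
-- disjunction with negation and conjunction.
--
-- An automaton sees letters but no time stamps. What it can know about time is which points have
-- been passed and which are still to come, and this is fixed in its construction by two lists of
-- intervals.
--
-- For the size, a body of size n has 2^O(n) types and O(n) points, so a disjunction has 2^O(n^2)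
-- members. Each member contains the nested translations once, so a freeze quantifier multiplies the
-- size by 2^O(n^2). In the exponent this is a sum over at most n + 1 levels, which gives a cubic
-- polynomial.

data Dir : Set where
  fut past : Dir

opp : Dir → Dir
opp fut  = past
opp past = fut

module _ {n : ℕ} where

  Before AtOrBefore Adjacent : Dir → Fin (suc n) → Fin (suc n) → Set
  Before fut  p q = p Fin.< q
  Before past p q = q Fin.< p
  AtOrBefore fut  p q = p Fin.≤ q
  AtOrBefore past p q = q Fin.≤ p
  Adjacent fut  p q = suc (toℕ p) ≡ toℕ q
  Adjacent past p q = suc (toℕ q) ≡ toℕ p

  endpoint : Dir → Fin (suc n)
  endpoint fut  = fromℕ n
  endpoint past = Fin.zero

  ≼-refl : ∀ d {p} → AtOrBefore d p p
  ≼-refl fut  = ℕ.≤-refl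
  ≼-refl past = ℕ.≤-refl

  ≼-trans : ∀ d {p q r} → AtOrBefore d p q → AtOrBefore d q r → AtOrBefore d p r
  ≼-trans fut  p≼q q≼r = ℕ.≤-trans p≼q q≼r
  ≼-trans past p≼q q≼r = ℕ.≤-trans q≼r p≼q

  ≼-antisym : ∀ d {p q} → AtOrBefore d p q → AtOrBefore d q p → p ≡ q
  ≼-antisym fut  p≼q q≼p = Fin.≤-antisym p≼q q≼p
  ≼-antisym past p≼q q≼p = Fin.≤-antisym q≼p p≼q

  ≺⇒≼ : ∀ d {p q} → Before d p q → AtOrBefore d p q
  ≺⇒≼ fut  = ℕ.<⇒≤
  ≺⇒≼ past = ℕ.<⇒≤

  ≺⇒⋡ : ∀ d {p q} → Before d p q → ¬ AtOrBefore d q p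
  ≺⇒⋡ fut  = ℕ.<⇒≱
  ≺⇒⋡ past = ℕ.<⇒≱

  ≺-≼-trans : ∀ d {p q r} → Before d p q → AtOrBefore d q r → Before d p r
  ≺-≼-trans fut  p≺q q≼r = ℕ.<-≤-trans p≺q q≼r
  ≺-≼-trans past p≺q q≼r = ℕ.≤-<-trans q≼r p≺q

  ≼-≺-trans : ∀ d {p q r} → AtOrBefore d p q → Before d q r → Before d p r
  ≼-≺-trans fut  p≼q q≺r = ℕ.≤-<-trans p≼q q≺r
  ≼-≺-trans past p≼q q≺r = ℕ.<-≤-trans q≺r p≼q

  ≼⇒≡⊎≺ : ∀ d {p q} → AtOrBefore d p q → p ≡ q ⊎ Before d p q
  ≼⇒≡⊎≺ fut {p} {q} p≼q with p Fin.≟ q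
  ... | yes p≡q = inj₁ p≡q
  ... | no  p≢q = inj₂ (Fin.≤∧≢⇒< p≼q p≢q)
  ≼⇒≡⊎≺ past {p} {q} q≼p with p Fin.≟ q
  ... | yes p≡q = inj₁ p≡q
  ... | no  p≢q = inj₂ (Fin.≤∧≢⇒< q≼p (p≢q ∘ sym))

  ≺? : ∀ d p q → Dec (Before d p q)
  ≺? fut  p q = p Fin.<? q
  ≺? past p q = q Fin.<? p

  ≼? : ∀ d p q → Dec (AtOrBefore d p q)
  ≼? fut  p q = p Fin.≤? q
  ≼? past p q = q Fin.≤? p

  ⊀⇒≽ : ∀ d {p q} → ¬ Before d p q → AtOrBefore d q p
  ⊀⇒≽ fut  = ℕ.≮⇒≥
  ⊀⇒≽ past = ℕ.≮⇒≥

  ≼-opp : ∀ d {p q} → AtOrBefore d p q → AtOrBefore (opp d) q p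
  ≼-opp fut  = id
  ≼-opp past = id

  ≼-opp⁻ : ∀ d {p q} → AtOrBefore (opp d) p q → AtOrBefore d q p
  ≼-opp⁻ fut  = id
  ≼-opp⁻ past = id

  adjacent⇒≺ : ∀ d {p q} → Adjacent d p q → Before d p q
  adjacent⇒≺ fut  = ℕ.≤-reflexive
  adjacent⇒≺ past = ℕ.≤-reflexive

  adjacent-≺⇒≼ : ∀ d {p q r} → Adjacent d p q → Before d p r → AtOrBefore d q r
  adjacent-≺⇒≼ fut  pq p≺r = subst (ℕ._≤ _) pq p≺r
  adjacent-≺⇒≼ past pq p≺r = ℕ.s≤s⁻¹ (subst (_ ℕ.<_) (sym pq) p≺r)

  ≼-endpoint : ∀ d p → AtOrBefore d p (endpoint d)
  ≼-endpoint fut  p = Fin.≤fromℕ p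
  ≼-endpoint past p = z≤n

  -- The induction starts at the far end because that is where eventualities must have been met,
  -- universal claims are vacuous, and automata stop.
  towardsEndpoint : ∀ d (P : Fin (suc n) → Set) → P (endpoint d) →
                    (∀ p q → Adjacent d p q → P q → P p) → ∀ p → P p
  towardsEndpoint fut  P base step =
    >-weakInduction P base λ i → step (inject₁ i) (Fin.suc i) (cong suc (Fin.toℕ-inject₁ i))
  towardsEndpoint past P base step =
    <-weakInduction P base λ i → step (Fin.suc i) (inject₁ i) (cong suc (Fin.toℕ-inject₁ i))

  next : ∀ d p → p ≡ endpoint d ⊎ ∃ (Adjacent d p)
  next d = towardsEndpoint d (λ p → p ≡ endpoint d ⊎ ∃ (Adjacent d p)) (inj₁ refl)
             λ p q pq _ → inj₂ (q , pq)

  LastFrom : Dir → (Fin (suc n) → Set) → Fin (suc n) → Set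
  LastFrom d P p = (∃ λ q → AtOrBefore d p q × P q × (∀ r → AtOrBefore d p r → P r → AtOrBefore d r q))
                   ⊎ (∀ q → AtOrBefore d p q → ¬ P q)

  last-satisfying : ∀ d (P : Fin (suc n) → Set) → (∀ p → Dec (P p)) → ∀ p → LastFrom d P p
  last-satisfying d P P? = towardsEndpoint d (LastFrom d P) base step
    where
    base : _
    base with P? (endpoint d)
    ... | yes h = inj₁ (_ , ≼-refl d , h , λ r _ _ → ≼-endpoint d r)
    ... | no ¬h = inj₂ λ q e≼q h → ¬h (subst P (≼-antisym d (≼-endpoint d q) e≼q) h)
    step : _
    step p p′ adj (inj₁ (q , p′≼q , h , max)) =
      inj₁ (q , ≼-trans d p≼p′ p′≼q , h , max′)
      where
      p≼p′ = ≺⇒≼ d (adjacent⇒≺ d adj)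
      max′ : _
      max′ r p≼r hr with ≼⇒≡⊎≺ d p≼r
      ... | inj₁ refl = ≼-trans d p≼p′ p′≼q
      ... | inj₂ p≺r  = max r (adjacent-≺⇒≼ d adj p≺r) hr
    step p p′ adj (inj₂ none) with P? p
    ... | yes h = inj₁ (p , ≼-refl d , h , max′)
      where
      max′ : _
      max′ r p≼r hr with ≼⇒≡⊎≺ d p≼r
      ... | inj₁ refl = ≼-refl d
      ... | inj₂ p≺r  = ⊥-elim (none r (adjacent-≺⇒≼ d adj p≺r) hr)
    ... | no ¬h = inj₂ none′
      where
      none′ : ∀ q → AtOrBefore d p q → ¬ P q
      none′ q p≼q with ≼⇒≡⊎≺ d p≼q
      ... | inj₁ refl = ¬h
      ... | inj₂ p≺q  = none q (adjacent-≺⇒≼ d adj p≺q)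

  -- Spelled as in `Seg⁺`, which is thus by definition the image of `range` under `map`.
  range : Fin (suc n) → Fin (suc n) → List (Fin (suc n))
  range x y = filter (λ j → (x Fin.≤? j) ×-dec (j Fin.≤? y)) (allFin (suc n))

  private
    Between : Fin (suc n) → Fin (suc n) → Fin (suc n) → Set
    Between x y j = x Fin.≤ j × j Fin.≤ y

    between? : ∀ x y j → Dec (Between x y j)
    between? x y j = (x Fin.≤? j) ×-dec (j Fin.≤? y)

    sorted : AllPairs Fin._<_ (allFin (suc n))
    sorted = AllPairs.tabulate⁺-< id

  filter-cong : ∀ {P Q : Fin (suc n) → Set} (P? : ∀ j → Dec (P j)) (Q? : ∀ j → Dec (Q j)) {js} →
                All (λ j → (P j → Q j) × (Q j → P j)) js → filter P? js ≡ filter Q? js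
  filter-cong P? Q? [] = refl
  filter-cong P? Q? {j ∷ js} ((p⇒q , q⇒p) ∷ h) with P? j
  ... | yes p = trans (cong (j ∷_) (filter-cong P? Q? h)) (sym (filter-accept Q? (p⇒q p)))
  ... | no ¬p = trans (filter-cong P? Q? h) (sym (filter-reject Q? (¬p ∘ q⇒p)))

  -- `allFin` is strictly increasing: entries before `x` fail both tests, and after `x` the lower
  -- bounds `x` and `x′` admit the same entries. If `x` is `y`, the remaining filter is empty.
  range-cons : ∀ {x x′ y} → suc (toℕ x) ≡ toℕ x′ → x Fin.≤ y → range x y ≡ x ∷ filter (between? x′ y) (allFin (suc n))
  range-cons {x} {x′} {y} xx′ x≤y = go _ sorted (∈-allFin x)
    where
    go : ∀ js → AllPairs Fin._<_ js → x ∈ js →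
         filter (between? x y) js ≡ x ∷ filter (between? x′ y) js
    go (j ∷ js) (j< ∷ _) (here refl) = begin
      filter (between? x y) (x ∷ js)      ≡⟨ filter-accept (between? x y) (ℕ.≤-refl , x≤y) ⟩
      x ∷ filter (between? x y) js        ≡⟨ cong (x ∷_) (filter-cong (between? x y) (between? x′ y) (All.map equiv j<)) ⟩
      x ∷ filter (between? x′ y) js       ≡⟨ cong (x ∷_) (sym (filter-reject (between? x′ y) λ h → ℕ.<⇒≱ (ℕ.≤-reflexive xx′) (proj₁ h))) ⟩
      x ∷ filter (between? x′ y) (x ∷ js) ∎
      where
      open ≡-Reasoning
      equiv : ∀ {j} → x Fin.< j → (Between x y j → Between x′ y j) × (Between x′ y j → Between x y j)
      equiv x<j = (λ h → adjacent-≺⇒≼ fut xx′ x<j , proj₂ h) , (λ h → ℕ.<⇒≤ x<j , proj₂ h)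
    go (j ∷ js) (j< ∷ srt) (there x∈) = begin
      filter (between? x y) (j ∷ js)      ≡⟨ filter-reject (between? x y) (λ h → ℕ.<⇒≱ j<x (proj₁ h)) ⟩
      filter (between? x y) js            ≡⟨ go js srt x∈ ⟩
      x ∷ filter (between? x′ y) js       ≡⟨ cong (x ∷_) (sym (filter-reject (between? x′ y) λ h → ℕ.<⇒≱ (ℕ.<-trans j<x (ℕ.≤-reflexive xx′)) (proj₁ h))) ⟩
      x ∷ filter (between? x′ y) (j ∷ js) ∎
      where
      open ≡-Reasoning
      j<x = All.lookup j< x∈

  range-singleton : ∀ x → range x x ≡ x ∷ []
  range-singleton x = go _ sorted (∈-allFin x)
    where
    go : ∀ js → AllPairs Fin._<_ js → x ∈ js → filter (between? x x) js ≡ x ∷ []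
    go (j ∷ js) (j< ∷ _) (here refl) =
      trans (filter-accept (between? x x) (ℕ.≤-refl , ℕ.≤-refl))
            (cong (x ∷_) (filter-none (between? x x) (All.map (λ x<j h → ℕ.<⇒≱ x<j (proj₂ h)) j<)))
    go (j ∷ js) (j< ∷ srt) (there x∈) =
      trans (filter-reject (between? x x) (λ h → ℕ.<⇒≱ (All.lookup j< x∈) (proj₁ h))) (go js srt x∈)

  -- A past segment is a reversed range, so its first letter comes from the last entry of the range.
  range-snoc : ∀ {y′ y} → suc (toℕ y′) ≡ toℕ y → ∀ x → x Fin.≤ y′ → range x y ≡ range x y′ ++ y ∷ []
  range-snoc {y′} {y} y′y = towardsEndpoint fut _ base step
    where
    single : range y′ y ≡ range y′ y′ ++ y ∷ []
    single = begin
      range y′ y            ≡⟨ range-cons y′y (ℕ.<⇒≤ (ℕ.≤-reflexive y′y)) ⟩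
      y′ ∷ range y y        ≡⟨ cong (y′ ∷_) (range-singleton y) ⟩
      y′ ∷ y ∷ []           ≡⟨ cong (_++ y ∷ []) (sym (range-singleton y′)) ⟩
      range y′ y′ ++ y ∷ [] ∎
      where open ≡-Reasoning
    base : _
    base e≤y′ with ≼-antisym fut (≼-endpoint fut y′) e≤y′
    ... | refl = single
    step : _
    step x x′ xx′ ih x≤y′ with ≼⇒≡⊎≺ fut x≤y′
    ... | inj₁ refl = single
    ... | inj₂ x<y′ = begin
      range x y                   ≡⟨ range-cons xx′ (ℕ.≤-trans x≤y′ (ℕ.<⇒≤ (ℕ.≤-reflexive y′y))) ⟩
      x ∷ range x′ y              ≡⟨ cong (x ∷_) (ih (adjacent-≺⇒≼ fut xx′ x<y′)) ⟩
      x ∷ range x′ y′ ++ y ∷ []   ≡⟨ cong (_++ y ∷ []) (sym (range-cons xx′ x≤y′)) ⟩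
      range x y′ ++ y ∷ []        ∎
      where open ≡-Reasoning

module _ (ℝ : CompleteOrderedField) where
  open Semantics ℝ using (Seg⁺; Seg⁻)

  Seg : ∀ {n s} → Dir → (Fin (suc n) → Subset s) → Fin (suc n) → Fin (suc n) → List (Subset s)
  Seg fut  = Seg⁺
  Seg past = Seg⁻

  Seg-singleton : ∀ {n s} d (f : Fin (suc n) → Subset s) x → Seg d f x x ≡ f x ∷ []
  Seg-singleton fut  f x = cong (map f) (range-singleton x)
  Seg-singleton past f x = cong (reverse ∘ map f) (range-singleton x)

  Seg-cons : ∀ {n s} d (f : Fin (suc n) → Subset s) {x x′ y} → Adjacent d x x′ → AtOrBefore d x′ y →
             Seg d f x y ≡ f x ∷ Seg d f x′ y
  Seg-cons fut  f xx′ x′≼y = cong (map f) (range-cons xx′ (ℕ.≤-trans (≺⇒≼ fut (adjacent⇒≺ fut xx′)) x′≼y))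
  Seg-cons past f {x} {x′} {y} x′x y≤x′ = begin
    reverse (map f (range y x))                       ≡⟨ cong (reverse ∘ map f) (range-snoc x′x y y≤x′) ⟩
    reverse (map f (range y x′ ++ x ∷ []))            ≡⟨ cong reverse (map-++ f (range y x′) (x ∷ [])) ⟩
    reverse (map f (range y x′) ++ f x ∷ [])          ≡⟨ reverse-++ (map f (range y x′)) (f x ∷ []) ⟩
    f x ∷ reverse (map f (range y x′))                ∎
    where open ≡-Reasoning

  -- Excludes that a run stops while positions of its segment remain unread.
  Seg-nonempty : ∀ {n s} d (f : Fin (suc n) → Subset s) x y → AtOrBefore d x y → Seg d f x y ≢ []
  Seg-nonempty d f x y x≼y eq with ≼⇒≡⊎≺ d x≼y
  ... | inj₁ refl with () ← trans (sym (Seg-singleton d f x)) eq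
  Seg-nonempty d f x y x≼y eq | inj₂ x≺y with next d x
  ... | inj₁ refl = ≺⇒⋡ d x≺y (≼-endpoint d y)
  ... | inj₂ (x′ , xx′) with () ← trans (sym (Seg-cons d f xx′ (adjacent-≺⇒≼ d xx′ x≺y))) eq

-- Hintikka labellings

_≟ᵈ_ : DecidableEquality Dir
fut  ≟ᵈ fut  = yes refl
fut  ≟ᵈ past = no λ ()
past ≟ᵈ fut  = no λ ()
past ≟ᵈ past = yes refl

-- What stands under one freeze quantifier, over letters from an `s`-element set. An arbitrary test
-- in `lit` covers propositions, their negations, the constants and nested freezes alike; the
-- direction merges `U` with `S` and `G` with `H`.
data Body (s : ℕ) : Set where
  lit        : (Subset s → Bool) → Body s
  clk        : Interval → Body s
  _and_ _or_ : Body s → Body s → Body s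
  until      : Dir → Body s → Body s → Body s
  always     : Dir → Body s → Body s

-- A Hintikka type claims some subformulas, one flag per occurrence.
Ty Sub : ∀ {s} → Body s → Set
Ty b = Bool × Sub b
Sub (lit _)       = ⊤
Sub (clk _)       = ⊤
Sub (b and c)     = Ty b × Ty c
Sub (b or c)      = Ty b × Ty c
Sub (until _ b c) = Ty b × Ty c
Sub (always _ b)  = Ty b

Claimed : ∀ {s} (b : Body s) → Ty b → Set
Claimed _ t = T (proj₁ t)

ordered : {A : Set} → Dir → (A → A → Set) → A → A → Set
ordered fut  R = R
ordered past R = flip R

ordered? : {A : Set} {R : A → A → Set} → ∀ d → (∀ x y → Dec (R x y)) → ∀ x y → Dec (ordered d R x y)
ordered? fut  R? x y = R? x y
ordered? past R? x y = R? y x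

∈-bools : (k : Bool) → k ∈ true ∷ false ∷ []
∈-bools true  = here refl
∈-bools false = there (here refl)

module _ {s : ℕ} where

  clocks : Body s → List Interval
  clocks (lit _)       = []
  clocks (clk I)       = I ∷ []
  clocks (b and c)     = clocks b ++ clocks c
  clocks (b or c)      = clocks b ++ clocks c
  clocks (until _ b c) = clocks b ++ clocks c
  clocks (always _ b)  = clocks b

  claimedClocks : ∀ (b : Body s) → Ty b → List Interval
  claimedClocks (lit _)       _           = []
  claimedClocks (clk I)       (false , _) = []
  claimedClocks (clk I)       (true , _)  = I ∷ []
  claimedClocks (b and c)     (_ , t , u) = claimedClocks b t ++ claimedClocks c u
  claimedClocks (b or c)      (_ , t , u) = claimedClocks b t ++ claimedClocks c u
  claimedClocks (until _ b c) (_ , t , u) = claimedClocks b t ++ claimedClocks c u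
  claimedClocks (always _ b)  (_ , t)     = claimedClocks b t

  -- Every condition is an implication that starts from a claim. There are no converses: a formula
  -- left unclaimed may still hold.
  LetterOK : ∀ (b : Body s) → Ty b → Subset s → Set
  LetterOK (lit p)       (k , _)     a = T k → T (p a)
  LetterOK (clk _)       _           a = ⊤
  LetterOK (b and c)     (k , t , u) a = (T k → Claimed b t × Claimed c u) × LetterOK b t a × LetterOK c u a
  LetterOK (b or c)      (k , t , u) a = (T k → Claimed b t ⊎ Claimed c u) × LetterOK b t a × LetterOK c u a
  LetterOK (until _ b c) (_ , t , u) a = LetterOK b t a × LetterOK c u a
  LetterOK (always _ b)  (_ , t)     a = LetterOK b t a

  -- The expansion law of the strict until: its goal holds at the next position, or its invariant
  -- holds there and the until persists.
  UntilStep : ∀ (b c : Body s) → Bool × Ty b × Ty c → Bool × Ty b × Ty c → Set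
  UntilStep b c (k , _) (k′ , t′ , u′) = T k → Claimed c u′ ⊎ (Claimed b t′ × T k′)

  AlwaysStep : ∀ (b : Body s) → Bool × Ty b → Bool × Ty b → Set
  AlwaysStep b (k , _) (k′ , t′) = T k → Claimed b t′ × T k′

  StepOK : ∀ (b : Body s) → Ty b → Ty b → Set
  StepOK (lit _)       _ _ = ⊤
  StepOK (clk _)       _ _ = ⊤
  StepOK (b and c)     (_ , t , u) (_ , t′ , u′) = StepOK b t t′ × StepOK c u u′
  StepOK (b or c)      (_ , t , u) (_ , t′ , u′) = StepOK b t t′ × StepOK c u u′
  StepOK (until d b c) x@(_ , t , u) y@(_ , t′ , u′) = ordered d (UntilStep b c) x y × StepOK b t t′ × StepOK c u u′
  StepOK (always d b)  x@(_ , t) y@(_ , t′) = ordered d (AlwaysStep b) x y × StepOK b t t′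

  -- The expansion law alone would let an until be postponed up to the end of the word, so a claim
  -- reaching the end in its own direction is forbidden. A claim of `always` is vacuously true
  -- there.
  EndOK : Dir → ∀ (b : Body s) → Ty b → Set
  EndOK d (lit _)        _           = ⊤
  EndOK d (clk _)        _           = ⊤
  EndOK d (b and c)      (_ , t , u) = EndOK d b t × EndOK d c u
  EndOK d (b or c)       (_ , t , u) = EndOK d b t × EndOK d c u
  EndOK d (until d′ b c) (k , t , u) = (d′ ≡ d → ¬ T k) × EndOK d b t × EndOK d c u
  EndOK d (always _ b)   (_ , t)     = EndOK d b t

  letterOK? : ∀ (b : Body s) (t : Ty b) a → Dec (LetterOK b t a)
  letterOK? (lit p)       (k , _)     a = Bool.T? k →-dec Bool.T? (p a)
  letterOK? (clk _)       _           a = yes tt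
  letterOK? (b and c)     (k , t , u) a =
    (Bool.T? k →-dec (Bool.T? (proj₁ t) ×-dec Bool.T? (proj₁ u))) ×-dec letterOK? b t a ×-dec letterOK? c u a
  letterOK? (b or c)      (k , t , u) a =
    (Bool.T? k →-dec (Bool.T? (proj₁ t) ⊎-dec Bool.T? (proj₁ u))) ×-dec letterOK? b t a ×-dec letterOK? c u a
  letterOK? (until _ b c) (_ , t , u) a = letterOK? b t a ×-dec letterOK? c u a
  letterOK? (always _ b)  (_ , t)     a = letterOK? b t a

  untilStep? : ∀ (b c : Body s) (x y : Bool × Ty b × Ty c) → Dec (UntilStep b c x y)
  untilStep? b c (k , _) (k′ , t′ , u′) =
    Bool.T? k →-dec (Bool.T? (proj₁ u′) ⊎-dec (Bool.T? (proj₁ t′) ×-dec Bool.T? k′))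

  alwaysStep? : ∀ (b : Body s) (x y : Bool × Ty b) → Dec (AlwaysStep b x y)
  alwaysStep? b (k , _) (k′ , t′) = Bool.T? k →-dec (Bool.T? (proj₁ t′) ×-dec Bool.T? k′)

  stepOK? : ∀ (b : Body s) (t t′ : Ty b) → Dec (StepOK b t t′)
  stepOK? (lit _)       _ _ = yes tt
  stepOK? (clk _)       _ _ = yes tt
  stepOK? (b and c)     (_ , t , u) (_ , t′ , u′) = stepOK? b t t′ ×-dec stepOK? c u u′
  stepOK? (b or c)      (_ , t , u) (_ , t′ , u′) = stepOK? b t t′ ×-dec stepOK? c u u′
  stepOK? (until d b c) x@(_ , t , u) y@(_ , t′ , u′) =
    ordered? {R = UntilStep b c} d (untilStep? b c) x y ×-dec stepOK? b t t′ ×-dec stepOK? c u u′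
  stepOK? (always d b)  x@(_ , t) y@(_ , t′) =
    ordered? {R = AlwaysStep b} d (alwaysStep? b) x y ×-dec stepOK? b t t′

  endOK? : ∀ d (b : Body s) (t : Ty b) → Dec (EndOK d b t)
  endOK? d (lit _)        _           = yes tt
  endOK? d (clk _)        _           = yes tt
  endOK? d (b and c)      (_ , t , u) = endOK? d b t ×-dec endOK? d c u
  endOK? d (b or c)       (_ , t , u) = endOK? d b t ×-dec endOK? d c u
  endOK? d (until d′ b c) (k , t , u) = ((d′ ≟ᵈ d) →-dec ¬? (Bool.T? k)) ×-dec endOK? d b t ×-dec endOK? d c u
  endOK? d (always _ b)   (_ , t)     = endOK? d b t

  _≟ᵗ_ : ∀ {b : Body s} → DecidableEquality (Ty b)
  _≟ˢ_ : ∀ {b : Body s} → DecidableEquality (Sub b)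
  _≟ᵗ_ {b} = ≡-dec Bool._≟_ (_≟ˢ_ {b = b})
  _≟ˢ_ {lit _}       tt tt = yes refl
  _≟ˢ_ {clk _}       tt tt = yes refl
  _≟ˢ_ {b and c}     = ≡-dec (_≟ᵗ_ {b = b}) (_≟ᵗ_ {b = c})
  _≟ˢ_ {b or c}      = ≡-dec (_≟ᵗ_ {b = b}) (_≟ᵗ_ {b = c})
  _≟ˢ_ {until _ b c} = ≡-dec (_≟ᵗ_ {b = b}) (_≟ᵗ_ {b = c})
  _≟ˢ_ {always _ b}  = _≟ᵗ_ {b = b}

  allTy : ∀ (b : Body s) → List (Ty b)
  allSub : ∀ (b : Body s) → List (Sub b)
  allTy b = cartesianProduct (true ∷ false ∷ []) (allSub b)
  allSub (lit _)       = tt ∷ []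
  allSub (clk _)       = tt ∷ []
  allSub (b and c)     = cartesianProduct (allTy b) (allTy c)
  allSub (b or c)      = cartesianProduct (allTy b) (allTy c)
  allSub (until _ b c) = cartesianProduct (allTy b) (allTy c)
  allSub (always _ b)  = allTy b

  ∈-allTy : ∀ (b : Body s) (t : Ty b) → t ∈ allTy b
  ∈-allSub : ∀ (b : Body s) (t : Sub b) → t ∈ allSub b
  ∈-allTy b (k , t) = ∈-cartesianProduct⁺ (∈-bools k) (∈-allSub b t)
  ∈-allSub (lit _)       tt      = here refl
  ∈-allSub (clk _)       tt      = here refl
  ∈-allSub (b and c)     (t , u) = ∈-cartesianProduct⁺ (∈-allTy b t) (∈-allTy c u)
  ∈-allSub (b or c)      (t , u) = ∈-cartesianProduct⁺ (∈-allTy b t) (∈-allTy c u)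
  ∈-allSub (until _ b c) (t , u) = ∈-cartesianProduct⁺ (∈-allTy b t) (∈-allTy c u)
  ∈-allSub (always _ b)  t       = ∈-allTy b t

  claimedClocks⊆clocks : ∀ (b : Body s) (t : Ty b) → All (_∈ clocks b) (claimedClocks b t)
  claimedClocks⊆clocks-++ : ∀ (b c : Body s) (t : Ty b) (u : Ty c) → All (_∈ clocks b ++ clocks c) (claimedClocks b t ++ claimedClocks c u)
  claimedClocks⊆clocks (lit _)       _           = []
  claimedClocks⊆clocks (clk I)       (false , _) = []
  claimedClocks⊆clocks (clk I)       (true , _)  = here refl ∷ []
  claimedClocks⊆clocks (b and c)     (_ , t , u) = claimedClocks⊆clocks-++ b c t u
  claimedClocks⊆clocks (b or c)      (_ , t , u) = claimedClocks⊆clocks-++ b c t u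
  claimedClocks⊆clocks (until _ b c) (_ , t , u) = claimedClocks⊆clocks-++ b c t u
  claimedClocks⊆clocks (always _ b)  (_ , t)     = claimedClocks⊆clocks b t
  claimedClocks⊆clocks-++ b c t u =
    All.++⁺ (All.map ∈-++⁺ˡ (claimedClocks⊆clocks b t)) (All.map (∈-++⁺ʳ (clocks b)) (claimedClocks⊆clocks c u))

-- Soundness of Hintikka labellings, and the labelling by truth

module BodySemantics {n s : ℕ} (f : Fin (suc n) → Subset s)
                     (In : Interval → Fin (suc n) → Set) (In? : ∀ I p → Dec (In I p)) where

  Sat : Body s → Fin (suc n) → Set
  Sat (lit a)       p = T (a (f p))
  Sat (clk I)       p = In I p
  Sat (b and c)     p = Sat b p × Sat c p
  Sat (b or c)      p = Sat b p ⊎ Sat c p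
  Sat (until d b c) p = ∃ λ q → Before d p q × Sat c q × (∀ r → Before d p r → Before d r q → Sat b r)
  Sat (always d b)  p = ∀ q → Before d p q → Sat b q

  sat? : ∀ (b : Body s) p → Dec (Sat b p)
  sat? (lit a)       p = Bool.T? (a (f p))
  sat? (clk I)       p = In? I p
  sat? (b and c)     p = sat? b p ×-dec sat? c p
  sat? (b or c)      p = sat? b p ⊎-dec sat? c p
  sat? (until d b c) p = Fin.any? λ q → ≺? d p q ×-dec sat? c q ×-dec
                           Fin.all? λ r → ≺? d p r →-dec (≺? d r q →-dec sat? b r)
  sat? (always d b)  p = Fin.all? λ q → ≺? d p q →-dec sat? b q

  Truthful : ∀ (b : Body s) → Ty b → Fin (suc n) → Set
  Truthful b t p = LetterOK b t (f p) × All (λ I → In I p) (claimedClocks b t)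

  record Hintikka (b : Body s) (g : Fin (suc n) → Ty b) : Set where
    field
      truthful : ∀ p → Truthful b (g p) p
      stepOK   : ∀ p q → Adjacent fut p q → StepOK b (g p) (g q)
      endOK    : ∀ d → EndOK d b (g (endpoint d))

  open Hintikka

  private
    along : ∀ {A : Set} {R : A → A → Set} {g : Fin (suc n) → A} d →
            (∀ p q → Adjacent fut p q → ordered d R (g p) (g q)) →
            ∀ p q → Adjacent d p q → R (g p) (g q)
    along fut  h p q pq = h p q pq
    along past h p q qp = h q p qp

  -- The claim is handed on from position to position and is absent at the endpoint, so the goal
  -- must be claimed on the way. Claims enter as bare predicates, detached from the types they are
  -- read off.
  until-sound : ∀ d (b c : Body s) {k : Fin (suc n) → Bool} {B C : Fin (suc n) → Set} →
    (∀ p → B p → Sat b p) → (∀ p → C p → Sat c p) →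
    (∀ p q → Adjacent d p q → T (k p) → C q ⊎ (B q × T (k q))) →
    ¬ T (k (endpoint d)) →
    ∀ p → T (k p) → Sat (until d b c) p
  until-sound d b c {k} satB satC step end = towardsEndpoint d _ (⊥-elim ∘ end) extend
    where
    extend : ∀ p q → Adjacent d p q → (T (k q) → Sat (until d b c) q) → T (k p) → Sat (until d b c) p
    extend p q pq ih kp with step p q pq kp
    ... | inj₁ cq = q , adjacent⇒≺ d pq , satC q cq , λ r p≺r r≺q → ⊥-elim (≺⇒⋡ d r≺q (adjacent-≺⇒≼ d pq p≺r))
    ... | inj₂ (bq , kq) with ih kq
    ...   | r , q≺r , cr , between = r , ≼-≺-trans d (≺⇒≼ d (adjacent⇒≺ d pq)) q≺r , cr , between′
      where
      between′ : ∀ x → Before d p x → Before d x r → Sat b x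
      between′ x p≺x x≺r with ≼⇒≡⊎≺ d (adjacent-≺⇒≼ d pq p≺x)
      ... | inj₁ refl = satB x bq
      ... | inj₂ q≺x  = between x q≺x x≺r

  always-sound : ∀ d (b : Body s) {k : Fin (suc n) → Bool} {B : Fin (suc n) → Set} →
    (∀ p → B p → Sat b p) →
    (∀ p q → Adjacent d p q → T (k p) → B q × T (k q)) →
    ∀ p → T (k p) → Sat (always d b) p
  always-sound d b {k} satB step = towardsEndpoint d _ (λ _ q e≺q → ⊥-elim (≺⇒⋡ d e≺q (≼-endpoint d q))) extend
    where
    extend : ∀ p q → Adjacent d p q → (T (k q) → Sat (always d b) q) → T (k p) → Sat (always d b) p
    extend p q pq ih kp r p≺r with step p q pq kp | ≼⇒≡⊎≺ d (adjacent-≺⇒≼ d pq p≺r)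
    ... | bq , _ | inj₁ refl = satB q bq
    ... | _ , kq | inj₂ q≺r  = ih kq r q≺r

  -- Each condition on a type contains the conditions on its components, so projecting a labelling
  -- to a subformula leaves it Hintikka; this drives the induction on the body.
  restrict : ∀ {b b′ : Body s} (π : Ty b → Ty b′) →
             (∀ t a → LetterOK b t a → LetterOK b′ (π t) a) →
             (∀ t {P : Interval → Set} → All P (claimedClocks b t) → All P (claimedClocks b′ (π t))) →
             (∀ t u → StepOK b t u → StepOK b′ (π t) (π u)) →
             (∀ d t → EndOK d b t → EndOK d b′ (π t)) →
             ∀ {g} → Hintikka b g → Hintikka b′ (π ∘ g)
  restrict π letter clock step end h = record
    { truthful = λ p → letter _ _ (proj₁ (truthful h p)) , clock _ (proj₂ (truthful h p))
    ; stepOK   = λ p q pq → step _ _ (stepOK h p q pq)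
    ; endOK    = λ d → end d _ (endOK h d)
    }

  hintikka-sound : ∀ (b : Body s) g → Hintikka b g → ∀ p → Claimed b (g p) → Sat b p
  hintikka-sound (lit a) g h p k = proj₁ (truthful h p) k
  hintikka-sound (clk I) g h p k with g p | proj₂ (truthful h p)
  ... | true , _ | i ∷ [] = i
  hintikka-sound (b and c) g h p k with proj₁ (proj₁ (truthful h p)) k
  ... | kb , kc = hintikka-sound b (proj₁ ∘ proj₂ ∘ g) hb p kb , hintikka-sound c (proj₂ ∘ proj₂ ∘ g) hc p kc
    where
    hb : Hintikka b (proj₁ ∘ proj₂ ∘ g)
    hb = restrict (proj₁ ∘ proj₂) (λ _ _ → proj₁ ∘ proj₂) (λ _ → All.++⁻ˡ _) (λ _ _ → proj₁) (λ _ _ → proj₁) h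
    hc : Hintikka c (proj₂ ∘ proj₂ ∘ g)
    hc = restrict (proj₂ ∘ proj₂) (λ _ _ → proj₂ ∘ proj₂) (λ _ → All.++⁻ʳ (claimedClocks b _)) (λ _ _ → proj₂) (λ _ _ → proj₂) h
  hintikka-sound (b or c) g h p k =
    Sum.map (hintikka-sound b (proj₁ ∘ proj₂ ∘ g) hb p) (hintikka-sound c (proj₂ ∘ proj₂ ∘ g) hc p)
            (proj₁ (proj₁ (truthful h p)) k)
    where
    hb : Hintikka b (proj₁ ∘ proj₂ ∘ g)
    hb = restrict (proj₁ ∘ proj₂) (λ _ _ → proj₁ ∘ proj₂) (λ _ → All.++⁻ˡ _) (λ _ _ → proj₁) (λ _ _ → proj₁) h
    hc : Hintikka c (proj₂ ∘ proj₂ ∘ g)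
    hc = restrict (proj₂ ∘ proj₂) (λ _ _ → proj₂ ∘ proj₂) (λ _ → All.++⁻ʳ (claimedClocks b _)) (λ _ _ → proj₂) (λ _ _ → proj₂) h
  hintikka-sound (until d b c) g h =
    until-sound d b c (hintikka-sound b (proj₁ ∘ proj₂ ∘ g) hb) (hintikka-sound c (proj₂ ∘ proj₂ ∘ g) hc)
      (along {R = UntilStep b c} d (λ q r qr → proj₁ (stepOK h q r qr))) (proj₁ (endOK h d) refl)
    where
    hb : Hintikka b (proj₁ ∘ proj₂ ∘ g)
    hb = restrict (proj₁ ∘ proj₂) (λ _ _ → proj₁) (λ _ → All.++⁻ˡ _) (λ _ _ → proj₁ ∘ proj₂) (λ _ _ → proj₁ ∘ proj₂) h
    hc : Hintikka c (proj₂ ∘ proj₂ ∘ g)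
    hc = restrict (proj₂ ∘ proj₂) (λ _ _ → proj₂) (λ _ → All.++⁻ʳ (claimedClocks b _)) (λ _ _ → proj₂ ∘ proj₂) (λ _ _ → proj₂ ∘ proj₂) h
  hintikka-sound (always d b) g h =
    always-sound d b (hintikka-sound b (proj₂ ∘ g) (restrict proj₂ (λ _ _ → id) (λ _ → id) (λ _ _ → proj₂) (λ _ _ → id) h))
      (along {R = AlwaysStep b} d (λ q r qr → proj₁ (stepOK h q r qr)))

  -- The labelling that claims exactly what is true. Completeness uses this one throughout.
  truth : ∀ (b : Body s) → Fin (suc n) → Ty b
  truthSub : ∀ (b : Body s) → Fin (suc n) → Sub b
  truth b p = isYes (sat? b p) , truthSub b p
  truthSub (lit _)       p = tt
  truthSub (clk _)       p = tt
  truthSub (b and c)     p = truth b p , truth c p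
  truthSub (b or c)      p = truth b p , truth c p
  truthSub (until _ b c) p = truth b p , truth c p
  truthSub (always _ b)  p = truth b p

  claimed⇒sat : ∀ (b : Body s) {p} → Claimed b (truth b p) → Sat b p
  claimed⇒sat b {p} = toWitness {a? = sat? b p}

  sat⇒claimed : ∀ (b : Body s) {p} → Sat b p → Claimed b (truth b p)
  sat⇒claimed b {p} = fromWitness {a? = sat? b p}

  truth-letterOK : ∀ (b : Body s) p → LetterOK b (truth b p) (f p)
  truth-letterOK (lit a)       p = claimed⇒sat (lit a)
  truth-letterOK (clk _)       p = tt
  truth-letterOK (b and c)     p = (λ k → let (x , y) = claimed⇒sat (b and c) {p} k in sat⇒claimed b x , sat⇒claimed c y)
                                 , truth-letterOK b p , truth-letterOK c p
  truth-letterOK (b or c)      p = (λ k → Sum.map (sat⇒claimed b) (sat⇒claimed c) (claimed⇒sat (b or c) {p} k))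
                                 , truth-letterOK b p , truth-letterOK c p
  truth-letterOK (until _ b c) p = truth-letterOK b p , truth-letterOK c p
  truth-letterOK (always _ b)  p = truth-letterOK b p

  truth-clocks : ∀ (b : Body s) p → All (λ I → In I p) (claimedClocks b (truth b p))
  truth-clocks (lit a)       p = []
  truth-clocks (clk I)       p with In? I p
  ... | yes i = i ∷ []
  ... | no  _ = []
  truth-clocks (b and c)     p = All.++⁺ (truth-clocks b p) (truth-clocks c p)
  truth-clocks (b or c)      p = All.++⁺ (truth-clocks b p) (truth-clocks c p)
  truth-clocks (until _ b c) p = All.++⁺ (truth-clocks b p) (truth-clocks c p)
  truth-clocks (always _ b)  p = truth-clocks b p

  private
    orderedAlong : ∀ {A : Set} {R : A → A → Set} {g : Fin (suc n) → A} d →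
                   (∀ p q → Adjacent d p q → R (g p) (g q)) →
                   ∀ p q → Adjacent fut p q → ordered d R (g p) (g q)
    orderedAlong fut  h p q pq = h p q pq
    orderedAlong past h p q pq = h q p pq

  truth-untilStep : ∀ d (b c : Body s) p q → Adjacent d p q → UntilStep b c (truth (until d b c) p) (truth (until d b c) q)
  truth-untilStep d b c p q pq k with claimed⇒sat (until d b c) {p} k
  ... | r , p≺r , cr , between with ≼⇒≡⊎≺ d (adjacent-≺⇒≼ d pq p≺r)
  ...   | inj₁ refl = inj₁ (sat⇒claimed c cr)
  ...   | inj₂ q≺r  = inj₂ ( sat⇒claimed b (between q (adjacent⇒≺ d pq) q≺r)
                           , sat⇒claimed (until d b c) (r , q≺r , cr , λ x q≺x → between x (≼-≺-trans d (≺⇒≼ d (adjacent⇒≺ d pq)) q≺x)))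

  truth-alwaysStep : ∀ d (b : Body s) p q → Adjacent d p q → AlwaysStep b (truth (always d b) p) (truth (always d b) q)
  truth-alwaysStep d b p q pq k = sat⇒claimed b (all q (adjacent⇒≺ d pq))
    , sat⇒claimed (always d b) (λ r q≺r → all r (≼-≺-trans d (≺⇒≼ d (adjacent⇒≺ d pq)) q≺r))
    where all = claimed⇒sat (always d b) {p} k

  truth-stepOK : ∀ (b : Body s) p q → Adjacent fut p q → StepOK b (truth b p) (truth b q)
  truth-stepOK (lit _)       p q pq = tt
  truth-stepOK (clk _)       p q pq = tt
  truth-stepOK (b and c)     p q pq = truth-stepOK b p q pq , truth-stepOK c p q pq
  truth-stepOK (b or c)      p q pq = truth-stepOK b p q pq , truth-stepOK c p q pq
  truth-stepOK (until d b c) p q pq = orderedAlong {R = UntilStep b c} d (truth-untilStep d b c) p q pq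
                                    , truth-stepOK b p q pq , truth-stepOK c p q pq
  truth-stepOK (always d b)  p q pq = orderedAlong {R = AlwaysStep b} d (truth-alwaysStep d b) p q pq
                                    , truth-stepOK b p q pq

  truth-endOK : ∀ d (b : Body s) → EndOK d b (truth b (endpoint d))
  truth-endOK d (lit _)        = tt
  truth-endOK d (clk _)        = tt
  truth-endOK d (b and c)      = truth-endOK d b , truth-endOK d c
  truth-endOK d (b or c)       = truth-endOK d b , truth-endOK d c
  truth-endOK d (until d′ b c) = noEnd , truth-endOK d b , truth-endOK d c
    where
    noEnd : d′ ≡ d → ¬ T (isYes (sat? (until d′ b c) (endpoint d)))
    noEnd refl k with claimed⇒sat (until d b c) {endpoint d} k
    ... | r , e≺r , _ = ≺⇒⋡ d e≺r (≼-endpoint d r)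
  truth-endOK d (always _ b)   = truth-endOK d b

-- Automata

vecsOver : {A : Set} → List A → (k : ℕ) → List (Vec A k)
vecsOver xs zero    = [] ∷ []
vecsOver xs (suc k) = cartesianProductWith _∷_ xs (vecsOver xs k)

∈-vecsOver⁺ : ∀ {A : Set} {xs : List A} {k} (v : Vec A k) → (∀ i → Vec.lookup v i ∈ xs) → v ∈ vecsOver xs k
∈-vecsOver⁺ []      h = here refl
∈-vecsOver⁺ (x ∷ v) h = ∈-cartesianProductWith⁺ _∷_ (h Fin.zero) (∈-vecsOver⁺ v (h ∘ Fin.suc))

∈-vecsOver⁻ : ∀ {A : Set} {xs : List A} {k} (v : Vec A k) → v ∈ vecsOver xs k → ∀ i → Vec.lookup v i ∈ xs
∈-vecsOver⁻ {xs = xs} {suc k} v h i with ∈-cartesianProductWith⁻ _∷_ xs (vecsOver xs k) h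
∈-vecsOver⁻ _ h Fin.zero    | x , w , x∈ , w∈ , refl = x∈
∈-vecsOver⁻ _ h (Fin.suc i) | x , w , x∈ , w∈ , refl = ∈-vecsOver⁻ w w∈ i

subsets : ∀ s → List (Subset s)
subsets = vecsOver (true ∷ false ∷ [])

∈-subsets : ∀ {s} (a : Subset s) → a ∈ subsets s
∈-subsets a = ∈-vecsOver⁺ a (∈-bools ∘ Vec.lookup a)

-- State zero is accepting and has no successors, state suc i is the i-th element of qs.
module Automaton {s : ℕ} {Q : Set} (qs : List Q) (complete : ∀ q → q ∈ qs)
                 {Step : Q → Subset s → Q → Set} (step? : ∀ q a q′ → Dec (Step q a q′))
                 {Stop : Q → Subset s → Set} (stop? : ∀ q a → Dec (Stop q a)) where

  Transition : Fin (suc (length qs)) × Subset s × Fin (suc (length qs)) → Set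
  Transition (Fin.zero  , a , _)         = ⊥
  Transition (Fin.suc i , a , Fin.zero)  = Stop (lookup qs i) a
  Transition (Fin.suc i , a , Fin.suc j) = Step (lookup qs i) a (lookup qs j)

  transition? : ∀ e → Dec (Transition e)
  transition? (Fin.zero  , a , _)         = no id
  transition? (Fin.suc i , a , Fin.zero)  = stop? (lookup qs i) a
  transition? (Fin.suc i , a , Fin.suc j) = step? (lookup qs i) a (lookup qs j)

  edges : List (Fin (suc (length qs)) × Subset s × Fin (suc (length qs)))
  edges = cartesianProduct (allFin _) (cartesianProduct (subsets s) (allFin _))

  state : Q → Fin (suc (length qs))
  state q = Fin.suc (Any.index (complete q))

  automaton : Q → NFA s
  automaton q₀ = record
    { states      = suc (length qs)
    ; initial     = ⁅ state q₀ ⁆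
    ; final       = ⁅ Fin.zero ⁆
    ; transitions = filter transition? edges
    }

  -- Acceptance by `automaton`, freed from the numbering of states.
  Run : Q → List (Subset s) → Set
  Run q []      = ⊥
  Run q (a ∷ w) = (Stop q a × w ≡ []) ⊎ ∃ λ q′ → Step q a q′ × Run q′ w

  private
    edge : ∀ q₀ {e} → Transition e → e ∈ transitions (automaton q₀)
    edge q₀ {i , a , j} h =
      ∈-filter⁺ transition? (∈-cartesianProduct⁺ (∈-allFin i) (∈-cartesianProduct⁺ (∈-subsets a) (∈-allFin j))) h

    edge⁻ : ∀ q₀ {e} → e ∈ transitions (automaton q₀) → Transition e
    edge⁻ q₀ h = proj₂ (∈-filter⁻ transition? {xs = edges} h)

    index≡ : ∀ q → lookup qs (Any.index (complete q)) ≡ q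
    index≡ q = sym (lookup-index (complete q))

    accepts⇒run : ∀ q₀ i w → AcceptsFrom (automaton q₀) (Fin.suc i) w → Run (lookup qs i) w
    accepts⇒run q₀ i [] acc with () ← x∈⁅y⁆⇒x≡y Fin.zero acc
    accepts⇒run q₀ i (a ∷ []) (Fin.zero , e , _) = inj₁ (edge⁻ q₀ e , refl)
    accepts⇒run q₀ i (a ∷ a′ ∷ w) (Fin.zero , _ , _ , e , _) = ⊥-elim (edge⁻ q₀ e)
    accepts⇒run q₀ i (a ∷ w) (Fin.suc j , e , acc) = inj₂ (lookup qs j , edge⁻ q₀ e , accepts⇒run q₀ j w acc)

    run⇒accepts : ∀ q₀ q w → Run q w → AcceptsFrom (automaton q₀) (state q) w
    run⇒accepts q₀ q (a ∷ []) (inj₁ (stop , refl)) =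
      Fin.zero , edge q₀ (subst (λ x → Stop x a) (sym (index≡ q)) stop) , x∈⁅x⁆ Fin.zero
    run⇒accepts q₀ q (a ∷ w) (inj₂ (q′ , step , run)) =
      state q′ , edge q₀ (subst₂ (λ x y → Step x a y) (sym (index≡ q)) (sym (index≡ q′)) step) , run⇒accepts q₀ q′ w run

  ∈L⇒run : ∀ q w → w ∈L automaton q → Run q w
  ∈L⇒run q w (i , init , acc) with x∈⁅y⁆⇒x≡y (state q) init
  ... | refl = subst (λ x → Run x w) (index≡ q) (accepts⇒run q _ w acc)

  run⇒∈L : ∀ q w → Run q w → w ∈L automaton q
  run⇒∈L q w run = state q , x∈⁅x⁆ _ , run⇒accepts q q w run

  module _ (ℝ : CompleteOrderedField) {n : ℕ} (d : Dir) (f : Fin (suc n) → Subset s) (y : Fin (suc n)) where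

    -- A run is consumed from its far end `y` backwards, so that `M` can speak of a labelling to
    -- which one position is prepended at a time.
    run-elim : (M : Fin (suc n) → Q → Set) →
               (∀ q → Stop q (f y) → M y q) →
               (∀ x x′ q q′ → Adjacent d x x′ → AtOrBefore d x′ y → Step q (f x) q′ → M x′ q′ → M x q) →
               ∀ x → AtOrBefore d x y → ∀ q → Run q (Seg ℝ d f x y) → M x q
    run-elim M stop step = towardsEndpoint d _ base extend
      where
      single : ∀ q → Run q (Seg ℝ d f y y) → M y q
      single q run with subst (Run q) (Seg-singleton ℝ d f y) run
      ... | inj₁ (e , _) = stop q e
      base : _
      base e≼y q run with ≼-antisym d (≼-endpoint d y) e≼y
      ... | refl = single q run
      extend : _
      extend x x′ adj ih x≼y q run with ≼⇒≡⊎≺ d x≼y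
      ... | inj₁ refl = single q run
      ... | inj₂ x≺y with subst (Run q) (Seg-cons ℝ d f adj (adjacent-≺⇒≼ d adj x≺y)) run
      ...   | inj₁ (_ , eq) = ⊥-elim (Seg-nonempty ℝ d f x′ y (adjacent-≺⇒≼ d adj x≺y) eq)
      ...   | inj₂ (q′ , st , run′) = step x x′ q q′ adj (adjacent-≺⇒≼ d adj x≺y) st (ih (adjacent-≺⇒≼ d adj x≺y) q′ run′)

    run-intro : (g : Fin (suc n) → Q) → Stop (g y) (f y) → ∀ x → AtOrBefore d x y →
                (∀ z z′ → Adjacent d z z′ → AtOrBefore d x z → AtOrBefore d z′ y → Step (g z) (f z) (g z′)) →
                Run (g x) (Seg ℝ d f x y)
    run-intro g stop = towardsEndpoint d _ base extend
      where
      single : Run (g y) (Seg ℝ d f y y)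
      single = subst (Run (g y)) (sym (Seg-singleton ℝ d f y)) (inj₁ (stop , refl))
      base : _
      base e≼y _ with ≼-antisym d (≼-endpoint d y) e≼y
      ... | refl = single
      extend : _
      extend x x′ adj ih x≼y step with ≼⇒≡⊎≺ d x≼y
      ... | inj₁ refl = single
      ... | inj₂ x≺y = subst (Run (g x)) (sym (Seg-cons ℝ d f adj x′≼y))
              (inj₂ (g x′ , step x x′ adj (≼-refl d) x′≼y
                    , ih x′≼y λ z z′ zz′ x′≼z → step z z′ zz′ (≼-trans d (≺⇒≼ d (adjacent⇒≺ d adj)) x′≼z)))
        where x′≼y = adjacent-≺⇒≼ d adj x≺y

-- One side of the freeze point

_≟ˡ_ : DecidableEquality Lower
-∞       ≟ˡ -∞       = yes refl
-∞       ≟ˡ closed _ = no λ ()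
-∞       ≟ˡ open′ _  = no λ ()
closed _ ≟ˡ -∞       = no λ ()
closed a ≟ˡ closed b = map′ (cong closed) (λ { refl → refl }) (a ℤ.≟ b)
closed _ ≟ˡ open′ _  = no λ ()
open′ _  ≟ˡ -∞       = no λ ()
open′ _  ≟ˡ closed _ = no λ ()
open′ a  ≟ˡ open′ b  = map′ (cong open′) (λ { refl → refl }) (a ℤ.≟ b)

_≟ᵘ_ : DecidableEquality Upper
+∞       ≟ᵘ +∞       = yes refl
+∞       ≟ᵘ closed _ = no λ ()
+∞       ≟ᵘ open′ _  = no λ ()
closed _ ≟ᵘ +∞       = no λ ()
closed a ≟ᵘ closed b = map′ (cong closed) (λ { refl → refl }) (a ℤ.≟ b)
closed _ ≟ᵘ open′ _  = no λ ()
open′ _  ≟ᵘ +∞       = no λ ()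
open′ _  ≟ᵘ closed _ = no λ ()
open′ a  ≟ᵘ open′ b  = map′ (cong open′) (λ { refl → refl }) (a ℤ.≟ b)

_≟ⁱ_ : DecidableEquality Interval
interval l u _ ≟ⁱ interval l′ u′ _ with l ≟ˡ l′ | u ≟ᵘ u′
... | yes refl | yes refl = yes refl
... | no l≢l′  | _        = no λ { refl → l≢l′ refl }
... | _        | no u≢u′  = no λ { refl → u≢u′ refl }

open DecMembership _≟ⁱ_ using () renaming (_∈?_ to _∈ⁱ?_)

-- The padding label. It always holds, and as its endpoints are infinite it is adjacent to nothing.
everything : Interval
everything = interval -∞ +∞ tt

-- In this form two insertions per interval give the length of the vector of points by definition.
double : ℕ → ℕ
double zero    = zero
double (suc n) = suc (suc (double n))

pending : ∀ {X : Set} {k} → Vec (Interval × X) k → List Interval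
pending []             = []
pending ((I , _) ∷ es) = I ∷ pending es

module Halves {s : ℕ} (b : Body s) (d : Dir) where

  ClocksIn : List Interval → Ty b → Set
  ClocksIn Is t = All (_∈ Is) (claimedClocks b t)

  clocksIn? : ∀ Is t → Dec (ClocksIn Is t)
  clocksIn? Is t = All.all? (_∈ⁱ? Is) (claimedClocks b t)

  Step : List Interval → List Interval → Ty b → Subset s → Ty b → Set
  Step seen rest t a t′ = LetterOK b t a × ordered d (StepOK b) t t′ × ClocksIn seen t × ClocksIn rest t′

  Stop : List Interval → Ty b → Subset s → Set
  Stop seen t a = LetterOK b t a × EndOK d b t × ClocksIn seen t

  step? : ∀ seen rest t a t′ → Dec (Step seen rest t a t′)
  step? seen rest t a t′ = letterOK? b t a ×-dec ordered? {R = StepOK b} d (stepOK? b) t t′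
                             ×-dec clocksIn? seen t ×-dec clocksIn? rest t′

  stop? : ∀ seen t a → Dec (Stop seen t a)
  stop? seen t a = letterOK? b t a ×-dec endOK? d b t ×-dec clocksIn? seen t

  -- Consecutive segments share a position, whose letter is read twice. The first segment ends by
  -- comparing types only; the tests at that position are made by the automaton that leaves it or
  -- stops at the end of the word.
  module Segment (seen rest : List Interval) (t′ : Ty b) =
    Automaton (allTy b) (∈-allTy b) {Step seen rest} (step? seen rest) {λ t _ → t ≡ t′} (λ t _ → _≟ᵗ_ {b = b} t t′)
  -- Nothing is pending after the last point, so the types at positions beyond it claim no
  -- constraint.
  module Tail (seen : List Interval) =
    Automaton (allTy b) (∈-allTy b) {Step seen []} (step? seen []) {Stop seen} (stop? seen)

  -- seen holds the intervals certified by points already passed, pending those of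
  -- the points still to come.  Every step checks seen where it leaves and pending
  -- where it arrives, so that points may share a position.
  automata : ∀ {k} → List Interval → Ty b → Vec (Interval × Ty b) k → Fin (suc k) → NFA s
  automata seen t []              Fin.zero    = Tail.automaton seen t
  automata seen t ((I , t′) ∷ es) Fin.zero    = Segment.automaton seen (I ∷ pending es) t′ t
  automata seen t ((I , t′) ∷ es) (Fin.suc w) = automata (I ∷ seen) t′ es w

  -- Labellings of one side, and their certification by points

  module OnWord {n : ℕ} (f : Fin (suc n) → Subset s)
           (In : Interval → Fin (suc n) → Set) (In? : ∀ I p → Dec (In I p))
           (convex : ∀ I {p q r} → AtOrBefore d p q → AtOrBefore d q r → In I p → In I r → In I q) where

    open BodySemantics f In In?

    -- The labelling is a total function but is constrained only from `p` on in direction `d`. The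
    -- types on the other side of `p` are arbitrary and are discarded in `glue`.
    record HalfHintikka (p : Fin (suc n)) (t : Ty b) : Set where
      field
        type     : Fin (suc n) → Ty b
        start    : type p ≡ t
        truthful : ∀ q → AtOrBefore d p q → Truthful b (type q) q
        stepOK   : ∀ q q′ → AtOrBefore d p q → Adjacent d q q′ → ordered d (StepOK b) (type q) (type q′)
        endOK    : EndOK d b (type (endpoint d))

    open HalfHintikka

    half-end : ∀ {t} → Truthful b t (endpoint d) → EndOK d b t → HalfHintikka (endpoint d) t
    half-end {t} tr eok = record
      { type     = λ _ → t
      ; start    = refl
      ; truthful = λ q e≼q → subst (Truthful b t) (≼-antisym d e≼q (≼-endpoint d q)) tr
      ; stepOK   = λ q q′ e≼q qq′ → ⊥-elim (≺⇒⋡ d (≼-≺-trans d e≼q (adjacent⇒≺ d qq′)) (≼-endpoint d q′))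
      ; endOK    = eok
      }

    half-cons : ∀ {p p′ t t′} → Adjacent d p p′ → Truthful b t p → ordered d (StepOK b) t t′ →
                HalfHintikka p′ t′ → HalfHintikka p t
    half-cons {p} {p′} {t} {t′} pp′ tr st h = record
      { type = g ; start = g-p ; truthful = tr′ ; stepOK = st′ ; endOK = subst (EndOK d b) (sym g-end) (endOK h) }
      where
      p≺p′ = adjacent⇒≺ d pp′
      g : Fin (suc n) → Ty b
      g q with q Fin.≟ p
      ... | yes _ = t
      ... | no  _ = type h q
      g-p : g p ≡ t
      g-p with p Fin.≟ p
      ... | yes _  = refl
      ... | no p≢p = ⊥-elim (p≢p refl)
      g-after : ∀ q → AtOrBefore d p′ q → g q ≡ type h q
      g-after q p′≼q with q Fin.≟ p
      ... | yes refl = ⊥-elim (≺⇒⋡ d p≺p′ p′≼q)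
      ... | no  _    = refl
      g-end : g (endpoint d) ≡ type h (endpoint d)
      g-end = g-after _ (≼-endpoint d p′)
      tr′ : ∀ q → AtOrBefore d p q → Truthful b (g q) q
      tr′ q p≼q with ≼⇒≡⊎≺ d p≼q
      ... | inj₁ refl = subst (λ x → Truthful b x q) (sym g-p) tr
      ... | inj₂ p≺q  = subst (λ x → Truthful b x q) (sym (g-after q p′≼q)) (truthful h q p′≼q)
        where p′≼q = adjacent-≺⇒≼ d pp′ p≺q
      st′ : ∀ q q′ → AtOrBefore d p q → Adjacent d q q′ → ordered d (StepOK b) (g q) (g q′)
      st′ q q′ p≼q qq′ with ≼⇒≡⊎≺ d p≼q
      ... | inj₁ refl = subst₂ (ordered d (StepOK b)) (sym g-p) (sym (trans (g-after q′ p′≼q′) (trans (cong (type h) (sym p′≡q′)) (start h)))) st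
        where
        p′≼q′ = adjacent-≺⇒≼ d pp′ (adjacent⇒≺ d qq′)
        p′≡q′ = ≼-antisym d p′≼q′ (adjacent-≺⇒≼ d qq′ p≺p′)
      ... | inj₂ p≺q  = subst₂ (ordered d (StepOK b)) (sym (g-after q p′≼q)) (sym (g-after q′ p′≼q′)) (stepOK h q q′ p′≼q qq′)
        where
        p′≼q  = adjacent-≺⇒≼ d pp′ p≺q
        p′≼q′ = ≼-trans d p′≼q (≺⇒≼ d (adjacent⇒≺ d qq′))

    Reached Awaited : Fin (suc n) → Interval → Set
    Reached p I = ∃ λ q → AtOrBefore d q p × In I q
    Awaited p I = ∃ λ q → AtOrBefore d p q × In I q

    truthful-here : ∀ {p q seen t} → AtOrBefore d p q → All (Reached p) seen →
                    LetterOK b t (f q) → ClocksIn seen t → All (Awaited q) (claimedClocks b t) → Truthful b t q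
    truthful-here {q = q} {seen} p≼q reached l cl aw = l , All.zipWith between (cl , aw)
      where
      between : ∀ {I} → I ∈ seen × Awaited q I → In I q
      between {I} (I∈ , r , q≼r , ir) with All.lookup reached I∈
      ... | x , x≼p , ix = convex I (≼-trans d x≼p p≼q) q≼r ix ir

    Monotone : ∀ {k} → (Fin (suc k) → Fin (suc n)) → Set
    Monotone i = ∀ w → AtOrBefore d (i (inject₁ w)) (i (Fin.suc w))

    ClocksAt : ∀ {k} → Vec (Interval × Ty b) k → (Fin (suc k) → Fin (suc n)) → Set
    ClocksAt es i = ∀ w → In (proj₁ (Vec.lookup es w)) (i (Fin.suc w))

    pending-awaited : ∀ {k} (es : Vec (Interval × Ty b) k) i → Monotone i → ClocksAt es i →
                      All (Awaited (i Fin.zero)) (pending es)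
    pending-awaited []       i mono at = []
    pending-awaited (e ∷ es) i mono at =
      (_ , mono Fin.zero , at Fin.zero)
      ∷ All.map (λ (q , le , iq) → q , ≼-trans d (mono Fin.zero) le , iq)
                (pending-awaited es (i ∘ Fin.suc) (mono ∘ Fin.suc) (at ∘ Fin.suc))

    module _ (ℝ : CompleteOrderedField) where

      Accepted : ∀ {k} → (Fin (suc k) → NFA s) → (Fin (suc k) → Fin (suc n)) → Set
      Accepted {k} A i = (∀ w → Seg ℝ d f (i (inject₁ w)) (i (Fin.suc w)) ∈L A (inject₁ w))
                       × Seg ℝ d f (i (fromℕ k)) (endpoint d) ∈L A (fromℕ k)

      -- Induction on the points to come, each of which moves its interval from the awaited to the
      -- reached ones. The last hypothesis stands in for the test made on arrival: the start of the
      -- first segment is never arrived at. At the freeze point `admissible?` supplies it.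
      half-sound : ∀ {k} (es : Vec (Interval × Ty b) k) seen t i → Monotone i → ClocksAt es i →
                   Accepted (automata seen t es) i → All (Reached (i Fin.zero)) seen →
                   All (Awaited (i Fin.zero)) (claimedClocks b t) → HalfHintikka (i Fin.zero) t
      half-sound [] seen t i mono at (_ , acc) reached =
        Tail.run-elim seen ℝ d f (endpoint d) M stop step (i Fin.zero) (≼-endpoint d _) t
          (Tail.∈L⇒run seen t _ acc) (≼-refl d)
        where
        -- That the claims at `x` are awaited is assumed here: it is established by the step
        -- arriving at `x`, which a proof from the far end meets only afterwards.
        M : Fin (suc n) → Ty b → Set
        M x t = AtOrBefore d (i Fin.zero) x → All (Awaited x) (claimedClocks b t) → HalfHintikka x t
        stop : ∀ t → Stop seen t (f (endpoint d)) → M (endpoint d) t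
        stop t (l , e , cl) ≼x aw = half-end (truthful-here ≼x reached l cl aw) e
        step : ∀ x x′ t t′ → Adjacent d x x′ → AtOrBefore d x′ (endpoint d) → Step seen [] t (f x) t′ → M x′ t′ → M x t
        step x x′ t t′ xx′ _ (l , st , cl , cl′) m ≼x aw =
          half-cons xx′ (truthful-here ≼x reached l cl aw) st
            (m (≼-trans d ≼x (≺⇒≼ d (adjacent⇒≺ d xx′))) (All.map (λ ()) cl′))
      half-sound ((I , t₁) ∷ es) seen t i mono at (accs , acc) reached =
        Segment.run-elim seen (I ∷ pending es) t₁ ℝ d f (i i₁) M stop step (i Fin.zero) (mono Fin.zero) t
          (Segment.∈L⇒run seen (I ∷ pending es) t₁ t _ (accs Fin.zero)) (≼-refl d)
        where
        i₁ = Fin.suc Fin.zero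
        M : Fin (suc n) → Ty b → Set
        M x t = AtOrBefore d (i Fin.zero) x → All (Awaited x) (claimedClocks b t) → HalfHintikka x t
        stop : ∀ t → t ≡ t₁ → M (i i₁) t
        stop t refl _ = half-sound es (I ∷ seen) t (i ∘ Fin.suc) (mono ∘ Fin.suc) (at ∘ Fin.suc) (accs ∘ Fin.suc , acc)
          ((i i₁ , ≼-refl d , at Fin.zero) ∷ All.map (λ (q , q≼ , iq) → q , ≼-trans d q≼ (mono Fin.zero) , iq) reached)
        awaited : ∀ {x} → AtOrBefore d x (i i₁) → All (Awaited x) (I ∷ pending es)
        awaited x≼ = (i i₁ , x≼ , at Fin.zero)
          ∷ All.map (λ (q , ≼q , iq) → q , ≼-trans d x≼ ≼q , iq)
                    (pending-awaited es (i ∘ Fin.suc) (mono ∘ Fin.suc) (at ∘ Fin.suc))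
        step : ∀ x x′ t t′ → Adjacent d x x′ → AtOrBefore d x′ (i i₁) → Step seen (I ∷ pending es) t (f x) t′ → M x′ t′ → M x t
        step x x′ t t′ xx′ x′≼ (l , st , cl , cl′) m ≼x aw =
          half-cons xx′ (truthful-here ≼x reached l cl aw) st
            (m (≼-trans d ≼x (≺⇒≼ d (adjacent⇒≺ d xx′))) (All.map (λ I∈ → All.lookup (awaited x′≼) I∈) cl′))

    Points : ℕ → Set
    Points k = Vec (Fin (suc n) × Interval) k

    Chain : ∀ {k} → Fin (suc n) → Points k → Set
    Chain p []             = ⊤
    Chain p ((q , I) ∷ ps) = AtOrBefore d p q × In I q × Chain q ps

    insert : ∀ {k} → Fin (suc n) × Interval → Points k → Points (suc k)
    insert x []       = x ∷ []
    insert x (y ∷ ps) with ≼? d (proj₁ x) (proj₁ y)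
    ... | yes _ = x ∷ y ∷ ps
    ... | no  _ = y ∷ insert x ps

    insert-chain : ∀ {k} {p q I} (ps : Points k) → AtOrBefore d p q → In I q → Chain p ps → Chain p (insert (q , I) ps)
    insert-chain []             p≼q iq _ = p≼q , iq , tt
    insert-chain {q = q} ((r , J) ∷ ps) p≼q iq (p≼r , jr , ch) with ≼? d q r
    ... | yes q≼r = p≼q , iq , q≼r , jr , ch
    ... | no  q⋠r = p≼r , jr , insert-chain ps (⊀⇒≽ d λ q≺r → q⋠r (≺⇒≼ d q≺r)) iq ch

    ∈-insert-here : ∀ {k} x (ps : Points k) → x ∈ᵥ insert x ps
    ∈-insert-here x [] = here refl
    ∈-insert-here x (y ∷ ps) with ≼? d (proj₁ x) (proj₁ y)
    ... | yes _ = here refl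
    ... | no  _ = there (∈-insert-here x ps)

    ∈-insert-there : ∀ {k} x {z} (ps : Points k) → z ∈ᵥ ps → z ∈ᵥ insert x ps
    ∈-insert-there x (y ∷ ps) z∈ with ≼? d (proj₁ x) (proj₁ y)
    ∈-insert-there x (y ∷ ps) z∈         | yes _ = there z∈
    ∈-insert-there x (y ∷ ps) (here eq)  | no  _ = here eq
    ∈-insert-there x (y ∷ ps) (there z∈) | no  _ = there (∈-insert-there x ps z∈)

    insert-all : ∀ {k} {P : Fin (suc n) × Interval → Set} {x} (ps : Points k) → P x → VecAll.All P ps → VecAll.All P (insert x ps)
    insert-all []       px []        = px ∷ []
    insert-all {x = x} (y ∷ ps) px (py ∷ h) with ≼? d (proj₁ x) (proj₁ y)
    ... | yes _ = px ∷ py ∷ h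
    ... | no  _ = py ∷ insert-all ps px h

    Covers : ∀ {k} → Fin (suc n) → Points k → Interval → Set
    Covers p ps I = ∀ q → AtOrBefore d p q → In I q →
      (∃ λ r → (r , I) ∈ᵥ ps × AtOrBefore d r q) × (∃ λ r → (r , I) ∈ᵥ ps × AtOrBefore d q r)

    -- Two points for each interval and a spare one. The spare point is needed because a modality
    -- must have at least one point even if there are no constraints.
    record Sampling (p : Fin (suc n)) (Is : List Interval) : Set where
      field
        points  : Points (suc (double (Data.List.length Is)))
        chain   : Chain p points
        marks   : VecAll.All (λ x → proj₂ x ∈ everything ∷ Is) points
        covered : All (Covers p points) Is

    sampling : (∀ q → In everything q) → ∀ p Is → Sampling p Is
    sampling full p [] = record { points = (p , everything) ∷ [] ; chain = ≼-refl d , full p , tt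
                                ; marks = here refl ∷ [] ; covered = [] }
    sampling full p (I ∷ Is) = extend (last-satisfying d (In I) (In? I) p)
      where
      open Sampling (sampling full p Is)
      weaken : ∀ {J} → J ∈ everything ∷ Is → J ∈ everything ∷ I ∷ Is
      weaken (here eq)  = here eq
      weaken (there J∈) = there (there J∈)
      two : (x y : Fin (suc n) × Interval) → Points _
      two x y = insert x (insert y points)
      keep : ∀ x y {z} → z ∈ᵥ points → z ∈ᵥ two x y
      keep x y z∈ = ∈-insert-there x (insert y points) (∈-insert-there y points z∈)
      keepCovers : ∀ x y {J} → Covers p points J → Covers p (two x y) J
      keepCovers x y cov q p≼q iq with cov q p≼q iq
      ... | (r , r∈ , r≼q) , (r′ , r′∈ , q≼r′) = (r , keep x y r∈ , r≼q) , (r′ , keep x y r′∈ , q≼r′)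
      add : ∀ {q r J} → AtOrBefore d p q → AtOrBefore d p r → In J q → In J r → J ∈ everything ∷ I ∷ Is →
            Covers p (two (q , J) (r , J)) I → Sampling p (I ∷ Is)
      add {q} {r} {J} p≼q p≼r jq jr J∈ cov = record
        { points  = two (q , J) (r , J)
        ; chain   = insert-chain (insert (r , J) points) p≼q jq (insert-chain points p≼r jr chain)
        ; marks   = insert-all (insert (r , J) points) J∈ (insert-all points J∈ (VecAll.map weaken marks))
        ; covered = cov ∷ All.map (keepCovers (q , J) (r , J)) covered
        }
      extend : LastFrom d (In I) p → Sampling p (I ∷ Is)
      -- An interval not met on this side still receives two points, placed at `p` with the trivial
      -- label, so that the number of points depends on `Is` alone.
      extend (inj₂ none) = add (≼-refl d) (≼-refl d) (full p) (full p) (here refl)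
                             λ q p≼q iq → ⊥-elim (none q p≼q iq)
      -- The first occurrence of `I` is the last one met when walking back from its last occurrence
      -- `z`; the added condition keeps the walk from passing `p`.
      extend (inj₁ (z , p≼z , iz , max)) = first (last-satisfying (opp d) (λ r → AtOrBefore d p r × In I r)
                                                    (λ r → ≼? d p r ×-dec In? I r) z)
        where
        first : LastFrom (opp d) (λ r → AtOrBefore d p r × In I r) z → Sampling p (I ∷ Is)
        first (inj₂ none) = ⊥-elim (none z (≼-refl (opp d)) (p≼z , iz))
        first (inj₁ (a , z≼a , (p≼a , ia) , min)) =
          add p≼a p≼z ia iz (there (here refl)) λ q p≼q iq →
              (a , ∈-insert-here (a , I) (insert (z , I) points)
                 , ≼-opp⁻ d (min q (≼-opp d (max q p≼q iq)) (p≼q , iq)))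
            , (z , ∈-insert-there (a , I) (insert (z , I) points) (∈-insert-here (z , I) points) , max q p≼q iq)

    entries : ∀ {k} → Points k → Vec (Interval × Ty b) k
    entries = Vec.map λ (q , I) → I , truth b q

    positions : ∀ {k} → Fin (suc n) → Points k → Fin (suc k) → Fin (suc n)
    positions p ps = Vec.lookup (p ∷ Vec.map proj₁ ps)

    chain-≼ : ∀ {k} {p} (ps : Points k) → Chain p ps → ∀ {r I} → (r , I) ∈ᵥ ps → AtOrBefore d p r
    chain-≼ (x ∷ ps) (p≼q , _ , ch) (here refl) = p≼q
    chain-≼ (x ∷ ps) (p≼q , _ , ch) (there r∈)  = ≼-trans d p≼q (chain-≼ ps ch r∈)

    positions-monotone : ∀ {k} p (ps : Points k) → Chain p ps → Monotone (positions p ps)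
    positions-monotone p (x ∷ ps) (p≼q , _ , ch) Fin.zero    = p≼q
    positions-monotone p (x ∷ ps) (p≼q , _ , ch) (Fin.suc w) = positions-monotone (proj₁ x) ps ch w

    positions-clocks : ∀ {k} p (ps : Points k) → Chain p ps → ClocksAt (entries ps) (positions p ps)
    positions-clocks p (x ∷ ps) (_ , iq , ch) Fin.zero    = iq
    positions-clocks p (x ∷ ps) (_ , iq , ch) (Fin.suc w) = positions-clocks (proj₁ x) ps ch w

    ∈-pending : ∀ {k r I} (ps : Points k) → (r , I) ∈ᵥ ps → I ∈ pending (entries ps)
    ∈-pending (x ∷ ps) (here refl) = here refl
    ∈-pending (x ∷ ps) (there r∈)  = there (∈-pending ps r∈)

    truth-step : ∀ q q′ → Adjacent d q q′ → ordered d (StepOK b) (truth b q) (truth b q′)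
    truth-step = go d
      where
      go : ∀ d q q′ → Adjacent d q q′ → ordered d (StepOK b) (truth b q) (truth b q′)
      go fut  q q′ qq′ = truth-stepOK b q q′ qq′
      go past q q′ q′q = truth-stepOK b q′ q q′q

    true-clocks : ∀ q {P : Interval → Set} → (∀ I → I ∈ clocks b → In I q → P I) → All P (claimedClocks b (truth b q))
    true-clocks q h = All.zipWith (λ (I∈ , iq) → h _ I∈ iq) (claimedClocks⊆clocks b (truth b q) , truth-clocks b q)

    module _ (ℝ : CompleteOrderedField) where

      -- The two hypotheses say that every occurrence of an interval from p on lies
      -- between points labelled with it, those before p being recorded in seen.
      half-complete : ∀ {k} (ps : Points k) p seen → Chain p ps →
        (∀ I q → I ∈ clocks b → AtOrBefore d p q → In I q → I ∈ seen ⊎ ∃ λ r → (r , I) ∈ᵥ ps × AtOrBefore d r q) →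
        (∀ I q → I ∈ clocks b → Before d p q → In I q → ∃ λ r → (r , I) ∈ᵥ ps × AtOrBefore d q r) →
        Accepted ℝ (automata seen (truth b p) (entries ps)) (positions p ps)
      half-complete [] p seen _ lower upper = (λ ()) , Tail.run⇒∈L seen _ _
        (Tail.run-intro seen ℝ d f (endpoint d) (truth b) stop p (≼-endpoint d p) step)
        where
        in-seen : ∀ q → AtOrBefore d p q → ClocksIn seen (truth b q)
        in-seen q p≼q = true-clocks q go
          where
          go : ∀ I → I ∈ clocks b → In I q → I ∈ seen
          go I I∈ iq with lower I q I∈ p≼q iq
          ... | inj₁ I∈seen = I∈seen
        stop : Stop seen (truth b (endpoint d)) (f (endpoint d))
        stop = truth-letterOK b _ , truth-endOK d b , in-seen _ (≼-endpoint d p)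
        step : ∀ z z′ → Adjacent d z z′ → AtOrBefore d p z → AtOrBefore d z′ (endpoint d) →
               Step seen [] (truth b z) (f z) (truth b z′)
        step z z′ zz′ p≼z _ = truth-letterOK b z , truth-step z z′ zz′ , in-seen z p≼z
          , true-clocks z′ λ I I∈ iz′ → ⊥-elim (none (upper I z′ I∈ (≼-≺-trans d p≼z (adjacent⇒≺ d zz′)) iz′))
          where
          none : ∀ {I z′} → ¬ ∃ λ r → (r , I) ∈ᵥ [] × AtOrBefore d z′ r
          none (_ , () , _)
      half-complete ((p₁ , J) ∷ ps) p seen (p≼p₁ , jp₁ , ch) lower upper = accs , proj₂ rec
        where
        rest = J ∷ pending (entries ps)
        lower′ : ∀ I q → I ∈ clocks b → AtOrBefore d p₁ q → In I q → I ∈ J ∷ seen ⊎ ∃ λ r → (r , I) ∈ᵥ ps × AtOrBefore d r q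
        lower′ I q I∈ p₁≼q iq with lower I q I∈ (≼-trans d p≼p₁ p₁≼q) iq
        ... | inj₁ I∈seen                = inj₁ (there I∈seen)
        ... | inj₂ (r , here refl , _)   = inj₁ (here refl)
        ... | inj₂ (r , there r∈ , r≼q) = inj₂ (r , r∈ , r≼q)
        upper′ : ∀ I q → I ∈ clocks b → Before d p₁ q → In I q → ∃ λ r → (r , I) ∈ᵥ ps × AtOrBefore d q r
        upper′ I q I∈ p₁≺q iq with upper I q I∈ (≼-≺-trans d p≼p₁ p₁≺q) iq
        ... | r , here refl , q≼r = ⊥-elim (≺⇒⋡ d p₁≺q q≼r)
        ... | r , there r∈ , q≼r  = r , r∈ , q≼r
        rec = half-complete ps p₁ (J ∷ seen) ch lower′ upper′
        -- The certificate at or before `q` cannot be a point to come, as those lie at `p₁` or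
        -- later; so it has been recorded already.
        in-seen : ∀ q → AtOrBefore d p q → Before d q p₁ → ClocksIn seen (truth b q)
        in-seen q p≼q q≺p₁ = true-clocks q go
          where
          go : ∀ I → I ∈ clocks b → In I q → I ∈ seen
          go I I∈ iq with lower I q I∈ p≼q iq
          ... | inj₁ I∈seen               = I∈seen
          ... | inj₂ (r , here refl , r≼q) = ⊥-elim (≺⇒⋡ d q≺p₁ r≼q)
          ... | inj₂ (r , there r∈ , r≼q)  = ⊥-elim (≺⇒⋡ d q≺p₁ (≼-trans d (chain-≼ ps ch r∈) r≼q))
        step : ∀ z z′ → Adjacent d z z′ → AtOrBefore d p z → AtOrBefore d z′ p₁ →
               Step seen rest (truth b z) (f z) (truth b z′)
        step z z′ zz′ p≼z z′≼p₁ = truth-letterOK b z , truth-step z z′ zz′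
          , in-seen z p≼z (≺-≼-trans d z≺z′ z′≼p₁)
          , true-clocks z′ λ I I∈ iz′ →
              let (r , r∈ , _) = upper I z′ I∈ (≼-≺-trans d p≼z z≺z′) iz′ in ∈-pending ((p₁ , J) ∷ ps) r∈
          where z≺z′ = adjacent⇒≺ d zz′
        accs : ∀ w → Seg ℝ d f (positions p ((p₁ , J) ∷ ps) (inject₁ w)) (positions p ((p₁ , J) ∷ ps) (Fin.suc w))
                     ∈L automata seen (truth b p) (entries ((p₁ , J) ∷ ps)) (inject₁ w)
        accs Fin.zero    = Segment.run⇒∈L seen rest (truth b p₁) _ _
          (Segment.run-intro seen rest (truth b p₁) ℝ d f p₁ (truth b) refl p p≼p₁ step)
        accs (Fin.suc w) = proj₁ rec w

-- The translation of a freeze quantifier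

module OrderedField (ℝ : CompleteOrderedField) where
  open CompleteOrderedField ℝ hiding (refl; sym; trans; _*_) renaming (_+_ to _+ᴿ_; _≤_ to _≤ᴿ_)
  open CompleteOrderedField ℝ using () renaming (refl to ≈-refl; sym to ≈-sym; trans to ≈-trans)
  open IsDecTotalOrder isDecTotalOrder using (_≤?_; _≟_; antisym; ≤-respˡ-≈; ≤-respʳ-≈) renaming (trans to ≤-trans)
  open RingProperties ring using (-‿involutive; -0#≈0#)
  open Semantics ℝ

  fromℤ-neg : ∀ a → fromℤ (ℤ.- a) ≈ - fromℤ a
  fromℤ-neg (+ zero)    = ≈-sym -0#≈0#
  fromℤ-neg (+ (suc n)) = ≈-refl
  fromℤ-neg -[1+ n ]    = ≈-sym (-‿involutive _)

  neg-antitone : ∀ {x y} → x ≤ᴿ y → - y ≤ᴿ - x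
  neg-antitone {x} {y} x≤y = ≤-respˡ-≈ left (≤-respʳ-≈ right (+-monoˡ-≤ (- x +ᴿ - y) x≤y))
    where
    open SetoidReasoning setoid
    left : x +ᴿ (- x +ᴿ - y) ≈ - y
    left = begin
      x +ᴿ (- x +ᴿ - y) ≈⟨ +-assoc x (- x) (- y) ⟨
      (x +ᴿ - x) +ᴿ - y ≈⟨ +-congʳ (-‿inverseʳ x) ⟩
      0# +ᴿ - y        ≈⟨ +-identityˡ (- y) ⟩
      - y             ∎
    right : y +ᴿ (- x +ᴿ - y) ≈ - x
    right = begin
      y +ᴿ (- x +ᴿ - y) ≈⟨ +-congˡ (+-comm (- x) (- y)) ⟩
      y +ᴿ (- y +ᴿ - x) ≈⟨ +-assoc y (- y) (- x) ⟨
      (y +ᴿ - y) +ᴿ - x ≈⟨ +-congʳ (-‿inverseʳ y) ⟩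
      0# +ᴿ - x        ≈⟨ +-identityˡ (- x) ⟩
      - x             ∎

  neg-injective : ∀ {x y} → - x ≈ - y → x ≈ y
  neg-injective {x} {y} h = ≈-trans (≈-sym (-‿involutive x)) (≈-trans (-‿cong h) (-‿involutive y))

  above-resp : ∀ l {r r′} → r ≈ r′ → AboveLower r l → AboveLower r′ l
  above-resp -∞         e h       = tt
  above-resp (closed a) e h       = ≤-respʳ-≈ e h
  above-resp (open′ a)  e (h , n) = ≤-respʳ-≈ e h , λ eq → n (≈-trans eq (≈-sym e))

  below-resp : ∀ u {r r′} → r ≈ r′ → BelowUpper r u → BelowUpper r′ u
  below-resp +∞         e h       = tt
  below-resp (closed b) e h       = ≤-respˡ-≈ e h
  below-resp (open′ b)  e (h , n) = ≤-respˡ-≈ e h , λ eq → n (≈-trans e eq)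

  ∈ᴵ-resp : ∀ I {r r′} → r ≈ r′ → r ∈ᴵ I → r′ ∈ᴵ I
  ∈ᴵ-resp I e (a , b) = above-resp (lower I) e a , below-resp (upper I) e b

  above-mono : ∀ l {r r′} → r ≤ᴿ r′ → AboveLower r l → AboveLower r′ l
  above-mono -∞         r≤r′ h       = tt
  above-mono (closed a) r≤r′ h       = ≤-trans h r≤r′
  above-mono (open′ a)  r≤r′ (h , n) = ≤-trans h r≤r′ , λ eq → n (antisym h (≤-respʳ-≈ (≈-sym eq) r≤r′))

  below-anti : ∀ u {r r′} → r ≤ᴿ r′ → BelowUpper r′ u → BelowUpper r u
  below-anti +∞         r≤r′ h       = tt
  below-anti (closed b) r≤r′ h       = ≤-trans r≤r′ h
  below-anti (open′ b)  r≤r′ (h , n) = ≤-trans r≤r′ h , λ eq → n (antisym h (≤-respˡ-≈ eq r≤r′))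

  ∈ᴵ-convex : ∀ I {x y z} → x ≤ᴿ y → y ≤ᴿ z → x ∈ᴵ I → z ∈ᴵ I → y ∈ᴵ I
  ∈ᴵ-convex I x≤y y≤z (a , _) (_ , b) = above-mono (lower I) x≤y a , below-anti (upper I) y≤z b

  private
    <? : ∀ x y → Dec (x < y)
    <? x y = (x ≤? y) ×-dec ¬? (x ≟ y)

    above? : ∀ r l → Dec (AboveLower r l)
    above? r -∞         = yes tt
    above? r (closed a) = fromℤ a ≤? r
    above? r (open′ a)  = <? (fromℤ a) r

    below? : ∀ r u → Dec (BelowUpper r u)
    below? r +∞         = yes tt
    below? r (closed a) = r ≤? fromℤ a
    below? r (open′ a)  = <? r (fromℤ a)

  ∈ᴵ? : ∀ r I → Dec (r ∈ᴵ I)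
  ∈ᴵ? r I = above? r (lower I) ×-dec below? r (upper I)

  above-neg : ∀ l {r} → AboveLower r l → BelowUpper (- r) (negLower l)
  above-neg -∞         h       = tt
  above-neg (closed a) h       = ≤-respʳ-≈ (≈-sym (fromℤ-neg a)) (neg-antitone h)
  above-neg (open′ a)  (h , n) = ≤-respʳ-≈ (≈-sym (fromℤ-neg a)) (neg-antitone h)
                               , λ eq → n (≈-sym (neg-injective (≈-trans eq (fromℤ-neg a))))

  below-neg : ∀ u {r} → BelowUpper r u → AboveLower (- r) (negUpper u)
  below-neg +∞         h       = tt
  below-neg (closed a) h       = ≤-respˡ-≈ (≈-sym (fromℤ-neg a)) (neg-antitone h)
  below-neg (open′ a)  (h , n) = ≤-respˡ-≈ (≈-sym (fromℤ-neg a)) (neg-antitone h)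
                               , λ eq → n (≈-sym (neg-injective (≈-trans (≈-sym (fromℤ-neg a)) eq)))

  private
    above-neg⁻ : ∀ u {r} → AboveLower r (negUpper u) → BelowUpper (- r) u
    above-neg⁻ +∞         h       = tt
    above-neg⁻ (closed a) h       = ≤-respʳ-≈ (≈-trans (-‿cong (fromℤ-neg a)) (-‿involutive _)) (neg-antitone h)
    above-neg⁻ (open′ a)  (h , n) = ≤-respʳ-≈ e (neg-antitone h) , λ eq → n (neg-injective (≈-sym (≈-trans eq (≈-sym e))))
      where e = ≈-trans (-‿cong (fromℤ-neg a)) (-‿involutive _)

    below-neg⁻ : ∀ l {r} → BelowUpper r (negLower l) → AboveLower (- r) l
    below-neg⁻ -∞         h       = tt
    below-neg⁻ (closed a) h       = ≤-respˡ-≈ (≈-trans (-‿cong (fromℤ-neg a)) (-‿involutive _)) (neg-antitone h)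
    below-neg⁻ (open′ a)  (h , n) = ≤-respˡ-≈ e (neg-antitone h) , λ eq → n (neg-injective (≈-sym (≈-trans e eq)))
      where e = ≈-trans (-‿cong (fromℤ-neg a)) (-‿involutive _)

  -[x-y]≈y-x : ∀ x y → - (x - y) ≈ y - x
  -[x-y]≈y-x x y = begin
    - (x - y)     ≈⟨ -‿anti-homo-+ x (- y) ⟩
    - - y +ᴿ - x   ≈⟨ +-congʳ (-‿involutive y) ⟩
    y - x         ∎
    where
    open SetoidReasoning setoid
    open RingProperties ring using (-‿anti-homo-+)

  negInterval⁺ : ∀ I {x y} → x - y ∈ᴵ I → y - x ∈ᴵ negInterval I
  negInterval⁺ I {x} {y} (a , b) =
    above-resp (negUpper (upper I)) (-[x-y]≈y-x x y) (below-neg (upper I) b) ,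
    below-resp (negLower (lower I)) (-[x-y]≈y-x x y) (above-neg (lower I) a)

  negInterval⁻ : ∀ I {x y} → x - y ∈ᴵ negInterval I → y - x ∈ᴵ I
  negInterval⁻ I {x} {y} (a , b) =
    above-resp (lower I) (-[x-y]≈y-x x y) (below-neg⁻ (lower I) b) ,
    below-resp (upper I) (-[x-y]≈y-x x y) (above-neg⁻ (upper I) a)

-- `𝓟` measures the time from the chosen point up to the freeze point, which is the negative of
-- `T - x` at the chosen point.
toward : Dir → Interval → Interval
toward fut  = id
toward past = negInterval

modality : ∀ {m s} → Dir → (k : ℕ) .{{_ : NonZero k}} → (Fin k → Interval) → (Fin (suc k) → NFA s) →
           (Fin s → PnEMTL m) → PnEMTL m
modality fut  k I A Θ = 𝓕 k I A Θ
modality past k I A Θ = 𝓟 k I A Θ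

-- The alphabet may be empty, so falsity cannot be built from propositions.
bottom : ∀ {m} → PnEMTL m
bottom = 𝓕 1 (λ _ → everything) {0} (λ _ → record { states = 0 ; initial = [] ; final = [] ; transitions = [] }) λ ()

_∨ᴾ_ : ∀ {m} → PnEMTL m → PnEMTL m → PnEMTL m
φ ∨ᴾ χ = ¬′ ((¬′ φ) ∧ (¬′ χ))

⋁ : ∀ {m} → List (PnEMTL m) → PnEMTL m
⋁ []       = bottom
⋁ (φ ∷ φs) = φ ∨ᴾ ⋁ φs

module _ {m s : ℕ} (b : Body s) (Is : List Interval) (Θ : Fin s → PnEMTL m) where

  entryVectors : List (Vec (Interval × Ty b) (suc (double (length Is))))
  entryVectors = vecsOver (cartesianProduct (everything ∷ Is) (allTy b)) _

  guess : Dir → Ty b → Vec (Interval × Ty b) (suc (double (length Is))) → PnEMTL m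
  guess d t es = modality d _ (λ w → toward d (proj₁ (Vec.lookup es w))) (Halves.automata b d [] t es) Θ

  -- The automata compare claims with pending intervals only on arrival at a position, hence never
  -- at the freeze point. The missing test does not depend on the word, so it can be made while the
  -- disjunction is formed.
  admissible? : ∀ d (t : Ty b) (es : Vec (Interval × Ty b) (suc (double (length Is)))) → Dec _
  admissible? d t es = Halves.clocksIn? b d (pending es) t

  guesses : Dir → Ty b → List (PnEMTL m)
  guesses d t = map (guess d t) (filter (admissible? d t) entryVectors)

  half : Dir → Ty b → PnEMTL m
  half d t = ⋁ (guesses d t)

  claiming : List (Ty b)
  claiming = filter (λ t → Bool.T? (proj₁ t)) (allTy b)

  bothHalves : Ty b → PnEMTL m
  bothHalves t = half fut t ∧ half past t

  freeze : PnEMTL m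
  freeze = ⋁ (map bothHalves claiming)

-- Correctness at a freeze point

module Correctness (ℝ : CompleteOrderedField) where
  open CompleteOrderedField ℝ using (Carrier; _≈_; _-_; +-congˡ; +-monoˡ-≤; -‿cong)
    renaming (sym to ≈-sym; refl to ≈-refl)
  open Semantics ℝ
  open OrderedField ℝ

  ⋁-intro : ∀ {m} {ρ : TimedWord m} {i φ} {φs : List (PnEMTL m)} → φ ∈ φs → ρ , i ⊨ᴾ φ → ρ , i ⊨ᴾ ⋁ φs
  ⋁-intro (here refl) h (¬φ , _) = ¬φ h
  ⋁-intro (there φ∈)  h (_ , ¬φs) = ¬φs (⋁-intro φ∈ h)

  -- A disjunction written with negations yields no disjunct constructively, only a contradiction
  -- when all disjuncts fail. Soundness therefore works under double negation until
  -- `decidable-stable` applies to the body. In the base case the automata of `bottom` have no state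
  -- to start in.
  ⋁-elim : ∀ {m} {ρ : TimedWord m} {i} (φs : List (PnEMTL m)) →
           (∀ φ → φ ∈ φs → ¬ (ρ , i ⊨ᴾ φ)) → ¬ (ρ , i ⊨ᴾ ⋁ φs)
  ⋁-elim []       ¬φ (_ , _ , _ , _ , _ , _ , _ , () , _)
  ⋁-elim (φ ∷ φs) ¬φ h = h (¬φ φ (here refl) , ⋁-elim φs λ χ χ∈ → ¬φ χ (there χ∈))

  module _ {m : ℕ} (ρ : TimedWord m) where

    Labels : ∀ {s} → (Fin s → PnEMTL m) → (Pos ρ → Subset s) → Set
    Labels Θ f = ∀ j t → t ∈ˢ f j ⇔ (ρ , j ⊨ᴾ Θ t)

    labels-unique : ∀ {s} {Θ : Fin s → PnEMTL m} {f f′} → Labels Θ f → Labels Θ f′ → ∀ j → f j ≡ f′ j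
    labels-unique l l′ j = ⊆-antisym (λ h → from (l′ j _) (to (l j _) h)) (λ h → from (l j _) (to (l′ j _) h))
      where open Equivalence

    Seg-cong : ∀ {s} d {f f′ : Pos ρ → Subset s} → (∀ j → f j ≡ f′ j) → ∀ x y → Seg ℝ d f x y ≡ Seg ℝ d f′ x y
    Seg-cong fut  eq x y = map-cong eq (range x y)
    Seg-cong past eq x y = cong reverse (map-cong eq (range y x))

    distance : Dir → Pos ρ → Pos ρ → Carrier
    distance fut  p q = τ ρ q - τ ρ p
    distance past p q = τ ρ p - τ ρ q

    module _ {s : ℕ} (f : Pos ρ → Subset s) (d : Dir) (i₀ : Pos ρ) where

      Witness : ∀ k → (Fin k → Interval) → (Fin (suc k) → NFA s) → Set
      Witness k I A = ∃ λ (i : Fin (suc k) → Pos ρ) →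
        i Fin.zero ≡ i₀ ×
        (∀ w → AtOrBefore d (i (inject₁ w)) (i (Fin.suc w))) ×
        (∀ w → distance d i₀ (i (Fin.suc w)) ∈ᴵ I w) ×
        (∀ w → Seg ℝ d f (i (inject₁ w)) (i (Fin.suc w)) ∈L A (inject₁ w)) ×
        Seg ℝ d f (i (fromℕ k)) (endpoint d) ∈L A (fromℕ k)

    modality⁺ : ∀ {s} d k .{{_ : NonZero k}} {I} {A : Fin (suc k) → NFA s} {Θ f i₀} → Labels Θ f → Witness f d i₀ k I A →
                ρ , i₀ ⊨ᴾ modality d k I A Θ
    modality⁺ fut  k l w = _ , l , w
    modality⁺ past k l w = _ , l , w

    -- The modality brings its own labelling `f′`. Truth determines it at every position, so it
    -- agrees with the given `f` and the accepted segments can be exchanged.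
    modality⁻ : ∀ {s} d k .{{_ : NonZero k}} {I} {A : Fin (suc k) → NFA s} {Θ f i₀} → Labels Θ f →
                ρ , i₀ ⊨ᴾ modality d k I A Θ → Witness f d i₀ k I A
    modality⁻ {s} d k {I} {A} {Θ} {f} {i₀} l h with unfold d h
      where
      unfold : ∀ d → ρ , i₀ ⊨ᴾ modality d k I A Θ → ∃ λ f → Labels Θ f × Witness f d i₀ k I A
      unfold fut  h = h
      unfold past h = h
    ... | f′ , l′ , i , start , mono , at , accs , acc =
      i , start , mono , at , (λ w → convert (accs w)) , convert acc
      where
      convert : ∀ {x y} {B : NFA s} → Seg ℝ d f′ x y ∈L B → Seg ℝ d f x y ∈L B
      convert = subst (_∈L _) (Seg-cong d (labels-unique l′ l) _ _)

    -- The clock value `ν` is kept apart from `τ ρ i₀` because the initial value `0#` equals the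
    -- first time stamp only up to `≈`.
    module _ {s : ℕ} (b : Body s) (Is : List Interval) (Θ : Fin s → PnEMTL m)
             (clocks⊆ : ∀ {I} → I ∈ clocks b → I ∈ Is)
             (f : Pos ρ → Subset s) (labels : Labels Θ f) (i₀ : Pos ρ) (ν : Carrier) (ν≈ : ν ≈ τ ρ i₀) where

      In : Interval → Pos ρ → Set
      In I q = τ ρ q - ν ∈ᴵ I

      In? : ∀ I q → Dec (In I q)
      In? I q = ∈ᴵ? _ I

      open BodySemantics f In In?

      convexᶠ : ∀ I {p q r} → p Fin.≤ q → q Fin.≤ r → In I p → In I r → In I q
      convexᶠ I p≤q q≤r = ∈ᴵ-convex I (+-monoˡ-≤ _ (τ-mono ρ p≤q)) (+-monoˡ-≤ _ (τ-mono ρ q≤r))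

      convex : ∀ d I {p q r} → AtOrBefore d p q → AtOrBefore d q r → In I p → In I r → In I q
      convex fut  I p≼q q≼r ip ir = convexᶠ I p≼q q≼r ip ir
      convex past I p≼q q≼r ip ir = convexᶠ I q≼r p≼q ir ip

      distance⁻ : ∀ d I q → distance d i₀ q ∈ᴵ toward d I → In I q
      distance⁻ fut  I q h = ∈ᴵ-resp I (+-congˡ (-‿cong (≈-sym ν≈))) h
      distance⁻ past I q h = ∈ᴵ-resp I (+-congˡ (-‿cong (≈-sym ν≈))) (negInterval⁻ I h)

      distance⁺ : ∀ d I q → In I q → distance d i₀ q ∈ᴵ toward d I
      distance⁺ fut  I q h = ∈ᴵ-resp I (+-congˡ (-‿cong ν≈)) h
      distance⁺ past I q h = negInterval⁺ I (∈ᴵ-resp I (+-congˡ (-‿cong ν≈)) h)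

      module H d = Halves b d
      module W d = Halves.OnWord b d f In In? (convex d)

      HalfHintikkaAt : Dir → Ty b → Set
      HalfHintikkaAt d t = W.HalfHintikka d i₀ t

      guess-sound : ∀ d t es → H.ClocksIn d (pending es) t → ρ , i₀ ⊨ᴾ guess b Is Θ d t es → HalfHintikkaAt d t
      guess-sound d t es cl h with modality⁻ d _ labels h
      ... | i , refl , mono , at , acc =
        W.half-sound d ℝ es [] t i mono at′ acc []
          (All.map (All.lookup (W.pending-awaited d es i mono at′)) cl)
        where
        at′ : ∀ w → In (proj₁ (Vec.lookup es w)) (i (Fin.suc w))
        at′ w = distance⁻ d _ _ (at w)

      half-soundᴾ : ∀ d t → ρ , i₀ ⊨ᴾ half b Is Θ d t → ¬ ¬ HalfHintikkaAt d t
      half-soundᴾ d t h ¬hh = ⋁-elim (guesses b Is Θ d t) each h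
        where
        each : ∀ φ → φ ∈ _ → ¬ (ρ , i₀ ⊨ᴾ φ)
        each φ φ∈ hφ with ∈-map⁻ (guess b Is Θ d t) φ∈
        ... | es , es∈ , refl = ¬hh (guess-sound d t es (proj₂ (∈-filter⁻ (admissible? b Is Θ d t) {xs = entryVectors b Is Θ} es∈)) hφ)

      half-completeᴾ : ∀ d → ρ , i₀ ⊨ᴾ half b Is Θ d (truth b i₀)
      half-completeᴾ d = ⋁-intro (∈-map⁺ (guess b Is Θ d t) (∈-filter⁺ (admissible? b Is Θ d t) es∈ admissible)) sat
        where
        t = truth b i₀
        open W.Sampling d (W.sampling d (λ _ → tt , tt) i₀ Is)
        es = W.entries d points
        cover : ∀ I q → I ∈ clocks b → AtOrBefore d i₀ q → In I q → _
        cover I q I∈ i₀≼q iq = All.lookup covered (clocks⊆ I∈) q i₀≼q iq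
        admissible : H.ClocksIn d (pending es) t
        admissible = W.true-clocks d i₀ λ I I∈ iq →
          W.∈-pending d points (proj₁ (proj₂ (proj₁ (cover I i₀ I∈ (≼-refl d) iq))))
        es∈ : es ∈ entryVectors b Is Θ
        es∈ = ∈-vecsOver⁺ es λ w → subst (_∈ _) (sym (Vec.lookup-map w _ points))
                (∈-cartesianProduct⁺ (VecAll.lookup⁺ marks w) (∈-allTy b _))
        accepted = W.half-complete d ℝ points i₀ [] chain
          (λ I q I∈ i₀≼q iq → inj₂ (proj₁ (cover I q I∈ i₀≼q iq)))
          (λ I q I∈ i₀≺q iq → proj₂ (cover I q I∈ (≺⇒≼ d i₀≺q) iq))
        sat : ρ , i₀ ⊨ᴾ guess b Is Θ d t es
        sat = modality⁺ d _ labels ( W.positions d i₀ points , refl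
                                   , W.positions-monotone d i₀ points chain
                                   , (λ w → distance⁺ d _ _ (W.positions-clocks d i₀ points chain w))
                                   , accepted)

      -- The halves agree on the type at `i₀`. Two adjacent positions never lie on opposite sides of
      -- `i₀`, so every step condition is one of a single half.
      glue : ∀ t → HalfHintikkaAt fut t → HalfHintikkaAt past t → ∃ λ g → g i₀ ≡ t × Hintikka b g
      glue t hf hp = g , g-start , record { truthful = tr ; stepOK = st ; endOK = en }
        where
        module F = W.HalfHintikka fut hf
        module P = W.HalfHintikka past hp
        g : Pos ρ → Ty b
        g q with q Fin.<? i₀
        ... | yes _ = P.type q
        ... | no  _ = F.type q
        g-past : ∀ {q} → q Fin.≤ i₀ → g q ≡ P.type q
        g-past {q} q≤i₀ with q Fin.<? i₀
        ... | yes _   = refl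
        ... | no q≮i₀ with ≼-antisym fut q≤i₀ (⊀⇒≽ fut q≮i₀)
        ...   | refl  = trans (F.start) (sym (P.start))
        g-fut : ∀ {q} → i₀ Fin.≤ q → g q ≡ F.type q
        g-fut {q} i₀≤q with q Fin.<? i₀
        ... | yes q<i₀ = ⊥-elim (≺⇒⋡ fut q<i₀ i₀≤q)
        ... | no _     = refl
        g-start : g i₀ ≡ t
        g-start = trans (g-fut (≼-refl fut {i₀})) (F.start)
        tr : ∀ q → Truthful b (g q) q
        tr q with ≼? fut i₀ q
        ... | yes i₀≤q = subst (λ x → Truthful b x q) (sym (g-fut i₀≤q)) (F.truthful q i₀≤q)
        ... | no i₀≰q  = subst (λ x → Truthful b x q) (sym (g-past q≤i₀)) (P.truthful q q≤i₀)
          where q≤i₀ = ⊀⇒≽ fut λ i₀<q → i₀≰q (≺⇒≼ fut {p = i₀} i₀<q)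
        st : ∀ p q → Adjacent fut p q → StepOK b (g p) (g q)
        st p q pq with ≼? fut i₀ p
        ... | yes i₀≤p = subst₂ (StepOK b) (sym (g-fut i₀≤p)) (sym (g-fut i₀≤q)) (F.stepOK p q i₀≤p pq)
          where i₀≤q = ≼-trans fut {i₀} {p} {q} i₀≤p (≺⇒≼ fut {p = p} (adjacent⇒≺ fut {p} {q} pq))
        ... | no i₀≰p = subst₂ (StepOK b) (sym (g-past p≤i₀)) (sym (g-past q≤i₀)) (P.stepOK q p q≤i₀ pq)
          where
          p<i₀ = ℕ.≰⇒> i₀≰p
          q≤i₀ = adjacent-≺⇒≼ fut {p} {q} {i₀} pq p<i₀
          p≤i₀ = ≺⇒≼ fut {p = p} {i₀} p<i₀
        en : ∀ d → EndOK d b (g (endpoint d))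
        en fut  = subst (EndOK fut b) (sym (g-fut (≼-endpoint fut i₀))) (F.endOK)
        en past = subst (EndOK past b) (sym (g-past (≼-endpoint past i₀))) (P.endOK)

      freeze-sound : ρ , i₀ ⊨ᴾ freeze b Is Θ → Sat b i₀
      freeze-sound h = decidable-stable (sat? b i₀) λ ¬sat → ⋁-elim (map (bothHalves b Is Θ) (claiming b Is Θ)) (each ¬sat) h
        where
        each : ¬ Sat b i₀ → ∀ φ → φ ∈ _ → ¬ (ρ , i₀ ⊨ᴾ φ)
        each ¬sat φ φ∈ hφ with ∈-map⁻ (bothHalves b Is Θ) φ∈
        each ¬sat φ φ∈ (hf , hp) | t , t∈ , refl = half-soundᴾ fut t hf λ f′ → half-soundᴾ past t hp λ p′ → contra f′ p′
          where
          contra : HalfHintikkaAt fut t → HalfHintikkaAt past t → ⊥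
          contra hf hp with glue t hf hp
          ... | g , refl , hint = ¬sat (hintikka-sound b g hint i₀ (proj₂ (∈-filter⁻ (λ t → Bool.T? (proj₁ t)) {xs = allTy b} t∈)))

      freeze-complete : Sat b i₀ → ρ , i₀ ⊨ᴾ freeze b Is Θ
      freeze-complete h = ⋁-intro
        (∈-map⁺ (bothHalves b Is Θ)
          (∈-filter⁺ (λ t → Bool.T? (proj₁ t)) (∈-allTy b (truth b i₀)) (sat⇒claimed b h)))
        (half-completeᴾ fut , half-completeᴾ past)

-- The translation of a formula

-- Occurrences of propositions and of outermost freezes. Their truth does not depend on the current
-- clock value, so a body may read them as letters.
leaves : ∀ {m} → TPTL m → ℕ
leaves (prop a)  = 1
leaves (¬prop a) = 1
leaves true      = 0
leaves false     = 0
leaves (x∙ φ)    = 1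
leaves (T-x∈ I)  = 0
leaves (x-T∈ I)  = 0
leaves (φ ∧ χ)   = leaves φ ℕ.+ leaves χ
leaves (φ ∨ χ)   = leaves φ ℕ.+ leaves χ
leaves (φ U χ)   = leaves φ ℕ.+ leaves χ
leaves (φ S χ)   = leaves φ ℕ.+ leaves χ
leaves (G φ)     = leaves φ
leaves (H φ)     = leaves φ

-- The embedding e places the leaves of φ among the letters of an enclosing body.
body : ∀ {m s} (φ : TPTL m) → (Fin (leaves φ) → Fin s) → Body s
body (prop a)  e = lit λ A → isYes (e Fin.zero ∈? A)
body (¬prop a) e = lit λ A → isNo (e Fin.zero ∈? A)
body true      e = lit λ _ → true
body false     e = lit λ _ → false
body (x∙ φ)    e = lit λ A → isYes (e Fin.zero ∈? A)
body (T-x∈ I)  e = clk I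
body (x-T∈ I)  e = clk (negInterval I)
body (φ ∧ χ)   e = body φ (e ∘ (_↑ˡ leaves χ)) and body χ (e ∘ (leaves φ ↑ʳ_))
body (φ ∨ χ)   e = body φ (e ∘ (_↑ˡ leaves χ)) or body χ (e ∘ (leaves φ ↑ʳ_))
body (φ U χ)   e = until fut (body φ (e ∘ (_↑ˡ leaves χ))) (body χ (e ∘ (leaves φ ↑ʳ_)))
body (φ S χ)   e = until past (body φ (e ∘ (_↑ˡ leaves χ))) (body χ (e ∘ (leaves φ ↑ʳ_)))
body (G φ)     e = always fut (body φ e)
body (H φ)     e = always past (body φ e)

clocks-body : ∀ {m s} (φ : TPTL m) (e : Fin (leaves φ) → Fin s) → clocks (body φ e) ≡ freeIntervals φ
clocks-body (prop a)  e = refl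
clocks-body (¬prop a) e = refl
clocks-body true      e = refl
clocks-body false     e = refl
clocks-body (x∙ φ)    e = refl
clocks-body (T-x∈ I)  e = refl
clocks-body (x-T∈ I)  e = refl
clocks-body (φ ∧ χ)   e = cong₂ _++_ (clocks-body φ _) (clocks-body χ _)
clocks-body (φ ∨ χ)   e = cong₂ _++_ (clocks-body φ _) (clocks-body χ _)
clocks-body (φ U χ)   e = cong₂ _++_ (clocks-body φ _) (clocks-body χ _)
clocks-body (φ S χ)   e = cong₂ _++_ (clocks-body φ _) (clocks-body χ _)
clocks-body (G φ)     e = clocks-body φ e
clocks-body (H φ)     e = clocks-body φ e

-- Repetitions must go: the number of points, and with it the arity, has to be bounded by the
-- available intervals rather than by the size of the formula.
constraints : ∀ {m} → TPTL m → List Interval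
constraints φ = deduplicate _≟ⁱ_ (freeIntervals φ)

-- translate φ expresses x∙ φ.
translate : ∀ {m} → TPTL m → PnEMTL m
leaf : ∀ {m} (φ : TPTL m) → Fin (leaves φ) → PnEMTL m
translate φ = freeze (body φ id) (constraints φ) (leaf φ)
leaf (prop a)  _ = prop a
-- The negation is part of the letter test in `body`.
leaf (¬prop a) _ = prop a
leaf (x∙ φ)    _ = translate φ
leaf (φ ∧ χ)     = leaf φ Vector.++ leaf χ
leaf (φ ∨ χ)     = leaf φ Vector.++ leaf χ
leaf (φ U χ)     = leaf φ Vector.++ leaf χ
leaf (φ S χ)     = leaf φ Vector.++ leaf χ
leaf (G φ)       = leaf φ
leaf (H φ)       = leaf φ

++-∀ : ∀ {A : Set} {P : A → Set} {k l} {xs : Fin k → A} {ys : Fin l → A} →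
       (∀ i → P (xs i)) → (∀ i → P (ys i)) → ∀ i → P ((xs Vector.++ ys) i)
++-∀ {k = k} hx hy i with splitAt k i
... | inj₁ j = hx j
... | inj₂ j = hy j

separate : ∀ {s} {P : Fin s → Set} (P? : ∀ t → Dec (P t)) → Subset s
separate P? = Vec.tabulate (λ t → does (P? t))

∈-separate : ∀ {s} {P : Fin s → Set} (P? : ∀ t → Dec (P t)) t → t ∈ˢ separate P? ⇔ P t
∈-separate {P = P} P? t = mk⇔ to from
  where
  lookup≡ : Vec.lookup (separate P?) t ≡ does (P? t)
  lookup≡ = Vec.lookup∘tabulate (λ t → does (P? t)) t
  to : t ∈ˢ separate P? → P t
  to t∈ with P? t | trans (sym lookup≡) (Vec.[]=⇒lookup t∈)
  ... | yes p | _ = p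
  from : P t → t ∈ˢ separate P?
  from p = Vec.lookup⇒[]= t (separate P?) (trans lookup≡ (dec-true (P? t) p))

-- Correctness of the translation of formulas

module TranslationCorrect (ℝ : CompleteOrderedField) where
  open CompleteOrderedField ℝ using (Carrier; _≈_; _-_) renaming (refl to ≈-refl; sym to ≈-sym)
  open Semantics ℝ
  open OrderedField ℝ
  open Correctness ℝ

  module _ {m : ℕ} (ρ : TimedWord m) where

    -- One recursion up to `leaf?`: the letters of `φ` require its leaves to be decided. A freeze
    -- among them is decided by evaluating its body on its own letters, and `freeze-correct`
    -- transfers the answer to its translation.
    translate? : ∀ (φ : TPTL m) i → Dec (ρ , i ⊨ᴾ translate φ)
    leaf? : ∀ (φ : TPTL m) t i → Dec (ρ , i ⊨ᴾ leaf φ t)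

    letters : (φ : TPTL m) → Pos ρ → Subset (leaves φ)
    letters φ i = separate (λ t → leaf? φ t i)

    labels : ∀ φ → Labels ρ (leaf φ) (letters φ)
    labels φ i t = ∈-separate (λ t → leaf? φ t i) t

    clocks⊆ : ∀ {s} (φ : TPTL m) (e : Fin (leaves φ) → Fin s) {I} → I ∈ clocks (body φ e) → I ∈ constraints φ
    clocks⊆ φ e I∈ = ∈-deduplicate⁺ _≟ⁱ_ (subst (_ ∈_) (clocks-body φ e) I∈)

    module Sem ν {s} (f : Pos ρ → Subset s) =
      BodySemantics f (λ I q → τ ρ q - ν ∈ᴵ I) (λ I q → ∈ᴵ? (τ ρ q - ν) I)

    freeze-correct : ∀ φ i ν → ν ≈ τ ρ i → Sem.Sat ν (letters φ) (body φ id) i ⇔ (ρ , i ⊨ᴾ translate φ)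
    freeze-correct φ i ν ν≈ = mk⇔
      (freeze-complete ρ (body φ id) (constraints φ) (leaf φ) (clocks⊆ φ id) (letters φ) (labels φ) i ν ν≈)
      (freeze-sound ρ (body φ id) (constraints φ) (leaf φ) (clocks⊆ φ id) (letters φ) (labels φ) i ν ν≈)

    translate? φ i = map′ to from (Sem.sat? (τ ρ i) (letters φ) (body φ id) i)
      where open Equivalence (freeze-correct φ i (τ ρ i) ≈-refl)

    leaf? (prop a)  _ i = a ∈? σ ρ i
    leaf? (¬prop a) _ i = a ∈? σ ρ i
    leaf? (x∙ φ)    _ i = translate? φ i
    leaf? (φ ∧ χ)   t i = ++-∀ {P = λ θ → Dec (ρ , i ⊨ᴾ θ)} (λ t → leaf? φ t i) (λ t → leaf? χ t i) t
    leaf? (φ ∨ χ)   t i = ++-∀ {P = λ θ → Dec (ρ , i ⊨ᴾ θ)} (λ t → leaf? φ t i) (λ t → leaf? χ t i) t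
    leaf? (φ U χ)   t i = ++-∀ {P = λ θ → Dec (ρ , i ⊨ᴾ θ)} (λ t → leaf? φ t i) (λ t → leaf? χ t i) t
    leaf? (φ S χ)   t i = ++-∀ {P = λ θ → Dec (ρ , i ⊨ᴾ θ)} (λ t → leaf? φ t i) (λ t → leaf? χ t i) t
    leaf? (G φ)     t i = leaf? φ t i
    leaf? (H φ)     t i = leaf? φ t i

    open Equivalence

    Marks : ∀ {k s} → (Fin k → Fin s) → (Pos ρ → Subset s) → (Fin k → PnEMTL m) → Set
    Marks e f θs = ∀ t j → e t ∈ˢ f j ⇔ (ρ , j ⊨ᴾ θs t)

    marksˡ : ∀ {k l s} {e : Fin (k ℕ.+ l) → Fin s} {f} (xs : Fin k → PnEMTL m) (ys : Fin l → PnEMTL m) →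
             Marks e f (xs Vector.++ ys) → Marks (e ∘ (_↑ˡ l)) f xs
    marksˡ {l = l} {e = e} {f} xs ys h t j =
      subst (λ θ → e (t ↑ˡ l) ∈ˢ f j ⇔ (ρ , j ⊨ᴾ θ)) (Vector.lookup-++ˡ xs ys t) (h (t ↑ˡ l) j)

    marksʳ : ∀ {k l s} {e : Fin (k ℕ.+ l) → Fin s} {f} (xs : Fin k → PnEMTL m) (ys : Fin l → PnEMTL m) →
             Marks e f (xs Vector.++ ys) → Marks (e ∘ (k ↑ʳ_)) f ys
    marksʳ {k} {e = e} {f} xs ys h t j =
      subst (λ θ → e (k ↑ʳ t) ∈ˢ f j ⇔ (ρ , j ⊨ᴾ θ)) (Vector.lookup-++ʳ xs ys t) (h (k ↑ʳ t) j)

    translate-correct : ∀ φ i ν → ν ≈ τ ρ i → (ρ , i ⊨ᴾ translate φ) ⇔ (ρ , i , ν ⊨ᵀ φ)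
    body-correct : ∀ {s} φ (e : Fin (leaves φ) → Fin s) (f : Pos ρ → Subset s) ν →
      Marks e f (leaf φ) → ∀ q → Sem.Sat ν f (body φ e) q ⇔ (ρ , q , ν ⊨ᵀ φ)

    translate-correct φ i ν ν≈ = mk⇔
      (to (body-correct φ id (letters φ) ν (λ t j → labels φ j t) i) ∘ from (freeze-correct φ i ν ν≈))
      (to (freeze-correct φ i ν ν≈) ∘ from (body-correct φ id (letters φ) ν (λ t j → labels φ j t) i))

    body-correct (prop a) e f ν l q = mk⇔ (to (l Fin.zero q) ∘ toWitness) (fromWitness ∘ from (l Fin.zero q))
    body-correct (¬prop a) e f ν l q =
      mk⇔ (λ h a∈ → toWitnessFalse h (from (l Fin.zero q) a∈)) (λ h → fromWitnessFalse (h ∘ to (l Fin.zero q)))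
    body-correct true e f ν l q = mk⇔ id id
    body-correct false e f ν l q = mk⇔ id id
    body-correct (x∙ φ) e f ν l q = mk⇔ (to c ∘ to (l Fin.zero q) ∘ toWitness) (fromWitness ∘ from (l Fin.zero q) ∘ from c)
      where c = translate-correct φ q (τ ρ q) ≈-refl
    body-correct (T-x∈ I) e f ν l q = mk⇔ id id
    body-correct (x-T∈ I) e f ν l q = mk⇔ (negInterval⁻ I) (negInterval⁺ I)
    body-correct (φ ∧ χ) e f ν l q = mk⇔ (Product.map (to cφ) (to cχ)) (Product.map (from cφ) (from cχ))
      where
      cφ = body-correct φ _ f ν (marksˡ (leaf φ) (leaf χ) l) q
      cχ = body-correct χ _ f ν (marksʳ (leaf φ) (leaf χ) l) q
    body-correct (φ ∨ χ) e f ν l q = mk⇔ (Sum.map (to cφ) (to cχ)) (Sum.map (from cφ) (from cχ))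
      where
      cφ = body-correct φ _ f ν (marksˡ (leaf φ) (leaf χ) l) q
      cχ = body-correct χ _ f ν (marksʳ (leaf φ) (leaf χ) l) q
    body-correct (φ U χ) e f ν l q = mk⇔
      (λ (j , q<j , c , between) → j , q<j , to (cχ j) c , λ k q<k k<j → to (cφ k) (between k q<k k<j))
      (λ (j , q<j , c , between) → j , q<j , from (cχ j) c , λ k q<k k<j → from (cφ k) (between k q<k k<j))
      where
      cφ = body-correct φ _ f ν (marksˡ (leaf φ) (leaf χ) l)
      cχ = body-correct χ _ f ν (marksʳ (leaf φ) (leaf χ) l)
    body-correct (φ S χ) e f ν l q = mk⇔
      (λ (j , j<q , c , between) → j , j<q , to (cχ j) c , λ k j<k k<q → to (cφ k) (between k k<q j<k))
      (λ (j , j<q , c , between) → j , j<q , from (cχ j) c , λ k k<q j<k → from (cφ k) (between k j<k k<q))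
      where
      cφ = body-correct φ _ f ν (marksˡ (leaf φ) (leaf χ) l)
      cχ = body-correct χ _ f ν (marksʳ (leaf φ) (leaf χ) l)
    body-correct (G φ) e f ν l q =
      mk⇔ (λ h j q<j → to (body-correct φ e f ν l j) (h j q<j)) (λ h j q<j → from (body-correct φ e f ν l j) (h j q<j))
    body-correct (H φ) e f ν l q =
      mk⇔ (λ h j j<q → to (body-correct φ e f ν l j) (h j j<q)) (λ h j j<q → from (body-correct φ e f ν l j) (h j j<q))

-- Non adjacency and arity

neg± : ℤ ± → ℤ ±
neg± ⊥±    = ⊤±
neg± ⊤±    = ⊥±
neg± [ z ] = [ ℤ.- z ]

neg±-involutive : ∀ z → neg± (neg± z) ≡ z
neg±-involutive ⊥±    = refl
neg±-involutive ⊤±    = refl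
neg±-involutive [ z ] = cong [_] (ℤ.neg-involutive z)

sup-negInterval : ∀ I → sup (negInterval I) ≡ neg± (inf I)
sup-negInterval (interval -∞ _ _)         = refl
sup-negInterval (interval (closed _) _ _) = refl
sup-negInterval (interval (open′ _) _ _)  = refl

inf-negInterval : ∀ I → inf (negInterval I) ≡ neg± (sup I)
inf-negInterval (interval _ +∞ _)         = refl
inf-negInterval (interval _ (closed _) _) = refl
inf-negInterval (interval _ (open′ _) _)  = refl

-- Negation exchanges infima and suprema, which reverses the ordered pair, and 0 is its own
-- negative.
negInterval-nonAdjacent : ∀ I J → NonAdjacent J I → NonAdjacent (negInterval I) (negInterval J)
negInterval-nonAdjacent I J na eq = begin
  sup (negInterval I) ≡⟨ eq ⟩
  inf (negInterval J) ≡⟨ inf-negInterval J ⟩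
  neg± (sup J)        ≡⟨ cong neg± (na sup≡inf) ⟩
  neg± [ ℤ.0ℤ ]       ∎
  where
  open ≡-Reasoning
  sup≡inf : sup J ≡ inf I
  sup≡inf = begin
    sup J                      ≡⟨ neg±-involutive (sup J) ⟨
    neg± (neg± (sup J))        ≡⟨ cong neg± (trans (sym (inf-negInterval J)) (trans (sym eq) (sup-negInterval I))) ⟩
    neg± (neg± (inf I))        ≡⟨ neg±-involutive (inf I) ⟩
    inf I                      ∎

everything-nonAdjacentˡ : ∀ J → NonAdjacent everything J
everything-nonAdjacentˡ (interval -∞ _ _) ()
everything-nonAdjacentˡ (interval (closed _) _ _) ()
everything-nonAdjacentˡ (interval (open′ _) _ _) ()

everything-nonAdjacentʳ : ∀ I → NonAdjacent I everything
everything-nonAdjacentʳ (interval _ +∞ _) ()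
everything-nonAdjacentʳ (interval _ (closed _) _) ()
everything-nonAdjacentʳ (interval _ (open′ _) _) ()

everything∷-nonAdjacent : ∀ {Is} → NonAdjacentSet Is → NonAdjacentSet (everything ∷ Is)
everything∷-nonAdjacent na {J = J} (here refl) _           = everything-nonAdjacentˡ J
everything∷-nonAdjacent na {I = I} (there I∈)  (here refl) = everything-nonAdjacentʳ I
everything∷-nonAdjacent na         (there I∈)  (there J∈)  = na I∈ J∈

toward-nonAdjacent : ∀ d {Is I J} → NonAdjacentSet Is → I ∈ Is → J ∈ Is → NonAdjacent (toward d I) (toward d J)
toward-nonAdjacent fut  na I∈ J∈ = na I∈ J∈
toward-nonAdjacent past {I = I} {J} na I∈ J∈ = negInterval-nonAdjacent I J (na J∈ I∈)

⋁-nonAdjacent : ∀ {m} (φs : List (PnEMTL m)) → (∀ φ → φ ∈ φs → NonAdjacentᴾ φ) → NonAdjacentᴾ (⋁ φs)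
⋁-nonAdjacent []       h = (λ { (here refl) (here refl) () }) , λ ()
⋁-nonAdjacent (φ ∷ φs) h = h φ (here refl) , ⋁-nonAdjacent φs λ χ χ∈ → h χ (there χ∈)

-- The bound must be at least 1 because `bottom` is itself a modality with one point.
⋁-arity : ∀ {m K} (φs : List (PnEMTL m)) → 1 ≤ K → (∀ φ → φ ∈ φs → arity φ ≤ K) → arity (⋁ φs) ≤ K
⋁-arity []       1≤K h = 1≤K
⋁-arity (φ ∷ φs) 1≤K h = ℕ.⊔-lub (h φ (here refl)) (⋁-arity φs 1≤K λ χ χ∈ → h χ (there χ∈))

-- Each use of `_∨ᴾ_` costs four connectives, charged to its left disjunct. The automata of `bottom`
-- have neither states nor transitions, so its size is 0.
⋁-size : ∀ {m M} (φs : List (PnEMTL m)) → (∀ φ → φ ∈ φs → sizeᴾ φ + 4 ≤ M) → sizeᴾ (⋁ φs) ≤ length φs * M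
⋁-size []       h = z≤n
⋁-size {M = M} (φ ∷ φs) h = begin
  suc (suc (suc (sizeᴾ φ) + suc (sizeᴾ (⋁ φs)))) ≡⟨ rearrange (sizeᴾ φ) (sizeᴾ (⋁ φs)) ⟩
  (sizeᴾ φ + 4) + sizeᴾ (⋁ φs)                   ≤⟨ ℕ.+-mono-≤ (h φ (here refl)) (⋁-size φs λ χ χ∈ → h χ (there χ∈)) ⟩
  M + length φs * M                              ∎
  where
  open ℕ.≤-Reasoning
  rearrange : ∀ a b → suc (suc (suc a + suc b)) ≡ (a + 4) + b
  rearrange = solve-∀

foldr-⊔-≤ : ∀ {K n} (g : Fin n → ℕ) → (∀ t → g t ≤ K) → foldr _⊔_ 0 (tabulate g) ≤ K
foldr-⊔-≤ {n = zero}  g h = z≤n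
foldr-⊔-≤ {n = suc n} g h = ℕ.⊔-lub (h Fin.zero) (foldr-⊔-≤ (g ∘ Fin.suc) (h ∘ Fin.suc))

sum-tabulate-≤ : ∀ {M n} (g : Fin n → ℕ) → (∀ t → g t ≤ M) → sum (tabulate g) ≤ n * M
sum-tabulate-≤ {n = zero}  g h = z≤n
sum-tabulate-≤ {n = suc n} g h = ℕ.+-mono-≤ (h Fin.zero) (sum-tabulate-≤ (g ∘ Fin.suc) (h ∘ Fin.suc))

module _ {m s : ℕ} (b : Body s) (Is : List Interval) (Θ : Fin s → PnEMTL m) where

  disjunct⁻ : ∀ {d t φ} → φ ∈ guesses b Is Θ d t →
              ∃ λ es → es ∈ entryVectors b Is Θ × φ ≡ guess b Is Θ d t es
  disjunct⁻ {d} {t} φ∈ with ∈-map⁻ (guess b Is Θ d t) φ∈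
  ... | es , es∈ , eq = es , proj₁ (∈-filter⁻ (admissible? b Is Θ d t) {xs = entryVectors b Is Θ} es∈) , eq

  entryVectors⁻ : ∀ es → es ∈ entryVectors b Is Θ → ∀ w → proj₁ (Vec.lookup es w) ∈ everything ∷ Is
  entryVectors⁻ es es∈ w = proj₁ (∈-cartesianProduct⁻ (everything ∷ Is) (allTy b) (∈-vecsOver⁻ es es∈ w))

  module _ (na : NonAdjacentSet Is) (naΘ : ∀ t → NonAdjacentᴾ (Θ t)) where

    guess-nonAdjacent : ∀ d t es → es ∈ entryVectors b Is Θ → NonAdjacentᴾ (guess b Is Θ d t es)
    guess-nonAdjacent d t es es∈ = wrap d set
      where
      set : NonAdjacentSet (tabulate (λ w → toward d (proj₁ (Vec.lookup es w))))
      set I∈ J∈ with ∈-tabulate⁻ {f = λ w → toward d (proj₁ (Vec.lookup es w))} I∈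
                   | ∈-tabulate⁻ {f = λ w → toward d (proj₁ (Vec.lookup es w))} J∈
      ... | v , refl | w , refl =
        toward-nonAdjacent d (everything∷-nonAdjacent na) (entryVectors⁻ es es∈ v) (entryVectors⁻ es es∈ w)
      wrap : ∀ d → NonAdjacentSet (tabulate (λ w → toward d (proj₁ (Vec.lookup es w)))) → NonAdjacentᴾ (guess b Is Θ d t es)
      wrap fut  h = h , naΘ
      wrap past h = h , naΘ

    half-nonAdjacent : ∀ d t → NonAdjacentᴾ (half b Is Θ d t)
    half-nonAdjacent d t = ⋁-nonAdjacent (guesses b Is Θ d t) each
      where
      each : ∀ φ → φ ∈ guesses b Is Θ d t → NonAdjacentᴾ φ
      each φ φ∈ with disjunct⁻ φ∈
      ... | es , es∈ , refl = guess-nonAdjacent d t es es∈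

    freeze-nonAdjacent : NonAdjacentᴾ (freeze b Is Θ)
    freeze-nonAdjacent = ⋁-nonAdjacent (map (bothHalves b Is Θ) (claiming b Is Θ)) each
      where
      each : ∀ φ → φ ∈ map (bothHalves b Is Θ) (claiming b Is Θ) → NonAdjacentᴾ φ
      each φ φ∈ with ∈-map⁻ (bothHalves b Is Θ) φ∈
      ... | t , _ , refl = half-nonAdjacent fut t , half-nonAdjacent past t

  module _ {K : ℕ} (len : suc (double (length Is)) ≤ K) (arΘ : ∀ t → arity (Θ t) ≤ K) where

    private
      1≤K : 1 ≤ K
      1≤K = ℕ.≤-trans (s≤s z≤n) len

    guess-arity : ∀ d t es → arity (guess b Is Θ d t es) ≤ K
    guess-arity fut  t es = ℕ.⊔-lub len (foldr-⊔-≤ (arity ∘ Θ) arΘ)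
    guess-arity past t es = ℕ.⊔-lub len (foldr-⊔-≤ (arity ∘ Θ) arΘ)

    half-arity : ∀ d t → arity (half b Is Θ d t) ≤ K
    half-arity d t = ⋁-arity (guesses b Is Θ d t) 1≤K each
      where
      each : ∀ φ → φ ∈ guesses b Is Θ d t → arity φ ≤ K
      each φ φ∈ with disjunct⁻ φ∈
      ... | es , _ , refl = guess-arity d t es

    freeze-arity : arity (freeze b Is Θ) ≤ K
    freeze-arity = ⋁-arity (map (bothHalves b Is Θ) (claiming b Is Θ)) 1≤K each
      where
      each : ∀ φ → φ ∈ map (bothHalves b Is Θ) (claiming b Is Θ) → arity φ ≤ K
      each φ φ∈ with ∈-map⁻ (bothHalves b Is Θ) φ∈
      ... | t , _ , refl = ℕ.⊔-lub (half-arity fut t) (half-arity past t)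

translate-nonAdjacent : ∀ {m} (φ : TPTL m) → NonAdjacentᵀ φ → NonAdjacentᴾ (translate φ)
leaf-nonAdjacent : ∀ {m} (φ : TPTL m) → NonAdjacentFreezes φ → ∀ t → NonAdjacentᴾ (leaf φ t)
translate-nonAdjacent φ (na , naF) = freeze-nonAdjacent (body φ id) (constraints φ) (leaf φ)
  (λ I∈ J∈ → na (∈-deduplicate⁻ _≟ⁱ_ (freeIntervals φ) I∈) (∈-deduplicate⁻ _≟ⁱ_ (freeIntervals φ) J∈))
  (leaf-nonAdjacent φ naF)
leaf-nonAdjacent (prop a)  _         t = tt
leaf-nonAdjacent (¬prop a) _         t = tt
leaf-nonAdjacent (x∙ φ)    na        t = translate-nonAdjacent φ na
leaf-nonAdjacent (φ ∧ χ)   (nφ , nχ) t = ++-∀ {P = NonAdjacentᴾ} (leaf-nonAdjacent φ nφ) (leaf-nonAdjacent χ nχ) t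
leaf-nonAdjacent (φ ∨ χ)   (nφ , nχ) t = ++-∀ {P = NonAdjacentᴾ} (leaf-nonAdjacent φ nφ) (leaf-nonAdjacent χ nχ) t
leaf-nonAdjacent (φ U χ)   (nφ , nχ) t = ++-∀ {P = NonAdjacentᴾ} (leaf-nonAdjacent φ nφ) (leaf-nonAdjacent χ nχ) t
leaf-nonAdjacent (φ S χ)   (nφ , nχ) t = ++-∀ {P = NonAdjacentᴾ} (leaf-nonAdjacent φ nφ) (leaf-nonAdjacent χ nχ) t
leaf-nonAdjacent (G φ)     na        t = leaf-nonAdjacent φ na t
leaf-nonAdjacent (H φ)     na        t = leaf-nonAdjacent φ na t

-- Pigeonhole: one occurrence of `x` is cut out of `ys`, and the other members of `xs`, all
-- different from `x`, still lie in what remains.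
unique-length-≤ : ∀ {A : Set} {xs ys : List A} → Unique xs → All (_∈ ys) xs → length xs ≤ length ys
unique-length-≤ [] [] = z≤n
unique-length-≤ {xs = x ∷ xs} (x≢ ∷ u) (x∈ ∷ xs∈) with ∈-∃++ x∈
... | as , bs , refl = ℕ.≤-trans (s≤s (unique-length-≤ u (All.zipWith drop (x≢ , xs∈))))
                                 (ℕ.≤-reflexive (sym (length-++-sucʳ as x bs)))
  where
  drop : ∀ {y} → ¬ (x ≡ y) × y ∈ as ++ x ∷ bs → y ∈ as ++ bs
  drop (x≢y , y∈) with ∈-++⁻ as y∈
  ... | inj₁ y∈as          = ∈-++⁺ˡ y∈as
  ... | inj₂ (here y≡x)    = ⊥-elim (x≢y (sym y≡x))
  ... | inj₂ (there y∈bs)  = ∈-++⁺ʳ as y∈bs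

double≡ : ∀ n → double n ≡ n + n
double≡ zero    = refl
double≡ (suc n) = cong suc (trans (cong suc (double≡ n)) (sym (ℕ.+-suc n n)))

module _ (Iν : List Interval) where

  -- Constraints on `x - T` contribute negated intervals, so twice the given number may occur.
  signed : List Interval
  signed = Iν ++ map negInterval Iν

  freeIntervals-signed : ∀ {m} (φ : TPTL m) → All (_∈ Iν) (intervals φ) → All (_∈ signed) (freeIntervals φ)
  freeIntervals-signed (prop a)  h = []
  freeIntervals-signed (¬prop a) h = []
  freeIntervals-signed true      h = []
  freeIntervals-signed false     h = []
  freeIntervals-signed (x∙ φ)    h = []
  freeIntervals-signed (T-x∈ I)  (I∈ ∷ []) = ∈-++⁺ˡ I∈ ∷ []
  freeIntervals-signed (x-T∈ I)  (I∈ ∷ []) = ∈-++⁺ʳ Iν (∈-map⁺ negInterval I∈) ∷ []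
  freeIntervals-signed (φ ∧ χ)   h = All.++⁺ (freeIntervals-signed φ (All.++⁻ˡ _ h)) (freeIntervals-signed χ (All.++⁻ʳ (intervals φ) h))
  freeIntervals-signed (φ ∨ χ)   h = All.++⁺ (freeIntervals-signed φ (All.++⁻ˡ _ h)) (freeIntervals-signed χ (All.++⁻ʳ (intervals φ) h))
  freeIntervals-signed (φ U χ)   h = All.++⁺ (freeIntervals-signed φ (All.++⁻ˡ _ h)) (freeIntervals-signed χ (All.++⁻ʳ (intervals φ) h))
  freeIntervals-signed (φ S χ)   h = All.++⁺ (freeIntervals-signed φ (All.++⁻ˡ _ h)) (freeIntervals-signed χ (All.++⁻ʳ (intervals φ) h))
  freeIntervals-signed (G φ)     h = freeIntervals-signed φ h
  freeIntervals-signed (H φ)     h = freeIntervals-signed φ h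

  length-signed : length signed ≡ length Iν + length Iν
  length-signed = trans (length-++ Iν) (cong (_+_ (length Iν)) (length-map negInterval Iν))

  arityBound : ℕ
  arityBound = suc (length signed + length signed)

  constraints-length : ∀ {m} (φ : TPTL m) → All (_∈ Iν) (intervals φ) → suc (double (length (constraints φ))) ≤ arityBound
  constraints-length φ h = s≤s (ℕ.≤-trans (ℕ.≤-reflexive (double≡ _)) (ℕ.+-mono-≤ le le))
    where
    le : length (constraints φ) ≤ length signed
    le = unique-length-≤ (Unique.deduplicate-! _≟ⁱ_ (freeIntervals φ))
           (All.tabulate λ I∈ → All.lookup (freeIntervals-signed φ h) (∈-deduplicate⁻ _≟ⁱ_ (freeIntervals φ) I∈))

  translate-arity : ∀ {m} (φ : TPTL m) → All (_∈ Iν) (intervals φ) → arity (translate φ) ≤ arityBound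
  leaf-arity : ∀ {m} (φ : TPTL m) → All (_∈ Iν) (intervals φ) → ∀ t → arity (leaf φ t) ≤ arityBound
  translate-arity φ h = freeze-arity (body φ id) (constraints φ) (leaf φ) (constraints-length φ h) (leaf-arity φ h)
  leaf-arity (prop a)  h t = z≤n
  leaf-arity (¬prop a) h t = z≤n
  leaf-arity (x∙ φ)    h t = translate-arity φ h
  leaf-arity (φ ∧ χ)   h t = ++-∀ {P = λ θ → arity θ ≤ arityBound} (leaf-arity φ (All.++⁻ˡ _ h)) (leaf-arity χ (All.++⁻ʳ (intervals φ) h)) t
  leaf-arity (φ ∨ χ)   h t = ++-∀ {P = λ θ → arity θ ≤ arityBound} (leaf-arity φ (All.++⁻ˡ _ h)) (leaf-arity χ (All.++⁻ʳ (intervals φ) h)) t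
  leaf-arity (φ U χ)   h t = ++-∀ {P = λ θ → arity θ ≤ arityBound} (leaf-arity φ (All.++⁻ˡ _ h)) (leaf-arity χ (All.++⁻ʳ (intervals φ) h)) t
  leaf-arity (φ S χ)   h t = ++-∀ {P = λ θ → arity θ ≤ arityBound} (leaf-arity φ (All.++⁻ˡ _ h)) (leaf-arity χ (All.++⁻ʳ (intervals φ) h)) t
  leaf-arity (G φ)     h t = leaf-arity φ h t
  leaf-arity (H φ)     h t = leaf-arity φ h t

  -- The bound is 4n + 1 for n given intervals, at most 5n^2 once n is positive. For n = 0 the spare
  -- point leaves arity 1, whence the maximum with 1.
  arityBound-≤ : arityBound ≤ 5 * (1 ⊔ length Iν ^ 2)
  arityBound-≤ = go (length Iν) (length signed) length-signed
    where
    go : ∀ n k → k ≡ n + n → suc (k + k) ≤ 5 * (1 ⊔ n ^ 2)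
    go n k refl with n
    ... | zero  = s≤s z≤n
    ... | suc l = ℕ.≤-trans (ℕ.≤-trans (ℕ.m≤m+n _ (6 * l + 5 * (l * l))) (ℕ.≤-reflexive (eq l)))
                            (ℕ.*-monoʳ-≤ 5 (ℕ.m≤n⊔m 1 (suc l ^ 2)))
      where
      eq : ∀ l → suc (((suc l) + (suc l)) + ((suc l) + (suc l))) + (6 * l + 5 * (l * l)) ≡ 5 * (suc l * (suc l * 1))
      eq = solve-∀

-- Size

length-cartesianProductWith : ∀ {A B C : Set} (f : A → B → C) xs ys →
                              length (cartesianProductWith f xs ys) ≡ length xs * length ys
length-cartesianProductWith f []       ys = refl
length-cartesianProductWith f (x ∷ xs) ys = trans (length-++ (map (f x) ys))
  (cong₂ _+_ (length-map (f x) ys) (length-cartesianProductWith f xs ys))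

length-vecsOver : ∀ {A : Set} (xs : List A) k → length (vecsOver xs k) ≡ length xs ^ k
length-vecsOver xs zero    = refl
length-vecsOver xs (suc k) = trans (length-cartesianProductWith _∷_ xs (vecsOver xs k))
                                   (cong (length xs *_) (length-vecsOver xs k))

occurrences : ∀ {s} → Body s → ℕ
occurrences (lit _)       = 1
occurrences (clk _)       = 1
occurrences (b and c)     = suc (occurrences b + occurrences c)
occurrences (b or c)      = suc (occurrences b + occurrences c)
occurrences (until _ b c) = suc (occurrences b + occurrences c)
occurrences (always _ b)  = suc (occurrences b)

length-allTy : ∀ {s} (b : Body s) → length (allTy b) ≡ 2 ^ occurrences b
length-allTy b = trans (length-cartesianProductWith _,_ (true ∷ false ∷ []) (allSub b)) (sub b)
  where
  pair : ∀ {s} (b c : Body s) → 2 * length (cartesianProduct (allTy b) (allTy c)) ≡ 2 ^ suc (occurrences b + occurrences c)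
  pair b c = cong (2 *_) (trans (length-cartesianProductWith _,_ (allTy b) (allTy c))
    (trans (cong₂ _*_ (length-allTy b) (length-allTy c)) (sym (ℕ.^-distribˡ-+-* 2 (occurrences b) (occurrences c)))))
  sub : ∀ {s} (b : Body s) → 2 * length (allSub b) ≡ 2 ^ occurrences b
  sub (lit _)       = refl
  sub (clk _)       = refl
  sub (b and c)     = pair b c
  sub (b or c)      = pair b c
  sub (until _ b c) = pair b c
  sub (always _ b)  = cong (2 *_) (length-allTy b)

module AutomatonSize {s : ℕ} {Q : Set} (qs : List Q) (complete : ∀ q → q ∈ qs)
                     {Step : Q → Subset s → Q → Set} (step? : ∀ q a q′ → Dec (Step q a q′))
                     {Stop : Q → Subset s → Set} (stop? : ∀ q a → Dec (Stop q a)) where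
  open Automaton qs complete step? stop?

  automaton-size : ∀ q₀ → sizeᴬ (automaton q₀) ≤ suc (length qs) + suc (length qs) * (2 ^ s * suc (length qs))
  automaton-size q₀ = ℕ.+-monoʳ-≤ k (ℕ.≤-trans (length-filter transition? edges) (ℕ.≤-reflexive edges≡))
    where
    open ≡-Reasoning
    k = suc (length qs)
    states≡ : length (allFin k) ≡ k
    states≡ = length-tabulate {n = k} id
    edges≡ : length edges ≡ k * (2 ^ s * k)
    edges≡ = begin
      length edges
        ≡⟨ length-cartesianProductWith _,_ (allFin k) (cartesianProduct (subsets s) (allFin k)) ⟩
      length (allFin k) * length (cartesianProduct (subsets s) (allFin k))
        ≡⟨ cong₂ _*_ states≡ (length-cartesianProductWith _,_ (subsets s) (allFin k)) ⟩
      k * (length (subsets s) * length (allFin k))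
        ≡⟨ cong (k *_) (cong₂ _*_ (length-vecsOver (true ∷ false ∷ []) s) states≡) ⟩
      k * (2 ^ s * k)
        ∎

automata-size : ∀ {s} (b : Body s) d {k} seen t (es : Vec (Interval × Ty b) k) w →
  sizeᴬ (Halves.automata b d seen t es w) ≤ suc (length (allTy b)) + suc (length (allTy b)) * (2 ^ s * suc (length (allTy b)))
automata-size b d seen t []              Fin.zero    =
  AutomatonSize.automaton-size (allTy b) (∈-allTy b) (Halves.step? b d seen []) (Halves.stop? b d seen) t
automata-size b d seen t ((I , t′) ∷ es) Fin.zero    =
  AutomatonSize.automaton-size (allTy b) (∈-allTy b) (Halves.step? b d seen (I ∷ pending es)) (λ t _ → _≟ᵗ_ {b = b} t t′) t
automata-size b d seen t ((I , t′) ∷ es) (Fin.suc w) = automata-size b d (I ∷ seen) t′ es w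

n≤2^n : ∀ n → n ≤ 2 ^ n
n≤2^n zero    = z≤n
n≤2^n (suc n) = ℕ.+-mono-≤ (ℕ.m^n>0 2 n) (ℕ.≤-trans (n≤2^n n) (ℕ.m≤m+n _ 0))

*-≤2^ : ∀ {a b x y} → a ≤ 2 ^ x → b ≤ 2 ^ y → a * b ≤ 2 ^ (x + y)
*-≤2^ {x = x} {y} a≤ b≤ = ℕ.≤-trans (ℕ.*-mono-≤ a≤ b≤) (ℕ.≤-reflexive (sym (ℕ.^-distribˡ-+-* 2 x y)))

+-≤2^ : ∀ {a b x} → a ≤ 2 ^ x → b ≤ 2 ^ x → a + b ≤ 2 ^ suc x
+-≤2^ {x = x} a≤ b≤ = ℕ.+-mono-≤ a≤ (ℕ.≤-trans b≤ (ℕ.m≤m+n _ 0))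

weaken-≤2^ : ∀ {a} x y → a ≤ 2 ^ x → x ≤ y → a ≤ 2 ^ y
weaken-≤2^ x y a≤ x≤y = ℕ.≤-trans a≤ (ℕ.^-monoʳ-≤ 2 {x} {y} x≤y)

by-slack : ∀ {a b} k → a + k ≡ b → a ≤ b
by-slack {a} k eq = ℕ.≤-trans (ℕ.m≤m+n a k) (ℕ.≤-reflexive eq)

-- X bounds the number of leaves and intervals of a formula of size at most n.
module SizeBound (n : ℕ) where

  X : ℕ
  X = suc n

  -- The letters are measured by the exponent `v`, and the bounds for formulas have the form
  -- `2 ^ (v + ...)`: nesting adds exponents, which keeps the blow-up singly exponential.
  module _ {m s : ℕ} (b : Body s) (Is : List Interval) (Θ : Fin s → PnEMTL m) (v : ℕ)
           (occ≤ : occurrences b ≤ 2 * X) (s≤ : s ≤ X) (Is≤ : length Is ≤ X) (Θ≤ : ∀ t → sizeᴾ (Θ t) ≤ 2 ^ v) where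

    types-≤ : length (allTy b) ≤ 2 ^ (2 * X)
    types-≤ = ℕ.≤-trans (ℕ.≤-reflexive (length-allTy b)) (ℕ.^-monoʳ-≤ 2 {occurrences b} {2 * X} occ≤)

    points-≤ : suc (double (length Is)) ≤ 3 * X
    points-≤ = ℕ.≤-trans (s≤s (ℕ.≤-trans (ℕ.≤-reflexive (double≡ (length Is))) (ℕ.+-mono-≤ Is≤ Is≤))) (by-slack n (eq n))
      where
      eq : ∀ n → suc (suc n + suc n) + n ≡ 3 * suc n
      eq = solve-∀

    entries-≤ : length (cartesianProduct (everything ∷ Is) (allTy b)) ≤ 2 ^ (4 * X)
    entries-≤ = ℕ.≤-trans (ℕ.≤-reflexive (length-cartesianProductWith _,_ (everything ∷ Is) (allTy b)))
      (weaken-≤2^ (suc X + 2 * X) (4 * X) (*-≤2^ {x = suc X} {2 * X} (ℕ.≤-trans (s≤s Is≤) (n≤2^n (suc X))) types-≤) (by-slack n (eq n)))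
      where
      eq : ∀ n → suc (suc n) + 2 * suc n + n ≡ 4 * suc n
      eq = solve-∀

    -- The source of the square: at most 3X entries are chosen, each in at most 2^(4X) ways.
    vectors-≤ : length (entryVectors b Is Θ) ≤ 2 ^ (12 * (X * X))
    vectors-≤ = begin
      length (entryVectors b Is Θ)                     ≡⟨ length-vecsOver (cartesianProduct (everything ∷ Is) (allTy b)) K ⟩
      length (cartesianProduct (everything ∷ Is) (allTy b)) ^ K ≤⟨ ℕ.^-monoˡ-≤ K entries-≤ ⟩
      (2 ^ (4 * X)) ^ K                                ≡⟨ ℕ.^-*-assoc 2 (4 * X) K ⟩
      2 ^ (4 * X * K)                                  ≤⟨ ℕ.^-monoʳ-≤ 2 {4 * X * K} {4 * X * (3 * X)} (ℕ.*-monoʳ-≤ (4 * X) points-≤) ⟩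
      2 ^ (4 * X * (3 * X))                            ≡⟨ cong (2 ^_) (eq X) ⟩
      2 ^ (12 * (X * X))                               ∎
      where
      open ℕ.≤-Reasoning
      K = suc (double (length Is))
      eq : ∀ x → 4 * x * (3 * x) ≡ 12 * (x * x)
      eq = solve-∀

    -- With at most 2^(2X+1) states and 2^X letters there are at most 2^(5X+2) transitions; adding
    -- the states costs one more in the exponent.
    automata-≤ : ∀ d t es w → sizeᴬ (Halves.automata b d {suc (double (length Is))} [] t es w) ≤ 2 ^ (8 * X)
    automata-≤ d t es w = ℕ.≤-trans (automata-size b d [] t es w)
      (weaken-≤2^ (suc (suc (2 * X) + (X + suc (2 * X)))) (8 * X)
        (+-≤2^ {x = suc (2 * X) + (X + suc (2 * X))} (weaken-≤2^ (suc (2 * X)) (suc (2 * X) + (X + suc (2 * X))) states-≤ (ℕ.m≤m+n _ _))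
                    (*-≤2^ {x = suc (2 * X)} {X + suc (2 * X)} states-≤
                      (*-≤2^ {x = X} {suc (2 * X)} (ℕ.^-monoʳ-≤ 2 {s} {X} s≤) states-≤))) (by-slack (3 * n) (eq n)))
      where
      states-≤ : suc (length (allTy b)) ≤ 2 ^ suc (2 * X)
      states-≤ = +-≤2^ {1} {x = 2 * X} (ℕ.m^n>0 2 (2 * X)) types-≤
      eq : ∀ n → suc (suc (2 * suc n) + (suc n + suc (2 * suc n))) + 3 * n ≡ 8 * suc n
      eq = solve-∀

    -- The 4 is the price of a disjunct in `⋁-size`. The letters contribute 2^(X+v) and the at most
    -- 3X + 1 automata 2^(4X+8X); both are below 2^(v+13X), and two further doublings take in their
    -- sum and the 4.
    guess-≤ : ∀ d t es → sizeᴾ (guess b Is Θ d t es) + 4 ≤ 2 ^ (v + 15 * X)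
    guess-≤ d t es = ℕ.≤-trans (ℕ.+-monoˡ-≤ 4 (unfold d))
      (weaken-≤2^ (suc (suc (v + 13 * X))) (v + 15 * X)
        (+-≤2^ {x = suc (v + 13 * X)} sums-≤ (weaken-≤2^ 2 (suc (v + 13 * X)) ℕ.≤-refl (by-slack (v + (13 * n + 12)) (eq₁ v n))))
                  (by-slack (2 * n) (eq₂ v n)))
      where
      A = Halves.automata b d [] t es
      unfold : ∀ d → sizeᴾ (guess b Is Θ d t es) ≤ sum (tabulate (sizeᴾ ∘ Θ)) + sum (tabulate λ w → sizeᴬ (Halves.automata b d [] t es w))
      unfold fut  = ℕ.≤-refl
      unfold past = ℕ.≤-refl
      automata-count : suc (suc (double (length Is))) ≤ 2 ^ (4 * X)
      automata-count = ℕ.≤-trans (s≤s points-≤) (ℕ.≤-trans (n≤2^n (suc (3 * X))) (ℕ.^-monoʳ-≤ 2 {suc (3 * X)} {4 * X} (by-slack n (eq n))))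
        where
        eq : ∀ n → suc (3 * suc n) + n ≡ 4 * suc n
        eq = solve-∀
      sums-≤ : sum (tabulate (sizeᴾ ∘ Θ)) + sum (tabulate (sizeᴬ ∘ A)) ≤ 2 ^ suc (v + 13 * X)
      sums-≤ = +-≤2^ {x = v + 13 * X}
        (ℕ.≤-trans (sum-tabulate-≤ (sizeᴾ ∘ Θ) Θ≤)
          (weaken-≤2^ (X + v) (v + 13 * X) (*-≤2^ {x = X} {v} (ℕ.≤-trans s≤ (n≤2^n X)) ℕ.≤-refl) (by-slack (12 * X) (eq₃ v X))))
        (ℕ.≤-trans (sum-tabulate-≤ (sizeᴬ ∘ A) (automata-≤ d t es))
          (weaken-≤2^ (4 * X + 8 * X) (v + 13 * X) (*-≤2^ {x = 4 * X} {8 * X} automata-count ℕ.≤-refl) (by-slack (v + X) (eq₄ v X))))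
        where
        eq₃ : ∀ v x → x + v + 12 * x ≡ v + 13 * x
        eq₃ = solve-∀
        eq₄ : ∀ v x → 4 * x + 8 * x + (v + x) ≡ v + 13 * x
        eq₄ = solve-∀
      eq₁ : ∀ v n → 2 + (v + (13 * n + 12)) ≡ suc (v + 13 * suc n)
      eq₁ = solve-∀
      eq₂ : ∀ v n → suc (suc (v + 13 * suc n)) + 2 * n ≡ v + 15 * suc n
      eq₂ = solve-∀

    half-≤ : ∀ d t → sizeᴾ (half b Is Θ d t) ≤ 2 ^ (v + 27 * (X * X))
    half-≤ d t = ℕ.≤-trans (⋁-size (guesses b Is Θ d t) each)
      (weaken-≤2^ (12 * (X * X) + (v + 15 * X)) (v + 27 * (X * X))
        (*-≤2^ {x = 12 * (X * X)} {v + 15 * X} (ℕ.≤-trans count vectors-≤) ℕ.≤-refl)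
        (by-slack (15 * (X * n)) (eq v n)))
      where
      each : ∀ φ → φ ∈ guesses b Is Θ d t → sizeᴾ φ + 4 ≤ 2 ^ (v + 15 * X)
      each φ φ∈ with disjunct⁻ b Is Θ φ∈
      ... | es , _ , refl = guess-≤ d t es
      count : length (guesses b Is Θ d t) ≤ length (entryVectors b Is Θ)
      count = ℕ.≤-trans (ℕ.≤-reflexive (length-map (guess b Is Θ d t) (filter (admissible? b Is Θ d t) (entryVectors b Is Θ))))
                        (length-filter (admissible? b Is Θ d t) (entryVectors b Is Θ))
      eq : ∀ v n → 12 * (suc n * suc n) + (v + 15 * suc n) + 15 * (suc n * n) ≡ v + 27 * (suc n * suc n)
      eq = solve-∀

    -- There are at most 2^(2X) disjuncts, each with two halves. Doubling for the second half and
    -- for the connectives adds 3 to the exponent, and 2X + 3 is at most 5X^2 since X is positive.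
    freeze-≤ : sizeᴾ (freeze b Is Θ) ≤ 2 ^ (v + 32 * (X * X))
    freeze-≤ = ℕ.≤-trans (⋁-size (map (bothHalves b Is Θ) (claiming b Is Θ)) each)
      (weaken-≤2^ (2 * X + suc (suc (suc (v + 27 * (X * X))))) (v + 32 * (X * X))
        (*-≤2^ {x = 2 * X} {suc (suc (suc (v + 27 * (X * X))))} (ℕ.≤-trans count types-≤) ℕ.≤-refl)
                  (by-slack (5 * (n * n) + 8 * n) (eq v n)))
      where
      u = v + 27 * (X * X)
      each : ∀ φ → φ ∈ map (bothHalves b Is Θ) (claiming b Is Θ) → sizeᴾ φ + 4 ≤ 2 ^ suc (suc (suc u))
      each φ φ∈ with ∈-map⁻ (bothHalves b Is Θ) φ∈
      ... | t , _ , refl = ℕ.≤-trans (ℕ.≤-reflexive (sym (ℕ.+-suc (sizeᴾ (half b Is Θ fut t) + sizeᴾ (half b Is Θ past t)) 4)))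
        (+-≤2^ {x = suc (suc u)} (weaken-≤2^ (suc u) (suc (suc u)) (+-≤2^ {x = u} (half-≤ fut t) (half-≤ past t)) (ℕ.n≤1+n (suc u)))
               (ℕ.≤-trans (ℕ.m≤m+n 5 3) (ℕ.^-monoʳ-≤ 2 {3} {suc (suc u)} (by-slack (v + 26 + 27 * (n * n) + 54 * n) (eq₀ v n)))))
        where
        eq₀ : ∀ v n → 3 + (v + 26 + 27 * (n * n) + 54 * n) ≡ suc (suc (v + 27 * (suc n * suc n)))
        eq₀ = solve-∀
      count : length (map (bothHalves b Is Θ) (claiming b Is Θ)) ≤ length (allTy b)
      count = ℕ.≤-trans (ℕ.≤-reflexive (length-map (bothHalves b Is Θ) (claiming b Is Θ)))
                        (length-filter (λ t → Bool.T? (proj₁ t)) (allTy b))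
      eq : ∀ v n → 2 * suc n + suc (suc (suc (v + 27 * (suc n * suc n)))) + (5 * (n * n) + 8 * n) ≡ v + 32 * (suc n * suc n)
      eq = solve-∀

leaves-≤ : ∀ {m} (φ : TPTL m) → leaves φ ≤ suc (sizeᵀ φ)
binary-leaves-≤ : ∀ {m} (φ χ : TPTL m) → leaves φ + leaves χ ≤ suc (suc (sizeᵀ φ + sizeᵀ χ))
leaves-≤ (prop a)  = ℕ.≤-refl
leaves-≤ (¬prop a) = s≤s z≤n
leaves-≤ true      = z≤n
leaves-≤ false     = z≤n
leaves-≤ (x∙ φ)    = s≤s z≤n
leaves-≤ (T-x∈ I)  = z≤n
leaves-≤ (x-T∈ I)  = z≤n
leaves-≤ (φ ∧ χ)   = binary-leaves-≤ φ χ
leaves-≤ (φ ∨ χ)   = binary-leaves-≤ φ χ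
leaves-≤ (φ U χ)   = binary-leaves-≤ φ χ
leaves-≤ (φ S χ)   = binary-leaves-≤ φ χ
leaves-≤ (G φ)     = ℕ.m≤n⇒m≤1+n (leaves-≤ φ)
leaves-≤ (H φ)     = ℕ.m≤n⇒m≤1+n (leaves-≤ φ)
binary-leaves-≤ φ χ = ℕ.≤-trans (ℕ.+-mono-≤ (leaves-≤ φ) (leaves-≤ χ)) (ℕ.≤-reflexive (cong suc (ℕ.+-suc _ _)))

freeIntervals-≤ : ∀ {m} (φ : TPTL m) → length (freeIntervals φ) ≤ suc (sizeᵀ φ)
binary-freeIntervals-≤ : ∀ {m} (φ χ : TPTL m) → length (freeIntervals φ ++ freeIntervals χ) ≤ suc (suc (sizeᵀ φ + sizeᵀ χ))
freeIntervals-≤ (prop a)  = z≤n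
freeIntervals-≤ (¬prop a) = z≤n
freeIntervals-≤ true      = z≤n
freeIntervals-≤ false     = z≤n
freeIntervals-≤ (x∙ φ)    = z≤n
freeIntervals-≤ (T-x∈ I)  = ℕ.≤-refl
freeIntervals-≤ (x-T∈ I)  = ℕ.≤-refl
freeIntervals-≤ (φ ∧ χ)   = binary-freeIntervals-≤ φ χ
freeIntervals-≤ (φ ∨ χ)   = binary-freeIntervals-≤ φ χ
freeIntervals-≤ (φ U χ)   = binary-freeIntervals-≤ φ χ
freeIntervals-≤ (φ S χ)   = binary-freeIntervals-≤ φ χ
freeIntervals-≤ (G φ)     = ℕ.m≤n⇒m≤1+n (freeIntervals-≤ φ)
freeIntervals-≤ (H φ)     = ℕ.m≤n⇒m≤1+n (freeIntervals-≤ φ)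
binary-freeIntervals-≤ φ χ = ℕ.≤-trans (ℕ.≤-reflexive (length-++ (freeIntervals φ)))
  (ℕ.≤-trans (ℕ.+-mono-≤ (freeIntervals-≤ φ) (freeIntervals-≤ χ)) (ℕ.≤-reflexive (cong suc (ℕ.+-suc _ _))))

occurrences-≤ : ∀ {m s} (φ : TPTL m) (e : Fin (leaves φ) → Fin s) → occurrences (body φ e) ≤ suc (2 * sizeᵀ φ)
binary-occurrences-≤ : ∀ {m s} (φ χ : TPTL m) (e : Fin (leaves φ) → Fin s) (e′ : Fin (leaves χ) → Fin s) →
  suc (occurrences (body φ e) + occurrences (body χ e′)) ≤ suc (2 * suc (sizeᵀ φ + sizeᵀ χ))
unary-occurrences-≤ : ∀ {m s} (φ : TPTL m) (e : Fin (leaves φ) → Fin s) → suc (occurrences (body φ e)) ≤ suc (2 * suc (sizeᵀ φ))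
occurrences-≤ (prop a)  e = s≤s z≤n
occurrences-≤ (¬prop a) e = s≤s z≤n
occurrences-≤ true      e = s≤s z≤n
occurrences-≤ false     e = s≤s z≤n
occurrences-≤ (x∙ φ)    e = s≤s z≤n
occurrences-≤ (T-x∈ I)  e = s≤s z≤n
occurrences-≤ (x-T∈ I)  e = s≤s z≤n
occurrences-≤ (φ ∧ χ)   e = binary-occurrences-≤ φ χ _ _
occurrences-≤ (φ ∨ χ)   e = binary-occurrences-≤ φ χ _ _
occurrences-≤ (φ U χ)   e = binary-occurrences-≤ φ χ _ _
occurrences-≤ (φ S χ)   e = binary-occurrences-≤ φ χ _ _
occurrences-≤ (G φ)     e = unary-occurrences-≤ φ e
occurrences-≤ (H φ)     e = unary-occurrences-≤ φ e
binary-occurrences-≤ φ χ e e′ = ℕ.≤-trans (s≤s (ℕ.+-mono-≤ (occurrences-≤ φ e) (occurrences-≤ χ e′)))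
                                          (ℕ.≤-reflexive (eq (sizeᵀ φ) (sizeᵀ χ)))
  where
  eq : ∀ a b → suc (suc (2 * a) + suc (2 * b)) ≡ suc (2 * suc (a + b))
  eq = solve-∀
unary-occurrences-≤ φ e = ℕ.≤-trans (s≤s (occurrences-≤ φ e)) (by-slack 1 (eq (sizeᵀ φ)))
  where
  eq : ∀ a → suc (suc (2 * a)) + 1 ≡ suc (2 * suc a)
  eq = solve-∀

module _ (n : ℕ) where
  open SizeBound n

  -- `X` stays that of the whole formula during the descent, so every freeze adds the same amount to
  -- the exponent. The factor `k` bounds the nesting by the size of the subformula, which works
  -- because a freeze quantifier counts 1.
  level : ℕ → ℕ
  level k = k * (32 * (X * X))

  translate-≤ : ∀ {m} (φ : TPTL m) → sizeᵀ φ ≤ n → sizeᴾ (translate φ) ≤ 2 ^ level (suc (sizeᵀ φ))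
  leaf-≤ : ∀ {m} (φ : TPTL m) k → sizeᵀ φ ≤ n → sizeᵀ φ ≤ k → ∀ t → sizeᴾ (leaf φ t) ≤ 2 ^ level k
  binary-leaf-≤ : ∀ {m} (φ χ : TPTL m) k → suc (sizeᵀ φ + sizeᵀ χ) ≤ n → suc (sizeᵀ φ + sizeᵀ χ) ≤ k →
                  ∀ t → sizeᴾ ((leaf φ Vector.++ leaf χ) t) ≤ 2 ^ level k
  translate-≤ φ φ≤n = weaken-≤2^ (level (sizeᵀ φ) + 32 * (X * X)) (level (suc (sizeᵀ φ)))
    (freeze-≤ (body φ id) (constraints φ) (leaf φ) (level (sizeᵀ φ))
      (ℕ.≤-trans (occurrences-≤ φ id) (ℕ.≤-trans (s≤s (ℕ.*-monoʳ-≤ 2 φ≤n)) (by-slack 1 (eq n))))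
      (ℕ.≤-trans (leaves-≤ φ) (s≤s φ≤n))
      (ℕ.≤-trans (length-deduplicate _≟ⁱ_ (freeIntervals φ)) (ℕ.≤-trans (freeIntervals-≤ φ) (s≤s φ≤n)))
      (leaf-≤ φ (sizeᵀ φ) φ≤n ℕ.≤-refl))
    (ℕ.≤-reflexive (ℕ.+-comm (level (sizeᵀ φ)) (32 * (X * X))))
    where
    eq : ∀ n → suc (2 * n) + 1 ≡ 2 * suc n
    eq = solve-∀
  leaf-≤ (prop a)  k _ _ t = ℕ.m^n>0 2 (level k)
  leaf-≤ (¬prop a) k _ _ t = ℕ.m^n>0 2 (level k)
  leaf-≤ (x∙ φ)    k φ<n φ<k t = weaken-≤2^ (level (suc (sizeᵀ φ))) (level k) (translate-≤ φ (ℕ.<⇒≤ φ<n)) (ℕ.*-monoˡ-≤ (32 * (X * X)) φ<k)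
  leaf-≤ (φ ∧ χ)   = binary-leaf-≤ φ χ
  leaf-≤ (φ ∨ χ)   = binary-leaf-≤ φ χ
  leaf-≤ (φ U χ)   = binary-leaf-≤ φ χ
  leaf-≤ (φ S χ)   = binary-leaf-≤ φ χ
  leaf-≤ (G φ)     k φ<n φ<k = leaf-≤ φ k (ℕ.<⇒≤ φ<n) (ℕ.<⇒≤ φ<k)
  leaf-≤ (H φ)     k φ<n φ<k = leaf-≤ φ k (ℕ.<⇒≤ φ<n) (ℕ.<⇒≤ φ<k)
  binary-leaf-≤ φ χ k ≤n ≤k = ++-∀ {P = λ θ → sizeᴾ θ ≤ 2 ^ level k}
    (leaf-≤ φ k (ℕ.≤-trans left ≤n) (ℕ.≤-trans left ≤k)) (leaf-≤ χ k (ℕ.≤-trans right ≤n) (ℕ.≤-trans right ≤k))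
    where
    left : sizeᵀ φ ≤ suc (sizeᵀ φ + sizeᵀ χ)
    left = ℕ.m≤n⇒m≤1+n (ℕ.m≤m+n _ _)
    right : sizeᵀ χ ≤ suc (sizeᵀ φ + sizeᵀ χ)
    right = ℕ.m≤n⇒m≤1+n (ℕ.m≤n+m _ _)

-- The coefficients of 32 (n + 1)^3: up to n + 1 levels, each adding 32 (n + 1)^2.
sizePolynomial : List ℕ
sizePolynomial = 32 ∷ 96 ∷ 96 ∷ 32 ∷ []

sizePolynomial-cube : ∀ n → level n (suc n) ≡ evalPoly sizePolynomial n
sizePolynomial-cube = expand
  where
  expand : ∀ n → suc n * (32 * (suc n * suc n)) ≡ 32 + n * (96 + n * (96 + n * (32 + n * 0)))
  expand = solve-∀

translate-size : ∀ {m} (ψ : TPTL m) → sizeᴾ (translate ψ) ≤ 2 ^ evalPoly sizePolynomial (sizeᵀ ψ)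
translate-size ψ = weaken-≤2^ (level (sizeᵀ ψ) (suc (sizeᵀ ψ))) (evalPoly sizePolynomial (sizeᵀ ψ))
  (translate-≤ (sizeᵀ ψ) ψ ℕ.≤-refl) (ℕ.≤-reflexive (sizePolynomial-cube (sizeᵀ ψ)))

translate-arity-≤ : ∀ Iν {m} (ψ : TPTL m) → All (_∈ Iν) (intervals ψ) → arity (translate ψ) ≤ 5 * (1 ⊔ length Iν ^ 2)
translate-arity-≤ Iν ψ ψ∈ = ℕ.≤-trans (translate-arity Iν ψ ψ∈) (arityBound-≤ Iν)

-- The same timed word serves both sides. The translation freezes the clock at the first position,
-- which changes nothing there: the time is 0, the initial value of the clock.
translate-satisfiable : ∀ {m} (ψ : TPTL m) (ℝ : CompleteOrderedField) →
                        Semantics.Satisfiableᵀ ℝ ψ ⇔ Semantics.Satisfiableᴾ ℝ (translate ψ)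
translate-satisfiable {m} ψ ℝ = mk⇔ (λ (ρ , h) → ρ , Equivalence.from (at-start ρ) h) (λ (ρ , h) → ρ , Equivalence.to (at-start ρ) h)
  where
  open Semantics ℝ
  open CompleteOrderedField ℝ using (0#) renaming (sym to ≈-sym)
  at-start : (ρ : TimedWord m) → (ρ , first ρ ⊨ᴾ translate ψ) ⇔ (ρ , first ρ , 0# ⊨ᵀ ψ)
  at-start ρ = TranslationCorrect.translate-correct ℝ ρ ψ (first ρ) 0# (≈-sym (τ-start ρ))

theorem5 : ∃₂ λ (p : List ℕ) (C : ℕ) →
    (Iν : List Interval) → Unique Iν →
    ∀ {m} (ψ : TPTL m) → NonAdjacentᵀ ψ → All (_∈ Iν) (intervals ψ) →
    ∃₂ λ (m′ : ℕ) (φ : PnEMTL m′) →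
    NonAdjacentᴾ φ
    × sizeᴾ φ ≤ 2 ^ evalPoly p (sizeᵀ ψ)
    × arity φ ≤ C * (1 ⊔ length Iν ^ 2)
    × ((ℝ : CompleteOrderedField) →
    Semantics.Satisfiableᵀ ℝ ψ ⇔ Semantics.Satisfiableᴾ ℝ φ)
theorem5 = sizePolynomial , 5 , λ Iν _ {m} ψ na ψ∈ →
  m , translate ψ , translate-nonAdjacent ψ na , translate-size ψ , translate-arity-≤ Iν ψ ψ∈ , translate-satisfiable ψ
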